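{- For all integers $3\le s\le t$, $\mathrm{ex}(n,\mathcal F_{1,s,t})=O\!\left(n^{1+\frac{s^2+1}{2s+2s^2}}\right)$; that is, there is a constant $C=C(s,t)$ such that every $n$-vertex graph containing no member of $\mathcal F_{1,s,t}$ as a subgraph has at most $C\,n^{1+\frac{s^2+1}{2s+2s^2}}$ edges.
   Context: For a family $\mathcal F$ of graphs, $\mathrm{ex}(n,\mathcal F)$ is the maximum number of edges in an $n$-vertex graph containing no (not necessarily induced) subgraph isomorphic to a member of $\mathcal F$. The family $\mathcal F_{1,s,t}$ is defined as follows. Start with the $1$-subdivision of the complete bipartite graph $K_{s,t}$: take vertices $y_1,\dots,y_s$ and $z_1,\dots,z_t$, and for every $i\in\{1,\dots,s\}$, $j\in\{1,\dots,t\}$ add a new vertex $b_{ij}$ adjacent to exactly $y_i$ and $z_j$. Add a further new vertex $r$. Then, one by one for each of the vertices $w\in\{y_1,\dots,y_s,z_1,\dots,z_t\}$, select a vertex $b$ which is either one of the vertices $b_{ij}$, or a brand new vertex, or a vertex that was added as a new vertex at an earlier step of this process, and join $b$ to $w$ and to $r$ (edges already present are not duplicated). $\mathcal F_{1,s,t}$ is the (finite) family of all bipartite graphs obtainable in this way. In particular it contains the $1$-subdivision of the complete tripartite graph $K_{1,s,t}$ (obtained by always choosing a brand new vertex). Here the $1$-subdivision of a graph replaces every edge by a path of length two. -}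

module Defs where

open import Data.Nat using (ℕ; _<ᵇ_; _+_; _*_; _^_; _≤_)
open import Data.Bool using (Bool; true; false; if_then_else_; _∧_; T)
open import Data.Fin using (Fin; toℕ)
open import Data.List using (List; allFin; concatMap; map)
open import Data.Nat.ListAction using (sum)
open import Data.Product using (_×_; _,_; ∃; ∃-syntax; Σ-syntax)
open import Data.Sum using (_⊎_; inj₁; inj₂)
open import Relation.Binary.PropositionalEquality using (_≡_)
open import Relation.Nullary using (¬_)

record Graph (n : ℕ) : Set where
  field
    adj   : Fin n → Fin n → Bool
    sym   : ∀ u v → adj u v ≡ adj v u
    irrefl : ∀ u → adj u u ≡ false
open Graph public

pairs : (n : ℕ) → List (Fin n × Fin n)
pairs n = concatMap (λ i → map (λ j → (i , j)) (allFin n)) (allFin n)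

edgeCount : {n : ℕ} → Graph n → ℕ
edgeCount {n} G =
  sum (map (λ p → if ((toℕ (Data.Product.proj₁ p) <ᵇ toℕ (Data.Product.proj₂ p))
                       ∧ adj G (Data.Product.proj₁ p) (Data.Product.proj₂ p))
                  then 1 else 0) (pairs n))

-- Vertices of a member of F_{1,s,t} with k "new" vertices:
-- y_i, z_j, b_ij (subdivision vertices of K_{s,t}), the new vertices, and r.
data HV (s t k : ℕ) : Set where
  y   : Fin s → HV s t k
  z   : Fin t → HV s t k
  b   : Fin s → Fin t → HV s t k
  new : Fin k → HV s t k
  r   : HV s t k

-- A choice assigns to each w ∈ {y_1..y_s, z_1..z_t} (encoded as Fin s ⊎ Fin t)
-- either some b_ij (inj₁ (i , j)) or one of the new vertices (inj₂ x).
Choice : ℕ → ℕ → ℕ → Set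
Choice s t k = Fin s ⊎ Fin t → (Fin s × Fin t) ⊎ Fin k

wv : ∀ {s t k} → Fin s ⊎ Fin t → HV s t k
wv (inj₁ i) = y i
wv (inj₂ j) = z j

cv : ∀ {s t k} → (Fin s × Fin t) ⊎ Fin k → HV s t k
cv (inj₁ (i , j)) = b i j
cv (inj₂ x) = new x

-- Every new vertex is actually chosen for some w (new vertices arise only
-- through the process).
ValidChoice : ∀ {s t k} → Choice s t k → Set
ValidChoice {s} {t} {k} c = ∀ (x : Fin k) → ∃[ w ] (c w ≡ inj₂ x)

-- Edges of the member H(c) of F_{1,s,t} (each edge listed in one orientation;
-- duplicates are harmless).
data HEdge {s t k : ℕ} (c : Choice s t k) : HV s t k → HV s t k → Set where
  yb : ∀ i j → HEdge c (y i) (b i j)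
  zb : ∀ i j → HEdge c (z j) (b i j)
  wc : ∀ w → HEdge c (wv w) (cv (c w))
  rc : ∀ w → HEdge c r (cv (c w))

ContainsH : ∀ {n s t k} → Graph n → Choice s t k → Set
ContainsH {n} {s} {t} {k} G c =
  Σ[ φ ∈ (HV s t k → Fin n) ]
    ((∀ u v → φ u ≡ φ v → u ≡ v) ×
     (∀ u v → HEdge c u v → T (adj G (φ u) (φ v))))

FFree : (s t : ℕ) → ∀ {n} → Graph n → Set
FFree s t G = ∀ (k : ℕ) (c : Choice s t k) → ValidChoice c → ¬ ContainsH G c

{-# OPTIONS --safe #-}
-- Pass to a bipartite subgraph with parts A and B whose degrees are at most Δ on B and at least δ on A. The
-- codegree graph joins u, v ∈ A having a common neighbour; such a pair is heavy if it has at least st of them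
-- and light otherwise. There is no heavy clique on 1 + s + t vertices, since middle vertices could be chosen
-- greedily. Hence, by a Turán argument inside each neighbourhood N(b) ∩ S, every S ⊆ A spans about (∑_{u ∈ S}
-- deg u)² / |B| light pairs. With S = A this yields a root r whose second neighbourhood S has size m of order
-- δΔ; applied again to that S, it shows that pairs z, z′ ∈ S have on average a large number θ of common light
-- neighbours in S. Convexity gives many tuples y₁, …, yₛ ∈ S with a large common light neighbourhood. The
-- tuples in which two of the required middle vertices b i j coincide are a small proportion because θ is much
-- larger than Δ, so a Ramsey-type supersaturation argument finds z₁, …, zₜ with all middle vertices distinct.
-- As S lies in the second neighbourhood of r, this is a member of F_{1,s,t}.
--
-- Regularity on B is obtained by splitting B into classes with degrees in [8^i d, 8^(i+1) d), where d = e /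
-- 4n: class i has at most 4n / 8^i vertices, so it is enough that it carries a 2^-(i+2) fraction of the edges,
-- which some class does.
module Submission where

open import Defs using (Graph; adj; HV; Choice; cv; ValidChoice; HEdge; yb; zb; wc; rc; FFree; edgeCount; pairs)
import Defs
import Data.Bool as Bool
open import Data.Bool using (Bool; true; false; if_then_else_; T; _∧_)
open import Data.Bool.Properties using (T?)
open import Data.Empty using (⊥; ⊥-elim)
open import Data.Fin using (Fin; zero; suc; _↑ˡ_; _↑ʳ_; remQuot; combine; splitAt; toℕ)
import Data.Fin.Properties as Fin
import Data.List as List
open import Data.List using (List; map; filter; deduplicate; allFin; _++_; length; []; _∷_; concatMap; tabulate)
open import Data.List.Membership.Propositional using (_∈_)
open import Data.List.Membership.Propositional.Properties using (∈-++⁺ˡ; ∈-++⁺ʳ; ∈-map⁺; ∈-map⁻; ∈-filter⁺; ∈-filter⁻; ∈-deduplicate⁺; ∈-deduplicate⁻; ∈-lookup; ∈-allFin)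
open import Data.List.Properties using (map-++; map-tabulate; map-∘)
import Data.List.Relation.Unary.All as ListAll
open import Data.List.Relation.Unary.AllPairs using (_∷_)
open import Data.List.Relation.Unary.Any using (index)
open import Data.List.Relation.Unary.Any.Properties using (lookup-index)
open import Data.List.Relation.Unary.Unique.DecPropositional.Properties using (deduplicate-!)
open import Data.List.Relation.Unary.Unique.Propositional using (Unique)
open import Data.Nat using (ℕ; zero; suc; _+_; _*_; _^_; _≤_; _<_; z≤n; s≤s; _≤?_; NonZero; _/_; _%_; >-nonZero; _<ᵇ_)
open import Data.Nat.DivMod using (m/n*n≤m; m*n/n≡m; /-monoˡ-≤; m≡m%n+[m/n]*n; m%n<n)
import Data.Nat.ListAction as ListAction
open import Data.Nat.ListAction.Properties using (sum-++)
open import Data.Nat.Properties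
open import Data.Nat.Tactic.RingSolver using (solve-∀)
open import Data.Product using (_×_; _,_; proj₁; proj₂; ∃; Σ-syntax; ∃-syntax)
open import Data.Sum using (_⊎_; inj₁; inj₂; [_,_]′)
open import Data.Unit using (⊤; tt)
open import Data.Vec using (Vec; []; _∷_; lookup)
import Data.Vec.Relation.Unary.All as All
open import Data.Vec.Relation.Unary.All using (All; []; _∷_; all?)
open import Data.Vec.Relation.Unary.All.Properties using (lookup⁺)
import Data.Vec.Relation.Unary.Any as Any
open import Data.Vec.Relation.Unary.Any using (Any; here; there; any?)
open import Function using (_∘_; id)
open import Relation.Binary.PropositionalEquality
open import Relation.Nullary using (¬_; Dec; yes; no; does; _×-dec_; _⊎-dec_; ¬?; contradiction)
open import Relation.Unary using (Decidable)
import Algebra.Properties.Semiring.Sum +-*-semiring as S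

-- Lightness controls coincidences: a light pair has fewer than s t common neighbours, each of
-- degree at most Δ, so only O(Δ) third vertices can share a middle vertex with it. Heavy pairs obey
-- no such bound; they become one colour of the Ramsey argument, whose cliques are excluded. With N
-- = |B|, the orders of magnitude are m = e²/(N n), δ = e/n, Δ = e/N and θ = m δ⁴/N². Four
-- requirements arise: e above N, for a root; m δ above N, so that S spans many light pairs, i.e. e³
-- above n² N²; θ above Δ, i.e. e⁵ above n⁵ N²; and m² θˢ above mˢ, so that stars with two different
-- centres outweigh those with one, i.e. e^(2s+2) above n^(2s+1) N^(s+1). For N = n these ask for e
-- above n, n^(4/3), n^(7/5) and n^(1+s/(2(s+1))), up to constants; the exponent of the theorem
-- exceeds each. Since N occurs in every requirement, a level with few vertices may carry few edges.
-- The growth factor 8 = 2³ of the levels suffices because a requirement on e^p with N^k always has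
-- p ≤ 3k; with 4 = 2² the third one, p = 5 and k = 2, would fail.

private variable
  n k : ℕ
  P Q R : Set

-- Indicators and finite sums

opaque
  𝟙 : Dec P → ℕ
  𝟙 d = if does d then 1 else 0

  𝟙-yes : (d : Dec P) → P → 𝟙 d ≡ 1
  𝟙-yes (yes _) _ = refl
  𝟙-yes (no ¬p) p = contradiction p ¬p

  𝟙-no : (d : Dec P) → ¬ P → 𝟙 d ≡ 0
  𝟙-no (yes p) ¬p = contradiction p ¬p
  𝟙-no (no _) _ = refl

  𝟙-mono : (d : Dec P) (e : Dec Q) → (P → Q) → 𝟙 d ≤ 𝟙 e
  𝟙-mono (yes p) e f = ≤-reflexive (sym (𝟙-yes e (f p)))
  𝟙-mono (no _) e f = z≤n

  𝟙-× : (d : Dec P) (e : Dec Q) → 𝟙 (d ×-dec e) ≡ 𝟙 d * 𝟙 e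
  𝟙-× (yes _) (yes _) = refl
  𝟙-× (yes _) (no _) = refl
  𝟙-× (no _) e = refl

  𝟙-⊎ : (d : Dec P) (e : Dec Q) → 𝟙 (d ⊎-dec e) ≤ 𝟙 d + 𝟙 e
  𝟙-⊎ (yes _) e = s≤s z≤n
  𝟙-⊎ (no _) (yes _) = ≤-refl
  𝟙-⊎ (no _) (no _) = ≤-refl

  𝟙≤1 : (d : Dec P) → 𝟙 d ≤ 1
  𝟙≤1 (yes _) = ≤-refl
  𝟙≤1 (no _) = z≤n

  𝟙-*-mono : (d : Dec P) {a b : ℕ} → (P → a ≤ b) → 𝟙 d * a ≤ 𝟙 d * b
  𝟙-*-mono (yes p) f = *-monoʳ-≤ 1 (f p)
  𝟙-*-mono (no _) f = z≤n

  𝟙-≤ : (d : Dec P) {b : ℕ} → (P → 1 ≤ b) → 𝟙 d ≤ b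
  𝟙-≤ (yes p) f = f p
  𝟙-≤ (no _) f = z≤n

𝟙-cong : (d : Dec P) (e : Dec Q) → (P → Q) → (Q → P) → 𝟙 d ≡ 𝟙 e
𝟙-cong d e f g = ≤-antisym (𝟙-mono d e f) (𝟙-mono e d g)

𝟙-*-≤ : (d : Dec P) {a b : ℕ} → (P → a ≤ b) → 𝟙 d * a ≤ b
𝟙-*-≤ d {a} {b} f = ≤-trans (𝟙-*-mono d f) (≤-trans (*-monoˡ-≤ b (𝟙≤1 d)) (≤-reflexive (*-identityˡ b)))

opaque
  sum : (Fin n → ℕ) → ℕ
  sum = S.sum

  sum-cong-≗ : {f g : Fin n → ℕ} → (∀ i → f i ≡ g i) → sum f ≡ sum g
  sum-cong-≗ = S.sum-cong-≗

  ∑-distrib-+ : (f g : Fin n → ℕ) → sum (λ i → f i + g i) ≡ sum f + sum g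
  ∑-distrib-+ = S.∑-distrib-+

  ∑-comm : ∀ {m} (f : Fin m → Fin n → ℕ) → sum (λ i → sum (f i)) ≡ sum (λ j → sum (λ i → f i j))
  ∑-comm = S.∑-comm

  *-distribˡ-sum : ∀ c (f : Fin n → ℕ) → c * sum f ≡ sum (λ i → c * f i)
  *-distribˡ-sum = S.*-distribˡ-sum

  *-distribʳ-sum : ∀ c (f : Fin n → ℕ) → sum f * c ≡ sum (λ i → f i * c)
  *-distribʳ-sum = S.*-distribʳ-sum

  sum-zero : (f : Fin 0 → ℕ) → sum f ≡ 0
  sum-zero f = refl

  sum-suc : (f : Fin (suc n) → ℕ) → sum f ≡ f zero + sum (f ∘ suc)
  sum-suc f = refl

  sum-mono : {f g : Fin n → ℕ} → (∀ i → f i ≤ g i) → sum f ≤ sum g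
  sum-mono {zero} h = z≤n
  sum-mono {suc n} h = +-mono-≤ (h zero) (sum-mono (h ∘ suc))

  sum-const : ∀ n c → sum {n} (λ _ → c) ≡ n * c
  sum-const zero c = refl
  sum-const (suc n) c = cong (c +_) (sum-const n c)

  term≤sum : (f : Fin n → ℕ) (i : Fin n) → f i ≤ sum f
  term≤sum f zero = m≤m+n _ _
  term≤sum f (suc i) = ≤-trans (term≤sum (f ∘ suc) i) (m≤n+m _ _)

  sum-max : ∀ (f : Fin (suc n) → ℕ) → ∃ λ i → sum f ≤ suc n * f i
  sum-max {zero} f = zero , ≤-refl
  sum-max {suc n} f with sum-max (f ∘ suc)
  ... | i , h with f zero ≤? f (suc i)
  ... | yes p = suc i , +-mono-≤ p h
  ... | no ¬p = zero , +-monoʳ-≤ (f zero) (≤-trans h (*-monoʳ-≤ (suc n) (<⇒≤ (≰⇒> ¬p))))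

sum-0 : {f : Fin n → ℕ} → (∀ i → f i ≡ 0) → sum f ≡ 0
sum-0 {n} h = trans (sum-cong-≗ h) (trans (sum-const n 0) (*-zeroʳ n))

sum-product : ∀ {m} (f : Fin n → ℕ) (g : Fin m → ℕ) → sum f * sum g ≡ sum λ i → sum λ j → f i * g j
sum-product f g = trans (*-distribʳ-sum (sum g) f) (sum-cong-≗ λ i → *-distribˡ-sum (f i) g)

#_ : {P : Fin n → Set} → Decidable P → ℕ
# P? = sum λ i → 𝟙 (P? i)

infix 8 #_

opaque
  unfolding 𝟙 sum

  #-∃ : {P : Fin n → Set} (P? : Decidable P) → 1 ≤ # P? → ∃ P
  #-∃ {suc n} P? h with P? zero
  ... | yes p = zero , p
  ... | no _ with #-∃ (P? ∘ suc) h
  ... | i , p = suc i , p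

∃-# : {P : Fin n → Set} (P? : Decidable P) → ∃ P → 1 ≤ # P?
∃-# P? (i , p) = ≤-trans (≤-reflexive (sym (𝟙-yes (P? i) p))) (term≤sum (λ j → 𝟙 (P? j)) i)

#-≡ : (i : Fin n) → # (i Fin.≟_) ≡ 1
#-≡ {suc n} zero = trans (sum-suc _) (cong₂ _+_ (𝟙-yes (zero {n} Fin.≟ zero) refl) (sum-0 λ j → 𝟙-no (zero Fin.≟ suc j) λ ()))
#-≡ {suc n} (suc i) = trans (sum-suc _) (cong₂ _+_ (𝟙-no (suc i Fin.≟ zero) λ ())
  (trans (sum-cong-≗ λ j → 𝟙-cong (suc i Fin.≟ suc j) (i Fin.≟ j) Fin.suc-injective (cong suc)) (#-≡ i)))

2ab≤a²+b² : ∀ a b → 2 * (a * b) ≤ a * a + b * b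
2ab≤a²+b² a b with ≤-total a b
... | inj₁ a≤b with m≤n⇒∃[o]m+o≡n a≤b
...   | d , refl = ≤-trans (m≤m+n _ (d * d)) (≤-reflexive (eq a d))
  where eq : ∀ a d → 2 * (a * (a + d)) + d * d ≡ a * a + (a + d) * (a + d)
        eq = solve-∀
2ab≤a²+b² a b | inj₂ b≤a with m≤n⇒∃[o]m+o≡n b≤a
...   | d , refl = ≤-trans (m≤m+n _ (d * d)) (≤-reflexive (eq b d))
  where eq : ∀ b d → 2 * ((b + d) * b) + d * d ≡ (b + d) * (b + d) + b * b
        eq = solve-∀

-- Doubled and expanded over ordered pairs, this is `2ab≤a²+b²` term by term: where an indicator
-- vanishes, so does the product. The factor counts only indices at which f may be nonzero, which
-- later makes it the size of B or of S instead of n.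
cauchySchwarz : {P : Fin n → Set} (P? : Decidable P) (f : Fin n → ℕ) → (∀ i → ¬ P i → f i ≡ 0) →
  sum f * sum f ≤ # P? * sum λ i → f i * f i
cauchySchwarz {n} {P} P? f supp = *-cancelˡ-≤ 2 (begin
  2 * (sum f * sum f)                                        ≡⟨ cong (2 *_) (sum-product f f) ⟩
  2 * (sum λ i → sum λ j → f i * f j)                        ≡⟨ *-distribˡ-sum 2 _ ⟩
  (sum λ i → 2 * sum λ j → f i * f j)                        ≡⟨ (sum-cong-≗ λ i → *-distribˡ-sum 2 λ j → f i * f j) ⟩
  (sum λ i → sum λ j → 2 * (f i * f j))                      ≤⟨ (sum-mono λ i → sum-mono λ j → bound i j) ⟩
  (sum λ i → sum λ j → 𝟙 (P? i) * f² j + 𝟙 (P? j) * f² i)    ≡⟨ (sum-cong-≗ λ i → ∑-distrib-+ (λ j → 𝟙 (P? i) * f² j) _) ⟩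
  (sum λ i → X i + (sum λ j → 𝟙 (P? j) * f² i))              ≡⟨ ∑-distrib-+ X _ ⟩
  sum X + (sum λ i → sum λ j → 𝟙 (P? j) * f² i)              ≡⟨ cong (sum X +_) (∑-comm λ i j → 𝟙 (P? j) * f² i) ⟩
  sum X + sum X                                              ≡⟨ cong (λ x → x + x) (sum-product (λ i → 𝟙 (P? i)) f²) ⟨
  # P? * sum f² + # P? * sum f²                              ≡⟨ cong (# P? * sum f² +_) (+-identityʳ _) ⟨
  2 * (# P? * sum f²)                                        ∎)
  where
  open ≤-Reasoning
  f² : Fin n → ℕ
  f² i = f i * f i
  X : Fin n → ℕ
  X i = sum λ j → 𝟙 (P? i) * f² j
  bound : ∀ i j → 2 * (f i * f j) ≤ 𝟙 (P? i) * f² j + 𝟙 (P? j) * f² i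
  bound i j with P? i | P? j
  ... | no ¬p | _ rewrite supp i ¬p = z≤n
  ... | yes _ | no ¬p rewrite supp j ¬p | *-zeroʳ (f i) = z≤n
  ... | yes p | yes q rewrite 𝟙-yes (yes p) p | 𝟙-yes (yes q) q | +-identityʳ (f² i) | +-identityʳ (f² j) =
    ≤-trans (2ab≤a²+b² (f i) (f j)) (≤-reflexive (+-comm (f² i) (f² j)))

-- Sums over tuples

opaque
  sumᵥ : ∀ k → (Vec (Fin n) k → ℕ) → ℕ
  sumᵥ zero f = f []
  sumᵥ (suc k) f = sum λ x → sumᵥ k λ xs → f (x ∷ xs)

  sumᵥ-mono : ∀ k {f g : Vec (Fin n) k → ℕ} → (∀ xs → f xs ≤ g xs) → sumᵥ k f ≤ sumᵥ k g
  sumᵥ-mono zero h = h []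
  sumᵥ-mono (suc k) h = sum-mono λ x → sumᵥ-mono k λ xs → h (x ∷ xs)

  sumᵥ-cong : ∀ k {f g : Vec (Fin n) k → ℕ} → (∀ xs → f xs ≡ g xs) → sumᵥ k f ≡ sumᵥ k g
  sumᵥ-cong zero h = h []
  sumᵥ-cong (suc k) h = sum-cong-≗ λ x → sumᵥ-cong k λ xs → h (x ∷ xs)

  sumᵥ-+ : ∀ k (f g : Vec (Fin n) k → ℕ) → sumᵥ k (λ xs → f xs + g xs) ≡ sumᵥ k f + sumᵥ k g
  sumᵥ-+ zero f g = refl
  sumᵥ-+ (suc k) f g = trans (sum-cong-≗ λ x → sumᵥ-+ k (f ∘ (x ∷_)) (g ∘ (x ∷_))) (∑-distrib-+ (λ x → sumᵥ k (f ∘ (x ∷_))) _)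

  sumᵥ-* : ∀ k c (f : Vec (Fin n) k → ℕ) → sumᵥ k (λ xs → c * f xs) ≡ c * sumᵥ k f
  sumᵥ-* zero c f = refl
  sumᵥ-* (suc k) c f = trans (sum-cong-≗ λ x → sumᵥ-* k c (f ∘ (x ∷_))) (sym (*-distribˡ-sum c λ x → sumᵥ k (f ∘ (x ∷_))))

  sum-sumᵥ : ∀ {m} k (f : Fin m → Vec (Fin n) k → ℕ) → (sum λ i → sumᵥ k (f i)) ≡ sumᵥ k λ xs → sum λ i → f i xs
  sum-sumᵥ zero f = refl
  sum-sumᵥ {n = n} (suc k) f = trans (∑-comm λ i x → sumᵥ k λ xs → f i (x ∷ xs)) (sum-cong-≗ λ x → sum-sumᵥ k λ i xs → f i (x ∷ xs))

  sumᵥ-∷ : ∀ k (f : Vec (Fin n) (suc k) → ℕ) → sumᵥ (suc k) f ≡ sum λ x → sumᵥ k λ xs → f (x ∷ xs)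
  sumᵥ-∷ k f = refl

  sumᵥ-[] : (f : Vec (Fin n) 0 → ℕ) → sumᵥ 0 f ≡ f []
  sumᵥ-[] f = refl

-- Tested on entries at two different positions, so an entry occurring twice is paired with itself;
-- for `Clash` this yields the injectivity of the ys.
SomePair : {A : Set} (R : A → A → Set) → Vec A k → Set
SomePair R [] = ⊥
SomePair R (y ∷ ys) = Any (R y) ys ⊎ SomePair R ys

somePair? : {A : Set} {R : A → A → Set} → (∀ x y → Dec (R x y)) → (ys : Vec A k) → Dec (SomePair R ys)
somePair? R? [] = no λ ()
somePair? R? (y ∷ ys) = any? (R? y) ys ⊎-dec somePair? R? ys

module Tuples {n : ℕ} {P : Fin n → Set} (P? : Decidable P) where

  open ≤-Reasoning

  𝟙-all-∷ : ∀ y (ys : Vec (Fin n) k) → 𝟙 (all? P? (y ∷ ys)) ≡ 𝟙 (P? y) * 𝟙 (all? P? ys)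
  𝟙-all-∷ y ys = trans
    (𝟙-cong (all? P? (y ∷ ys)) (P? y ×-dec all? P? ys) (λ { (p ∷ ps) → p , ps }) (λ { (p , ps) → p ∷ ps }))
    (𝟙-× (P? y) (all? P? ys))

  sumᵥ-all : ∀ k → sumᵥ k (λ ys → 𝟙 (all? P? ys)) ≡ (# P?) ^ k
  sumᵥ-all zero = trans (sumᵥ-[] _) (𝟙-yes (all? P? []) [])
  sumᵥ-all (suc k) = begin-equality
    sumᵥ (suc k) (λ ys → 𝟙 (all? P? ys))                  ≡⟨ sumᵥ-∷ k _ ⟩
    (sum λ y → sumᵥ k λ ys → 𝟙 (all? P? (y ∷ ys)))        ≡⟨ (sum-cong-≗ λ y → sumᵥ-cong k (𝟙-all-∷ y)) ⟩
    (sum λ y → sumᵥ k λ ys → 𝟙 (P? y) * 𝟙 (all? P? ys))   ≡⟨ (sum-cong-≗ λ y → sumᵥ-* k (𝟙 (P? y)) λ ys → 𝟙 (all? P? ys)) ⟩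
    (sum λ y → 𝟙 (P? y) * sumᵥ k λ ys → 𝟙 (all? P? ys))   ≡⟨ *-distribʳ-sum (sumᵥ k λ ys → 𝟙 (all? P? ys)) (λ y → 𝟙 (P? y)) ⟨
    # P? * sumᵥ k (λ ys → 𝟙 (all? P? ys))                 ≡⟨ cong (# P? *_) (sumᵥ-all k) ⟩
    # P? * (# P?) ^ k                                     ∎

  private
    rest : ∀ k (w : Vec (Fin n) k → ℕ) →
      (sum λ y → sumᵥ k λ ys → 𝟙 (P? y) * (𝟙 (all? P? ys) * w ys)) ≡ # P? * sumᵥ k (λ ys → 𝟙 (all? P? ys) * w ys)
    rest k w = trans (sum-cong-≗ λ y → sumᵥ-* k (𝟙 (P? y)) λ ys → 𝟙 (all? P? ys) * w ys)
      (sym (*-distribʳ-sum (sumᵥ k λ ys → 𝟙 (all? P? ys) * w ys) (λ y → 𝟙 (P? y))))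

    split : ∀ a b c d e → c ≤ d + e → (a * b) * c ≤ a * (b * d) + a * (b * e)
    split a b c d e h = ≤-trans (*-monoʳ-≤ (a * b) h) (≤-reflexive (eq a b d e))
      where eq : ∀ a b d e → a * b * (d + e) ≡ a * (b * d) + a * (b * e)
            eq = solve-∀

  -- Union bound over the position of the entry in H: that entry has at most M values, the other k
  -- are free.
  any-bound : {H : Fin n → Set} (H? : Decidable H) {M : ℕ} → (sum λ y → 𝟙 (P? y) * 𝟙 (H? y)) ≤ M →
    ∀ k → sumᵥ (suc k) (λ ys → 𝟙 (all? P? ys) * 𝟙 (any? H? ys)) ≤ suc k * M * (# P?) ^ k
  any-bound H? {M} hM zero = begin
    sumᵥ 1 (λ ys → 𝟙 (all? P? ys) * 𝟙 (any? H? ys))          ≡⟨ trans (sumᵥ-∷ 0 _) (sum-cong-≗ λ y → sumᵥ-[] _) ⟩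
    (sum λ y → 𝟙 (all? P? (y ∷ [])) * 𝟙 (any? H? (y ∷ [])))  ≤⟨ (sum-mono λ y → *-mono-≤
        (𝟙-mono (all? P? (y ∷ [])) (P? y) (λ { (p ∷ []) → p })) (𝟙-mono (any? H? (y ∷ [])) (H? y) λ { (here h) → h })) ⟩
    (sum λ y → 𝟙 (P? y) * 𝟙 (H? y))                          ≤⟨ hM ⟩
    M                                                        ≡⟨ trans (*-identityʳ _) (*-identityˡ M) ⟨
    1 * M * 1                                                ∎
  any-bound {H} H? {M} hM (suc k) = begin
    sumᵥ (suc (suc k)) (λ ys → 𝟙 (all? P? ys) * 𝟙 (any? H? ys))
      ≡⟨ sumᵥ-∷ (suc k) _ ⟩
    (sum λ y → sumᵥ (suc k) λ ys → 𝟙 (all? P? (y ∷ ys)) * 𝟙 (any? H? (y ∷ ys)))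
      ≤⟨ (sum-mono λ y → sumᵥ-mono (suc k) λ ys → bound y ys) ⟩
    (sum λ y → sumᵥ (suc k) λ ys → 𝟙 (P? y) * (𝟙 (all? P? ys) * 𝟙 (H? y)) + 𝟙 (P? y) * (𝟙 (all? P? ys) * 𝟙 (any? H? ys)))
      ≡⟨ (sum-cong-≗ λ y → sumᵥ-+ (suc k) (λ ys → 𝟙 (P? y) * (𝟙 (all? P? ys) * 𝟙 (H? y))) _) ⟩
    (sum λ y → sumᵥ (suc k) (λ ys → 𝟙 (P? y) * (𝟙 (all? P? ys) * 𝟙 (H? y))) + sumᵥ (suc k) (λ ys → 𝟙 (P? y) * (𝟙 (all? P? ys) * 𝟙 (any? H? ys))))
      ≡⟨ ∑-distrib-+ (λ y → sumᵥ (suc k) (λ ys → 𝟙 (P? y) * (𝟙 (all? P? ys) * 𝟙 (H? y)))) _ ⟩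
    (sum λ y → sumᵥ (suc k) (λ ys → 𝟙 (P? y) * (𝟙 (all? P? ys) * 𝟙 (H? y)))) + (sum λ y → sumᵥ (suc k) (λ ys → 𝟙 (P? y) * (𝟙 (all? P? ys) * 𝟙 (any? H? ys))))
      ≡⟨ cong₂ _+_ first (rest (suc k) λ ys → 𝟙 (any? H? ys)) ⟩
    (sum λ y → 𝟙 (P? y) * 𝟙 (H? y)) * (# P?) ^ suc k + # P? * sumᵥ (suc k) (λ ys → 𝟙 (all? P? ys) * 𝟙 (any? H? ys))
      ≤⟨ +-mono-≤ (*-monoˡ-≤ ((# P?) ^ suc k) hM) (*-monoʳ-≤ (# P?) (any-bound H? hM k)) ⟩
    M * (# P?) ^ suc k + # P? * (suc k * M * (# P?) ^ k)
      ≡⟨ eq M (# P?) ((# P?) ^ k) k ⟩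
    suc (suc k) * M * (# P?) ^ suc k ∎
    where
    eq : ∀ M a b k → M * (a * b) + a * (suc k * M * b) ≡ suc (suc k) * M * (a * b)
    eq = solve-∀
    bound : ∀ y ys → 𝟙 (all? P? (y ∷ ys)) * 𝟙 (any? H? (y ∷ ys)) ≤ 𝟙 (P? y) * (𝟙 (all? P? ys) * 𝟙 (H? y)) + 𝟙 (P? y) * (𝟙 (all? P? ys) * 𝟙 (any? H? ys))
    bound y ys rewrite 𝟙-all-∷ y ys = split (𝟙 (P? y)) (𝟙 (all? P? ys)) _ _ _
      (≤-trans (𝟙-mono (any? H? (y ∷ ys)) (H? y ⊎-dec any? H? ys) (λ { (here h) → inj₁ h ; (there h) → inj₂ h })) (𝟙-⊎ (H? y) (any? H? ys)))
    first : (sum λ y → sumᵥ (suc k) (λ ys → 𝟙 (P? y) * (𝟙 (all? P? ys) * 𝟙 (H? y)))) ≡ (sum λ y → 𝟙 (P? y) * 𝟙 (H? y)) * (# P?) ^ suc k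
    first = trans (sum-cong-≗ λ y → trans (sumᵥ-cong (suc k) λ ys → shuffle (𝟙 (P? y)) (𝟙 (all? P? ys)) (𝟙 (H? y)))
        (trans (sumᵥ-* (suc k) (𝟙 (P? y) * 𝟙 (H? y)) λ ys → 𝟙 (all? P? ys)) (cong (𝟙 (P? y) * 𝟙 (H? y) *_) (sumᵥ-all (suc k)))))
      (sym (*-distribʳ-sum ((# P?) ^ suc k) λ y → 𝟙 (P? y) * 𝟙 (H? y)))
      where shuffle : ∀ a b c → a * (b * c) ≡ a * c * b
            shuffle = solve-∀

  -- Union bound over the two positions: once the earlier entry is fixed, the later one has at most
  -- M values.
  somePair-bound : {R : Fin n → Fin n → Set} (R? : ∀ x y → Dec (R x y)) {M : ℕ} →
    (∀ x → P x → (sum λ y → 𝟙 (P? y) * 𝟙 (R? x y)) ≤ M) →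
    ∀ k → sumᵥ (suc k) (λ ys → 𝟙 (all? P? ys) * 𝟙 (somePair? R? ys)) ≤ suc k * suc k * M * (# P?) ^ k
  somePair-bound R? {M} hM zero = ≤-trans (≤-reflexive (trans (sumᵥ-∷ 0 _) (sum-0 λ y → trans (sumᵥ-[] _)
    (trans (cong (𝟙 (all? P? (y ∷ [])) *_) (𝟙-no (somePair? R? (y ∷ [])) λ { (inj₁ ()) ; (inj₂ ()) })) (*-zeroʳ (𝟙 (all? P? (y ∷ [])))))))) z≤n
  somePair-bound {R} R? {M} hM (suc k) = begin
    sumᵥ (suc (suc k)) (λ ys → 𝟙 (all? P? ys) * 𝟙 (somePair? R? ys))
      ≡⟨ sumᵥ-∷ (suc k) _ ⟩
    (sum λ y → sumᵥ (suc k) λ ys → 𝟙 (all? P? (y ∷ ys)) * 𝟙 (somePair? R? (y ∷ ys)))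
      ≤⟨ (sum-mono λ y → sumᵥ-mono (suc k) λ ys → bound y ys) ⟩
    (sum λ y → sumᵥ (suc k) λ ys → F y ys + 𝟙 (P? y) * (𝟙 (all? P? ys) * 𝟙 (somePair? R? ys)))
      ≡⟨ (sum-cong-≗ λ y → sumᵥ-+ (suc k) (F y) _) ⟩
    (sum λ y → sumᵥ (suc k) (F y) + sumᵥ (suc k) (λ ys → 𝟙 (P? y) * (𝟙 (all? P? ys) * 𝟙 (somePair? R? ys))))
      ≡⟨ ∑-distrib-+ (λ y → sumᵥ (suc k) (F y)) _ ⟩
    (sum λ y → sumᵥ (suc k) (F y)) + (sum λ y → sumᵥ (suc k) (λ ys → 𝟙 (P? y) * (𝟙 (all? P? ys) * 𝟙 (somePair? R? ys))))
      ≤⟨ +-mono-≤ (sum-mono first) (≤-reflexive (rest (suc k) λ ys → 𝟙 (somePair? R? ys))) ⟩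
    (sum λ y → 𝟙 (P? y) * (suc k * M * (# P?) ^ k)) + # P? * sumᵥ (suc k) (λ ys → 𝟙 (all? P? ys) * 𝟙 (somePair? R? ys))
      ≤⟨ +-mono-≤ (≤-reflexive (sym (*-distribʳ-sum (suc k * M * (# P?) ^ k) (λ y → 𝟙 (P? y))))) (*-monoʳ-≤ (# P?) (somePair-bound R? hM k)) ⟩
    # P? * (suc k * M * (# P?) ^ k) + # P? * (suc k * suc k * M * (# P?) ^ k)
      -- Padding: (k+1) + (k+1)² + (k+2) = (k+2)², so the induction closes with a square in place of
      -- the number of pairs of positions.
      ≤⟨ m≤m+n _ (suc (suc k) * M * (# P? * (# P?) ^ k)) ⟩
    # P? * (suc k * M * (# P?) ^ k) + # P? * (suc k * suc k * M * (# P?) ^ k) + suc (suc k) * M * (# P? * (# P?) ^ k)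
      ≡⟨ eq M (# P?) ((# P?) ^ k) k ⟩
    suc (suc k) * suc (suc k) * M * (# P?) ^ suc k ∎
    where
    eq : ∀ M a b k → a * (suc k * M * b) + a * (suc k * suc k * M * b) + suc (suc k) * M * (a * b) ≡ suc (suc k) * suc (suc k) * M * (a * b)
    eq = solve-∀
    F : Fin n → Vec (Fin n) (suc k) → ℕ
    F y ys = 𝟙 (P? y) * (𝟙 (all? P? ys) * 𝟙 (any? (R? y) ys))
    bound : ∀ y ys → 𝟙 (all? P? (y ∷ ys)) * 𝟙 (somePair? R? (y ∷ ys)) ≤ F y ys + 𝟙 (P? y) * (𝟙 (all? P? ys) * 𝟙 (somePair? R? ys))
    bound y ys rewrite 𝟙-all-∷ y ys = split (𝟙 (P? y)) (𝟙 (all? P? ys)) _ _ _ (𝟙-⊎ (any? (R? y) ys) (somePair? R? ys))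
    first : ∀ y → sumᵥ (suc k) (F y) ≤ 𝟙 (P? y) * (suc k * M * (# P?) ^ k)
    first y = ≤-trans (≤-reflexive (sumᵥ-* (suc k) (𝟙 (P? y)) λ ys → 𝟙 (all? P? ys) * 𝟙 (any? (R? y) ys))) (𝟙-*-mono (P? y) λ p → any-bound (R? y) (hM y p) k)

-- Ramsey-type supersaturation

-- Injectivity is not demanded; where a clique produces a configuration it follows from the
-- relation, since heavy pairs are distinct and equal centres would `Meet`.
Clique : (Fin n → Fin n → Set) → (Fin n → Set) → ℕ → Set
Clique {n} R Z a = Σ[ f ∈ (Fin a → Fin n) ] ((∀ i → Z (f i)) × (∀ {i j} → i ≢ j → R (f i) (f j)))

extend : {R : Fin n → Fin n → Set} → (∀ {x y} → R x y → R y x) → {Z : Fin n → Set} (z : Fin n) → Z z →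
  Clique R (λ x → Z x × R z x) k → Clique R Z (suc k)
extend {n} {k} {R} R-sym {Z} z Zz (f , f∈ , f-adj) = g , g∈ , g-adj
  where
  g : Fin (suc k) → Fin n
  g zero = z
  g (suc i) = f i
  g∈ : ∀ i → Z (g i)
  g∈ zero = Zz
  g∈ (suc i) = proj₁ (f∈ i)
  g-adj : ∀ {i j} → i ≢ j → R (g i) (g j)
  g-adj {zero} {zero} i≢j = contradiction refl i≢j
  g-adj {zero} {suc j} _ = proj₂ (f∈ j)
  g-adj {suc i} {zero} _ = R-sym (proj₂ (f∈ i))
  g-adj {suc i} {suc j} i≢j = f-adj (i≢j ∘ cong suc)

-- Ramsey's theorem bounds the sets without bad pairs; in counting form, bad ordered pairs, the
-- diagonal included, are a positive proportion of Z × Z unless a clique appears.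
module Supersaturation {n : ℕ} {R G : Fin n → Fin n → Set}
  (R? : ∀ x y → Dec (R x y)) (R-sym : ∀ {x y} → R x y → R y x)
  (G? : ∀ x y → Dec (G x y)) (G-sym : ∀ {x y} → G x y → G y x)
  {B : Fin n → Fin n → Set} (B? : ∀ x y → Dec (B x y)) (cover : ∀ x y → R x y ⊎ G x y ⊎ B x y) where

  open ≤-Reasoning

  bad : {Z : Fin n → Set} → Decidable Z → ℕ
  bad Z? = sum λ x → sum λ y → 𝟙 (Z? x) * (𝟙 (Z? y) * 𝟙 (B? x y))

  private
    bad-mono : {Z W : Fin n → Set} (Z? : Decidable Z) (W? : Decidable W) → (∀ {x} → Z x → W x) → bad Z? ≤ bad W?
    bad-mono Z? W? f = sum-mono λ x → sum-mono λ y → *-mono-≤ (𝟙-mono (Z? x) (W? x) f) (*-monoˡ-≤ (𝟙 (B? x y)) (𝟙-mono (Z? y) (W? y) f))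

    -- Recursing into a third of Z costs a factor 9 in the squared size: the base of the constant 9
    -- ^ (a + b).
    scale : ∀ a b c d → a ≤ 3 * b → b * b ≤ c * d → a * a ≤ (9 * c) * d
    scale a b c d h k = begin
      a * a               ≤⟨ *-mono-≤ h h ⟩
      (3 * b) * (3 * b)   ≡⟨ eq b ⟩
      9 * (b * b)         ≤⟨ *-monoʳ-≤ 9 k ⟩
      9 * (c * d)         ≡⟨ *-assoc 9 c d ⟨
      (9 * c) * d         ∎
      where eq : ∀ b → (3 * b) * (3 * b) ≡ 9 * (b * b)
            eq = solve-∀

  -- Either some z ∈ Z has a third of Z as R-neighbours or as G-neighbours, and we recurse into that
  -- neighbourhood, or every z ∈ Z has a third of Z as bad neighbours.
  supersaturation : ∀ a b {Z : Fin n → Set} (Z? : Decidable Z) →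
    Clique R Z a ⊎ Clique G Z b ⊎ (# Z? * # Z? ≤ 9 ^ (a + b) * bad Z?)
  supersaturation zero b Z? = inj₁ ((λ ()) , (λ ()) , λ { {()} })
  supersaturation (suc a) zero Z? = inj₂ (inj₁ ((λ ()) , (λ ()) , λ { {()} }))
  supersaturation (suc a) (suc b) {Z} Z?
    with Fin.any? (λ z → Z? z ×-dec (# Z? ≤? 3 * # (λ x → Z? x ×-dec R? z x)))
       | Fin.any? (λ z → Z? z ×-dec (# Z? ≤? 3 * # (λ x → Z? x ×-dec G? z x)))
  ... | yes (z , Zz , large) | _ with supersaturation a (suc b) (λ x → Z? x ×-dec R? z x)
  ...   | inj₁ c = inj₁ (extend R-sym z Zz c)
  ...   | inj₂ (inj₁ (f , f∈ , f-adj)) = inj₂ (inj₁ (f , proj₁ ∘ f∈ , f-adj))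
  ...   | inj₂ (inj₂ h) = inj₂ (inj₂ (≤-trans (scale (# Z?) (# (λ x → Z? x ×-dec R? z x)) (9 ^ (a + suc b)) _ large h)
            (*-monoʳ-≤ (9 ^ (suc a + suc b)) (bad-mono (λ x → Z? x ×-dec R? z x) Z? proj₁))))
  supersaturation (suc a) (suc b) {Z} Z? | no _ | yes (z , Zz , large) with supersaturation (suc a) b (λ x → Z? x ×-dec G? z x)
  ...   | inj₁ (f , f∈ , f-adj) = inj₁ (f , proj₁ ∘ f∈ , f-adj)
  ...   | inj₂ (inj₁ c) = inj₂ (inj₁ (extend G-sym z Zz c))
  ...   | inj₂ (inj₂ h) = inj₂ (inj₂ (≤-trans (scale (# Z?) (# (λ x → Z? x ×-dec G? z x)) (9 ^ (suc a + b)) _ large h)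
            (≤-trans (≤-reflexive (cong (λ e → 9 ^ e * bad (λ x → Z? x ×-dec G? z x)) (sym (+-suc (suc a) b))))
              (*-monoʳ-≤ (9 ^ (suc a + suc b)) (bad-mono (λ x → Z? x ×-dec G? z x) Z? proj₁)))))
  supersaturation (suc a) (suc b) {Z} Z? | no fewR | no fewG = inj₂ (inj₂ (begin
    # Z? * # Z?                                                ≡⟨ *-distribʳ-sum (# Z?) (λ x → 𝟙 (Z? x)) ⟩
    (sum λ x → 𝟙 (Z? x) * # Z?)                                ≤⟨ sum-mono manyBad ⟩
    (sum λ x → 𝟙 (Z? x) * (9 * badDeg x))                      ≡⟨ (sum-cong-≗ λ x → pull (𝟙 (Z? x)) (badDeg x)) ⟩
    (sum λ x → 9 * (𝟙 (Z? x) * badDeg x))                      ≡⟨ *-distribˡ-sum 9 (λ x → 𝟙 (Z? x) * badDeg x) ⟨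
    9 * (sum λ x → 𝟙 (Z? x) * badDeg x)                        ≡⟨ cong (9 *_) (sum-cong-≗ λ x → *-distribˡ-sum (𝟙 (Z? x)) λ y → 𝟙 (Z? y) * 𝟙 (B? x y)) ⟩
    9 * bad Z?                                                 ≤⟨ *-monoˡ-≤ (bad Z?) (m≤m*n 9 (9 ^ (a + suc b)) ⦃ m^n≢0 9 (a + suc b) ⦄) ⟩
    9 ^ (suc a + suc b) * bad Z?                               ∎))
    where
    badDeg : Fin n → ℕ
    badDeg x = sum λ y → 𝟙 (Z? y) * 𝟙 (B? x y)
    pull : ∀ c d → c * (9 * d) ≡ 9 * (c * d)
    pull = solve-∀
    split : ∀ z → # Z? ≤ # (λ x → Z? x ×-dec R? z x) + (# (λ x → Z? x ×-dec G? z x) + badDeg z)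
    split z = begin
      # Z?
        ≤⟨ sum-mono bound ⟩
      (sum λ x → 𝟙 (Z? x ×-dec R? z x) + (𝟙 (Z? x ×-dec G? z x) + 𝟙 (Z? x) * 𝟙 (B? z x)))
        ≡⟨ ∑-distrib-+ (λ x → 𝟙 (Z? x ×-dec R? z x)) _ ⟩
      # (λ x → Z? x ×-dec R? z x) + (sum λ x → 𝟙 (Z? x ×-dec G? z x) + 𝟙 (Z? x) * 𝟙 (B? z x))
        ≡⟨ cong (# (λ x → Z? x ×-dec R? z x) +_) (∑-distrib-+ (λ x → 𝟙 (Z? x ×-dec G? z x)) _) ⟩
      # (λ x → Z? x ×-dec R? z x) + (# (λ x → Z? x ×-dec G? z x) + badDeg z) ∎
      where
      bound : ∀ x → 𝟙 (Z? x) ≤ 𝟙 (Z? x ×-dec R? z x) + (𝟙 (Z? x ×-dec G? z x) + 𝟙 (Z? x) * 𝟙 (B? z x))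
      bound x = 𝟙-≤ (Z? x) λ Zx → case Zx (cover z x)
        where
        case : Z x → R z x ⊎ G z x ⊎ B z x → 1 ≤ 𝟙 (Z? x ×-dec R? z x) + (𝟙 (Z? x ×-dec G? z x) + 𝟙 (Z? x) * 𝟙 (B? z x))
        case Zx (inj₁ p) rewrite 𝟙-yes (Z? x ×-dec R? z x) (Zx , p) = s≤s z≤n
        case Zx (inj₂ (inj₁ p)) rewrite 𝟙-yes (Z? x ×-dec G? z x) (Zx , p) = ≤-trans (s≤s z≤n) (m≤n+m _ (𝟙 (Z? x ×-dec R? z x)))
        case Zx (inj₂ (inj₂ p)) rewrite 𝟙-yes (Z? x) Zx | 𝟙-yes (B? z x) p = ≤-trans (m≤n+m 1 _) (m≤n+m _ (𝟙 (Dec-R x)))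
          where Dec-R = λ x → Z? x ×-dec R? z x
    -- At most a third each for R and G leaves a third for B; the factor 3 is relaxed to 9, the cost
    -- of one recursive step.
    third : ∀ N x y w → N ≤ x + (y + w) → 3 * x ≤ N → 3 * y ≤ N → N ≤ 9 * w
    third N x y w h hx hy = ≤-trans (+-cancelˡ-≤ (N + N) N (3 * w) (begin
      N + N + N                  ≡⟨ eq₁ N ⟩
      3 * N                      ≤⟨ *-monoʳ-≤ 3 h ⟩
      3 * (x + (y + w))          ≡⟨ eq₂ x y w ⟩
      3 * x + 3 * y + 3 * w      ≤⟨ +-monoˡ-≤ (3 * w) (+-mono-≤ hx hy) ⟩
      N + N + 3 * w              ∎)) (*-monoˡ-≤ w {3} {9} (m≤m+n 3 6))
      where eq₁ : ∀ N → N + N + N ≡ 3 * N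
            eq₁ = solve-∀
            eq₂ : ∀ x y w → 3 * (x + (y + w)) ≡ 3 * x + 3 * y + 3 * w
            eq₂ = solve-∀
    manyBad : ∀ x → 𝟙 (Z? x) * # Z? ≤ 𝟙 (Z? x) * (9 * badDeg x)
    manyBad x = 𝟙-*-mono (Z? x) λ Zx → third (# Z?) (# (λ y → Z? y ×-dec R? x y)) (# (λ y → Z? y ×-dec G? x y)) (badDeg x) (split x)
      (<⇒≤ (≰⇒> λ h → fewR (x , Zx , h))) (<⇒≤ (≰⇒> λ h → fewG (x , Zx , h)))

-- Embedding members of the family

lookup-injective : {A : Set} {xs : List A} → Unique xs → ∀ {i j} → List.lookup xs i ≡ List.lookup xs j → i ≡ j
lookup-injective (_ ∷ _) {zero} {zero} _ = refl
lookup-injective (x∉ ∷ _) {zero} {suc j} eq = contradiction eq (ListAll.lookup x∉ (∈-lookup j))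
lookup-injective (x∉ ∷ _) {suc i} {zero} eq = contradiction (sym eq) (ListAll.lookup x∉ (∈-lookup i))
lookup-injective (_ ∷ u) {suc i} {suc j} eq = cong suc (lookup-injective u eq)

-- The connecting vertices of root-ys and root-zs may coincide with each other and with the bs:
-- this freedom is what the whole family F_{1,s,t}, rather than one of its members, provides.
record Config {n : ℕ} (s t : ℕ) (E : Fin n → Fin n → Set) : Set where
  field
    root        : Fin n
    ys          : Fin s → Fin n
    zs          : Fin t → Fin n
    bs          : Fin s → Fin t → Fin n
    ys-inj      : ∀ {i j} → ys i ≡ ys j → i ≡ j
    zs-inj      : ∀ {i j} → zs i ≡ zs j → i ≡ j
    bs-inj      : ∀ {i i′ j j′} → bs i j ≡ bs i′ j′ → i ≡ i′ × j ≡ j′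
    ys≢zs       : ∀ i j → ys i ≢ zs j
    root≢ys     : ∀ i → root ≢ ys i
    root≢zs     : ∀ j → root ≢ zs j
    ys-bs       : ∀ i j → E (ys i) (bs i j)
    zs-bs       : ∀ i j → E (zs j) (bs i j)
    root-ys     : ∀ i → ∃ λ v → E (ys i) v × E root v
    root-zs     : ∀ j → ∃ λ v → E (zs j) v × E root v

module _ {n s t : ℕ} (G : Graph n) {E : Fin n → Fin n → Set}
  (E⇒adj : ∀ {u v} → E u v → T (adj G u v)) (bipartite : ∀ {u v w} → E u v → ¬ E v w) where

  private
   module Embedding (conf : Config s t E) where
    open Config conf

    terminal : Fin s ⊎ Fin t → Fin n
    terminal = [ ys , zs ]′

    connect : ∀ w → ∃ λ v → E (terminal w) v × E root v
    connect (inj₁ i) = root-ys i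
    connect (inj₂ j) = root-zs j

    β : Fin s ⊎ Fin t → Fin n
    β w = proj₁ (connect w)

    Old : Fin n → Set
    Old v = ∃ λ i → ∃ λ j → bs i j ≡ v

    old? : Decidable Old
    old? v = Fin.any? λ i → Fin.any? λ j → bs i j Fin.≟ v

    terminals : List (Fin s ⊎ Fin t)
    terminals = map inj₁ (allFin s) ++ map inj₂ (allFin t)

    ∈-terminals : ∀ w → w ∈ terminals
    ∈-terminals (inj₁ i) = ∈-++⁺ˡ (∈-map⁺ inj₁ (∈-allFin i))
    ∈-terminals (inj₂ j) = ∈-++⁺ʳ (map inj₁ (allFin s)) (∈-map⁺ inj₂ (∈-allFin j))

    -- Connecting vertices outside the b i j, without repetitions: terminals with the same
    -- connecting vertex then choose the same new vertex, which is the option of reusing one added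
    -- earlier.
    news : List (Fin n)
    news = deduplicate Fin._≟_ (filter (¬? ∘ old?) (map β terminals))

    ∈-news : ∀ w → ¬ Old (β w) → β w ∈ news
    ∈-news w ¬old = ∈-deduplicate⁺ Fin._≟_ (∈-filter⁺ (¬? ∘ old?) (∈-map⁺ β (∈-terminals w)) ¬old)

    news-origin : ∀ x → (∃ λ w → List.lookup news x ≡ β w) × ¬ Old (List.lookup news x)
    news-origin x with ∈-filter⁻ (¬? ∘ old?) {xs = map β terminals} (∈-deduplicate⁻ Fin._≟_ (filter (¬? ∘ old?) (map β terminals)) (∈-lookup x))
    ... | v∈ , ¬old with ∈-map⁻ β v∈
    ... | w , _ , eq = (w , eq) , ¬old

    lookup-inj : ∀ {x x′} → List.lookup news x ≡ List.lookup news x′ → x ≡ x′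
    lookup-inj = lookup-injective (deduplicate-! Fin._≟_ (filter (¬? ∘ old?) (map β terminals)))

    choice : Choice s t (length news)
    choice w with old? (β w)
    ... | yes (i , j , _) = inj₁ (i , j)
    ... | no ¬old = inj₂ (index (∈-news w ¬old))

    φ : HV s t (length news) → Fin n
    φ (Defs.y i) = ys i
    φ (Defs.z j) = zs j
    φ (Defs.b i j) = bs i j
    φ (Defs.new x) = List.lookup news x
    φ Defs.r = root

    φ-choice : ∀ w → φ (cv (choice w)) ≡ β w
    φ-choice w with old? (β w)
    ... | yes (i , j , eq) = eq
    ... | no ¬old = sym (lookup-index (∈-news w ¬old))

    valid : ValidChoice choice
    valid x with news-origin x
    ... | (w , eq) , ¬old with choice w in c≡ | φ-choice w
    ...   | inj₁ (i , j) | q = contradiction (i , j , trans q (sym eq)) ¬old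
    ...   | inj₂ x′ | q = w , trans c≡ (cong inj₂ (lookup-inj (trans q (sym eq))))

    Left Right : Fin n → Set
    Left u = ∃ λ v → E u v
    Right v = ∃ λ u → E u v

    -- Bipartiteness separates the middle and connecting vertices from the terminals and the root at
    -- once, so `Config` records distinctness only among left vertices and among the bs.
    clash : ∀ {u v} → Left u → Right v → u ≢ v
    clash (_ , p) (_ , q) refl = bipartite q p

    terminal-left : ∀ w → Left (terminal w)
    terminal-left w = β w , proj₁ (proj₂ (connect w))

    root-left : Fin s ⊎ Fin t → Left root
    root-left w = β w , proj₂ (proj₂ (connect w))

    bs-right : ∀ i j → Right (bs i j)
    bs-right i j = ys i , ys-bs i j

    news-terminal : Fin (length news) → Fin s ⊎ Fin t
    news-terminal x = proj₁ (proj₁ (news-origin x))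

    news-right : ∀ x → Right (List.lookup news x)
    news-right x with news-origin x
    ... | (w , eq) , _ = root , subst (E root) (sym eq) (proj₂ (proj₂ (connect w)))

    φ-inj : ∀ u v → φ u ≡ φ v → u ≡ v
    φ-inj (Defs.y i) (Defs.y i′) eq = cong Defs.y (ys-inj eq)
    φ-inj (Defs.y i) (Defs.z j) eq = contradiction eq (ys≢zs i j)
    φ-inj (Defs.y i) (Defs.b i′ j) eq = contradiction eq (clash (terminal-left (inj₁ i)) (bs-right i′ j))
    φ-inj (Defs.y i) (Defs.new x) eq = contradiction eq (clash (terminal-left (inj₁ i)) (news-right x))
    φ-inj (Defs.y i) Defs.r eq = contradiction (sym eq) (root≢ys i)
    φ-inj (Defs.z j) (Defs.y i) eq = contradiction (sym eq) (ys≢zs i j)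
    φ-inj (Defs.z j) (Defs.z j′) eq = cong Defs.z (zs-inj eq)
    φ-inj (Defs.z j) (Defs.b i j′) eq = contradiction eq (clash (terminal-left (inj₂ j)) (bs-right i j′))
    φ-inj (Defs.z j) (Defs.new x) eq = contradiction eq (clash (terminal-left (inj₂ j)) (news-right x))
    φ-inj (Defs.z j) Defs.r eq = contradiction (sym eq) (root≢zs j)
    φ-inj (Defs.b i j) (Defs.y i′) eq = contradiction (sym eq) (clash (terminal-left (inj₁ i′)) (bs-right i j))
    φ-inj (Defs.b i j) (Defs.z j′) eq = contradiction (sym eq) (clash (terminal-left (inj₂ j′)) (bs-right i j))
    φ-inj (Defs.b i j) (Defs.b i′ j′) eq with bs-inj eq
    ... | refl , refl = refl
    φ-inj (Defs.b i j) (Defs.new x) eq = contradiction (i , j , eq) (proj₂ (news-origin x))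
    φ-inj (Defs.b i j) Defs.r eq = contradiction (sym eq) (clash (root-left (inj₁ i)) (bs-right i j))
    φ-inj (Defs.new x) (Defs.y i) eq = contradiction (sym eq) (clash (terminal-left (inj₁ i)) (news-right x))
    φ-inj (Defs.new x) (Defs.z j) eq = contradiction (sym eq) (clash (terminal-left (inj₂ j)) (news-right x))
    φ-inj (Defs.new x) (Defs.b i j) eq = contradiction (i , j , sym eq) (proj₂ (news-origin x))
    φ-inj (Defs.new x) (Defs.new x′) eq = cong Defs.new (lookup-inj eq)
    φ-inj (Defs.new x) Defs.r eq = contradiction (sym eq) (clash (root-left (news-terminal x)) (news-right x))
    φ-inj Defs.r (Defs.y i) eq = contradiction eq (root≢ys i)
    φ-inj Defs.r (Defs.z j) eq = contradiction eq (root≢zs j)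
    φ-inj Defs.r (Defs.b i j) eq = contradiction eq (clash (root-left (inj₁ i)) (bs-right i j))
    φ-inj Defs.r (Defs.new x) eq = contradiction eq (clash (root-left (news-terminal x)) (news-right x))
    φ-inj Defs.r Defs.r eq = refl

    φ-edge : ∀ u v → HEdge choice u v → T (adj G (φ u) (φ v))
    φ-edge _ _ (yb i j) = E⇒adj (ys-bs i j)
    φ-edge _ _ (zb i j) = E⇒adj (zs-bs i j)
    φ-edge _ _ (wc (inj₁ i)) rewrite φ-choice (inj₁ i) = E⇒adj (proj₁ (proj₂ (root-ys i)))
    φ-edge _ _ (wc (inj₂ j)) rewrite φ-choice (inj₂ j) = E⇒adj (proj₁ (proj₂ (root-zs j)))
    φ-edge _ _ (rc w) rewrite φ-choice w = E⇒adj (proj₂ (proj₂ (connect w)))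

  FFree⇒¬Config : FFree s t G → ¬ Config s t E
  FFree⇒¬Config free conf = free _ choice valid (φ , φ-inj , φ-edge)
    where open Embedding conf

-- Greedy: the N values already chosen hit at most N of the at least N + 1 candidates for index
-- zero.
distinctRepresentatives : ∀ N {C : Fin N → Fin n → Set} (C? : ∀ i → Decidable (C i)) → (∀ i → N ≤ # (C? i)) →
  Σ[ f ∈ (Fin N → Fin n) ] ((∀ i → C i (f i)) × (∀ {i j} → f i ≡ f j → i ≡ j))
distinctRepresentatives zero C? h = (λ ()) , (λ ()) , λ { {()} }
distinctRepresentatives {n} (suc N) {C} C? h with distinctRepresentatives N (C? ∘ suc) (λ i → ≤-trans (n≤1+n N) (h (suc i)))
... | f , f∈ , f-inj = g , g∈ , g-inj
  where
  open ≤-Reasoning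
  used? : ∀ v → Dec (∃ λ i → f i ≡ v)
  used? v = Fin.any? λ i → f i Fin.≟ v
  fresh? : ∀ v → Dec (C zero v × ¬ ∃ λ i → f i ≡ v)
  fresh? v = C? zero v ×-dec ¬? (used? v)
  bound : ∀ v → 𝟙 (C? zero v) ≤ 𝟙 (fresh? v) + # (λ i → f i Fin.≟ v)
  bound v = 𝟙-≤ (C? zero v) λ Cv → case Cv (used? v)
    where
    case : C zero v → Dec (∃ λ i → f i ≡ v) → 1 ≤ 𝟙 (fresh? v) + # (λ i → f i Fin.≟ v)
    case Cv (yes u) = ≤-trans (∃-# (λ i → f i Fin.≟ v) u) (m≤n+m _ (𝟙 (fresh? v)))
    case Cv (no ¬u) = ≤-trans (≤-reflexive (sym (𝟙-yes (fresh? v) (Cv , ¬u)))) (m≤m+n _ _)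
  count : suc N ≤ # fresh? + N
  count = begin
    suc N                                                     ≤⟨ h zero ⟩
    # (C? zero)                                               ≤⟨ sum-mono bound ⟩
    (sum λ v → 𝟙 (fresh? v) + # (λ i → f i Fin.≟ v))          ≡⟨ ∑-distrib-+ (λ v → 𝟙 (fresh? v)) _ ⟩
    # fresh? + (sum λ v → sum λ i → 𝟙 (f i Fin.≟ v))          ≡⟨ cong (# fresh? +_) (∑-comm λ v i → 𝟙 (f i Fin.≟ v)) ⟩
    # fresh? + (sum λ i → sum λ v → 𝟙 (f i Fin.≟ v))          ≡⟨ cong (# fresh? +_) (sum-cong-≗ λ i → #-≡ (f i)) ⟩
    # fresh? + (sum {N} λ i → 1)                              ≡⟨ cong (# fresh? +_) (trans (sum-const N 1) (*-identityʳ N)) ⟩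
    # fresh? + N                                              ∎
  new : ∃ λ v → C zero v × ¬ ∃ λ i → f i ≡ v
  new = #-∃ fresh? (+-cancelʳ-≤ N 1 (# fresh?) count)
  g : Fin (suc N) → Fin n
  g zero = proj₁ new
  g (suc i) = f i
  g∈ : ∀ i → C i (g i)
  g∈ zero = proj₁ (proj₂ new)
  g∈ (suc i) = f∈ i
  g-inj : ∀ {i j} → g i ≡ g j → i ≡ j
  g-inj {zero} {zero} eq = refl
  g-inj {zero} {suc j} eq = contradiction (j , sym eq) (proj₂ (proj₂ new))
  g-inj {suc i} {zero} eq = contradiction (i , eq) (proj₂ (proj₂ new))
  g-inj {suc i} {suc j} eq = cong suc (f-inj eq)

-- Heavy and light pairs

𝟙-×₃ : (d : Dec P) (e : Dec Q) (f : Dec R) → 𝟙 d * (𝟙 e * 𝟙 f) ≡ 𝟙 (d ×-dec e ×-dec f)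
𝟙-×₃ d e f = sym (trans (𝟙-× d (e ×-dec f)) (cong (𝟙 d *_) (𝟙-× e f)))

any-lookup : {A : Set} {P : A → Set} (ys : Vec A k) → ∀ i → P (lookup ys i) → Any P ys
any-lookup (y ∷ ys) zero p = here p
any-lookup (y ∷ ys) (suc i) p = there (any-lookup ys i p)

somePair-lookup : {A : Set} {R : A → A → Set} → (∀ {x y} → R x y → R y x) →
  (ys : Vec A k) → ∀ {i j} → i ≢ j → R (lookup ys i) (lookup ys j) → SomePair R ys
somePair-lookup R-sym (y ∷ ys) {zero} {zero} i≢j _ = contradiction refl i≢j
somePair-lookup R-sym (y ∷ ys) {zero} {suc j} _ p = inj₁ (any-lookup ys j p)
somePair-lookup R-sym (y ∷ ys) {suc i} {zero} _ p = inj₁ (any-lookup ys i (R-sym p))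
somePair-lookup R-sym (y ∷ ys) {suc i} {suc j} i≢j p = inj₂ (somePair-lookup R-sym ys (i≢j ∘ cong suc) p)

-- The constant of `supersaturation` for cliques of 1 + s + t and of t vertices, the sizes excluded
-- in `cleanBound`.
cliqueConstant : ℕ → ℕ → ℕ
cliqueConstant s t = 9 ^ (suc (s + t) + t)

module Codegree {n : ℕ} (s t : ℕ) (1≤s : 1 ≤ s) (2≤t : 2 ≤ t)
  {E : Fin n → Fin n → Set} (E? : ∀ u v → Dec (E u v)) (noConfig : ¬ Config s t E) where

  open ≤-Reasoning

  common? : ∀ u v b → Dec (E u b × E v b)
  common? u v b = E? u b ×-dec E? v b

  h : Fin n → Fin n → ℕ
  h u v = # (common? u v)

  h-sym : ∀ u v → h u v ≡ h v u
  h-sym u v = sum-cong-≗ λ b → 𝟙-cong (common? u v b) (common? v u b) (λ (p , q) → q , p) (λ (p , q) → q , p)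

  Heavy : Fin n → Fin n → Set
  Heavy u v = u ≢ v × s * t ≤ h u v

  heavy? : ∀ u v → Dec (Heavy u v)
  heavy? u v = ¬? (u Fin.≟ v) ×-dec (s * t ≤? h u v)

  heavy-sym : ∀ {u v} → Heavy u v → Heavy v u
  heavy-sym {u} {v} (u≢v , p) = u≢v ∘ sym , subst (s * t ≤_) (h-sym u v) p

  Light : Fin n → Fin n → Set
  Light u v = u ≢ v × 1 ≤ h u v × ¬ Heavy u v

  light? : ∀ u v → Dec (Light u v)
  light? u v = ¬? (u Fin.≟ v) ×-dec (1 ≤? h u v) ×-dec ¬? (heavy? u v)

  light-bound : ∀ {u v} → u ≢ v → ¬ Heavy u v → h u v ≤ s * t
  light-bound {u} {v} u≢v ¬heavy = <⇒≤ (≰⇒> λ p → ¬heavy (u≢v , p))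

  -- The threshold `s * t` is the number of vertices b i j. The connecting vertices of the root may
  -- coincide with anything on their side, so one common neighbour is enough for each and they do
  -- not enter the count.
  noHeavyClique : {Z : Fin n → Set} → ¬ Clique Heavy Z (suc (s + t))
  noHeavyClique (f , _ , f-heavy) = noConfig record
    { root = f zero ; ys = y ; zs = z ; bs = λ i j → g (combine i j)
    ; ys-inj = λ eq → Fin.↑ˡ-injective t _ _ (Fin.suc-injective (f-inj eq))
    ; zs-inj = λ eq → Fin.↑ʳ-injective s _ _ (Fin.suc-injective (f-inj eq))
    ; bs-inj = λ eq → Fin.combine-injective _ _ _ _ (g-inj eq)
    ; ys≢zs = λ i j eq → ↑ˡ≢↑ʳ i j (Fin.suc-injective (f-inj eq))
    ; root≢ys = λ i eq → Fin.0≢1+n (f-inj eq) ; root≢zs = λ j eq → Fin.0≢1+n (f-inj eq)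
    ; ys-bs = λ i j → subst (λ p → E (y (proj₁ p)) (g (combine i j))) (Fin.remQuot-combine i j) (proj₁ (g∈ (combine i j)))
    ; zs-bs = λ i j → subst (λ p → E (z (proj₂ p)) (g (combine i j))) (Fin.remQuot-combine i j) (proj₂ (g∈ (combine i j)))
    ; root-ys = λ i → joined λ () ; root-zs = λ j → joined λ () }
    where
    f-inj : ∀ {i j} → f i ≡ f j → i ≡ j
    f-inj {i} {j} eq with i Fin.≟ j
    ... | yes p = p
    ... | no i≢j = contradiction eq (proj₁ (f-heavy i≢j))
    y : Fin s → Fin n
    y i = f (suc (i ↑ˡ t))
    z : Fin t → Fin n
    z j = f (suc (s ↑ʳ j))
    ↑ˡ≢↑ʳ : ∀ i j → i ↑ˡ t ≢ s ↑ʳ j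
    ↑ˡ≢↑ʳ i j eq with trans (sym (Fin.splitAt-↑ˡ s i t)) (trans (cong (splitAt s) eq) (Fin.splitAt-↑ʳ s t j))
    ... | ()
    joined : ∀ {i j} → i ≢ j → ∃ λ v → E (f i) v × E (f j) v
    joined {i} {j} i≢j = #-∃ (common? (f i) (f j)) (≤-trans (*-mono-≤ 1≤s (≤-trans (s≤s z≤n) 2≤t)) (proj₂ (f-heavy i≢j)))
    candidates? : ∀ k b → Dec (E (y (proj₁ (remQuot {s} t k))) b × E (z (proj₂ (remQuot {s} t k))) b)
    candidates? k b = common? (y (proj₁ (remQuot {s} t k))) (z (proj₂ (remQuot {s} t k))) b
    reps = distinctRepresentatives (s * t) candidates? λ k →
      proj₂ (f-heavy λ eq → ↑ˡ≢↑ʳ (proj₁ (remQuot {s} t k)) (proj₂ (remQuot {s} t k)) (Fin.suc-injective eq))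
    g = proj₁ reps
    g∈ = proj₁ (proj₂ reps)
    g-inj = proj₂ (proj₂ reps)

  q₀ : ℕ
  q₀ = cliqueConstant s t

  -- The Turán step, as supersaturation with an empty second colour, in which a clique of t ≥ 2
  -- vertices is absurd; taking t here gives the same constant as in `cleanBound`.
  manyNonHeavy : {Z : Fin n → Set} (Z? : Decidable Z) →
    # Z? * # Z? ≤ q₀ * (sum λ x → sum λ y → 𝟙 (Z? x) * (𝟙 (Z? y) * 𝟙 (¬? (heavy? x y))))
  manyNonHeavy {Z} Z? with SS.supersaturation (suc (s + t)) t Z?
    where
    cover : ∀ x y → Heavy x y ⊎ ⊥ ⊎ ¬ Heavy x y
    cover x y with heavy? x y
    ... | yes p = inj₁ p
    ... | no ¬p = inj₂ (inj₂ ¬p)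
    module SS = Supersaturation heavy? heavy-sym (λ _ _ → no λ ()) ⊥-elim (λ x y → ¬? (heavy? x y)) cover
  ... | inj₁ c = ⊥-elim (noHeavyClique {Z} c)
  ... | inj₂ (inj₁ (_ , _ , f-adj)) = ⊥-elim (case 2≤t f-adj)
    where
    case : ∀ {t} → 2 ≤ t → (∀ {i j : Fin t} → i ≢ j → ⊥) → ⊥
    case (s≤s (s≤s _)) f-adj = f-adj {zero} {suc zero} λ ()
  ... | inj₂ (inj₂ p) = p

  module _ {S : Fin n → Set} (S? : Decidable S) where

    q : Fin n → ℕ
    q b = # λ u → S? u ×-dec E? u b

    lightPairs : ℕ
    lightPairs = sum λ u → sum λ v → 𝟙 (S? u) * (𝟙 (S? v) * 𝟙 (light? u v))

    private
      w : Fin n → Fin n → Fin n → ℕ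
      w u v b = 𝟙 (S? u ×-dec E? u b) * (𝟙 (S? v ×-dec E? v b) * 𝟙 (¬? (heavy? u v)))
      Λ? : ∀ u v → Dec (S u × S v × Light u v)
      Λ? u v = S? u ×-dec S? v ×-dec light? u v

      -- A non-heavy pair with u ≠ v and a common neighbour is light and is met once for each common
      -- neighbour, at most s t times; a diagonal pair is met once for each neighbour.
      pairBound : ∀ u v → sum (w u v) ≤ 𝟙 (Λ? u v) * (s * t) + 𝟙 (u Fin.≟ v) * # (λ b → S? u ×-dec E? u b)
      pairBound u v = case (u Fin.≟ v)
        where
        bound : u ≢ v → ∀ b → w u v b ≤ 𝟙 (Λ? u v) * 𝟙 (common? u v b)
        bound u≢v b = begin
          w u v b                               ≡⟨ 𝟙-×₃ (S? u ×-dec E? u b) (S? v ×-dec E? v b) (¬? (heavy? u v)) ⟩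
          _                                     ≤⟨ 𝟙-mono ((S? u ×-dec E? u b) ×-dec (S? v ×-dec E? v b) ×-dec ¬? (heavy? u v)) (Λ? u v ×-dec common? u v b)
            (λ ((Su , Eu) , (Sv , Ev) , ¬heavy) → (Su , Sv , u≢v , ∃-# (common? u v) (b , Eu , Ev) , ¬heavy) , Eu , Ev) ⟩
          𝟙 (Λ? u v ×-dec common? u v b)        ≡⟨ 𝟙-× (Λ? u v) (common? u v b) ⟩
          𝟙 (Λ? u v) * 𝟙 (common? u v b)        ∎
        case : Dec (u ≡ v) → sum (w u v) ≤ 𝟙 (Λ? u v) * (s * t) + 𝟙 (u Fin.≟ v) * # (λ b → S? u ×-dec E? u b)
        case (yes u≡v) = begin
          sum (w u v)                                              ≤⟨ (sum-mono λ b → ≤-trans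
            (≤-reflexive (𝟙-×₃ (S? u ×-dec E? u b) (S? v ×-dec E? v b) (¬? (heavy? u v)))) (𝟙-mono _ (S? u ×-dec E? u b) proj₁)) ⟩
          # (λ b → S? u ×-dec E? u b)                              ≡⟨ trans (cong (_* # (λ b → S? u ×-dec E? u b)) (𝟙-yes (u Fin.≟ v) u≡v)) (*-identityˡ _) ⟨
          𝟙 (u Fin.≟ v) * # (λ b → S? u ×-dec E? u b)              ≤⟨ m≤n+m _ _ ⟩
          𝟙 (Λ? u v) * (s * t) + 𝟙 (u Fin.≟ v) * # (λ b → S? u ×-dec E? u b) ∎
        case (no u≢v) = begin
          sum (w u v)                                              ≤⟨ sum-mono (bound u≢v) ⟩
          (sum λ b → 𝟙 (Λ? u v) * 𝟙 (common? u v b))               ≡⟨ *-distribˡ-sum (𝟙 (Λ? u v)) (λ b → 𝟙 (common? u v b)) ⟨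
          𝟙 (Λ? u v) * h u v                                       ≤⟨ 𝟙-*-mono (Λ? u v) (λ (_ , _ , _ , _ , ¬heavy) → light-bound u≢v ¬heavy) ⟩
          𝟙 (Λ? u v) * (s * t)                                     ≤⟨ m≤m+n _ _ ⟩
          𝟙 (Λ? u v) * (s * t) + 𝟙 (u Fin.≟ v) * # (λ b → S? u ×-dec E? u b) ∎

    -- Sum `manyNonHeavy` over the sets N(b) ∩ S and exchange the summations; the diagonal of
    -- `pairBound` adds up to sum q.
    sum-q² : (sum λ b → q b * q b) ≤ q₀ * (lightPairs * (s * t) + sum q)
    sum-q² = begin
      (sum λ b → q b * q b)                                    ≤⟨ (sum-mono λ b → manyNonHeavy λ u → S? u ×-dec E? u b) ⟩
      (sum λ b → q₀ * (sum λ u → sum λ v → w u v b))           ≡⟨ *-distribˡ-sum q₀ (λ b → sum λ u → sum λ v → w u v b) ⟨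
      q₀ * (sum λ b → sum λ u → sum λ v → w u v b)             ≡⟨ cong (q₀ *_) (trans (∑-comm λ b u → sum λ v → w u v b) (sum-cong-≗ λ u → ∑-comm λ b v → w u v b)) ⟩
      q₀ * (sum λ u → sum λ v → sum (w u v))                   ≤⟨ *-monoʳ-≤ q₀ (sum-mono λ u → sum-mono λ v → pairBound u v) ⟩
      q₀ * (sum λ u → sum λ v → 𝟙 (Λ? u v) * (s * t) + 𝟙 (u Fin.≟ v) * d u)
        ≡⟨ cong (q₀ *_) (trans (sum-cong-≗ λ u → ∑-distrib-+ (λ v → 𝟙 (Λ? u v) * (s * t)) _) (∑-distrib-+ (λ u → sum λ v → 𝟙 (Λ? u v) * (s * t)) _)) ⟩
      q₀ * ((sum λ u → sum λ v → 𝟙 (Λ? u v) * (s * t)) + (sum λ u → sum λ v → 𝟙 (u Fin.≟ v) * d u))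
        ≡⟨ cong (q₀ *_) (cong₂ _+_ eq₁ eq₂) ⟩
      q₀ * (lightPairs * (s * t) + sum q)                      ∎
      where
      d : Fin n → ℕ
      d u = # (λ b → S? u ×-dec E? u b)
      eq₁ : (sum λ u → sum λ v → 𝟙 (Λ? u v) * (s * t)) ≡ lightPairs * (s * t)
      eq₁ = trans (sum-cong-≗ λ u → trans (sum-cong-≗ λ v → cong (_* (s * t)) (sym (𝟙-×₃ (S? u) (S? v) (light? u v))))
        (sym (*-distribʳ-sum (s * t) λ v → 𝟙 (S? u) * (𝟙 (S? v) * 𝟙 (light? u v)))))
        (sym (*-distribʳ-sum (s * t) λ u → sum λ v → 𝟙 (S? u) * (𝟙 (S? v) * 𝟙 (light? u v))))
      eq₂ : (sum λ u → sum λ v → 𝟙 (u Fin.≟ v) * d u) ≡ sum q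
      eq₂ = trans (sum-cong-≗ λ u → trans (sym (*-distribʳ-sum (d u) λ v → 𝟙 (u Fin.≟ v))) (trans (cong (_* d u) (#-≡ u)) (*-identityˡ (d u))))
        (∑-comm λ u b → 𝟙 (S? u ×-dec E? u b))

    -- Cauchy-Schwarz over B passes to the squares bounded in `sum-q²`. The size hypothesis makes
    -- the diagonal term at most half of the total, so it is absorbed.
    manyLight : {B : Fin n → Set} (B? : Decidable B) → (∀ {u b} → E u b → B b) →
      2 * (# B? * q₀) ≤ sum q → sum q * sum q ≤ 2 * (q₀ * (s * t)) * (# B? * lightPairs)
    manyLight {B} B? E⇒B large = +-cancelʳ-≤ (sum q * sum q) _ _ (begin
      sum q * sum q + sum q * sum q                                      ≡⟨ cong (sum q * sum q +_) (+-identityʳ _) ⟨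
      2 * (sum q * sum q)                                                ≤⟨ *-monoʳ-≤ 2 (cauchySchwarz B? q supp) ⟩
      2 * (# B? * (sum λ b → q b * q b))                                 ≤⟨ *-monoʳ-≤ 2 (*-monoʳ-≤ (# B?) sum-q²) ⟩
      2 * (# B? * (q₀ * (lightPairs * (s * t) + sum q)))                 ≡⟨ eq (# B?) q₀ lightPairs (s * t) (sum q) ⟩
      2 * (q₀ * (s * t)) * (# B? * lightPairs) + 2 * (# B? * q₀) * sum q ≤⟨ +-monoʳ-≤ _ (*-monoˡ-≤ (sum q) large) ⟩
      2 * (q₀ * (s * t)) * (# B? * lightPairs) + sum q * sum q           ∎)
      where
      supp : ∀ b → ¬ B b → q b ≡ 0
      supp b ¬Bb = sum-0 λ u → 𝟙-no (S? u ×-dec E? u b) (¬Bb ∘ E⇒B ∘ proj₂)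
      eq : ∀ B q L m D → 2 * (B * (q * (L * m + D))) ≡ 2 * (q * m) * (B * L) + 2 * (B * q) * D
      eq = solve-∀

  Share : Fin n → Fin n → Fin n → Set
  Share u v w = ∃ λ b → E u b × E v b × E w b

  share? : ∀ u v w → Dec (Share u v w)
  share? u v w = Fin.any? λ b → E? u b ×-dec E? v b ×-dec E? w b

  module _ (Δ : ℕ) (degree≤Δ : ∀ b → # (λ u → E? u b) ≤ Δ) where

    -- Union bound over the common neighbours of the pair; the source of every factor `s * t * Δ`
    -- below.
    share-count : ∀ {u v} → u ≢ v → ¬ Heavy u v → # (share? u v) ≤ s * t * Δ
    share-count {u} {v} u≢v ¬heavy = begin
      # (share? u v)                                             ≤⟨ sum-mono bound ⟩
      (sum λ w → sum λ b → 𝟙 (common? u v b) * 𝟙 (E? w b))       ≡⟨ (∑-comm λ w b → 𝟙 (common? u v b) * 𝟙 (E? w b)) ⟩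
      (sum λ b → sum λ w → 𝟙 (common? u v b) * 𝟙 (E? w b))       ≡⟨ (sum-cong-≗ λ b → *-distribˡ-sum (𝟙 (common? u v b)) λ w → 𝟙 (E? w b)) ⟨
      (sum λ b → 𝟙 (common? u v b) * # (λ w → E? w b))           ≤⟨ (sum-mono λ b → *-monoʳ-≤ (𝟙 (common? u v b)) (degree≤Δ b)) ⟩
      (sum λ b → 𝟙 (common? u v b) * Δ)                          ≡⟨ *-distribʳ-sum Δ (λ b → 𝟙 (common? u v b)) ⟨
      h u v * Δ                                                  ≤⟨ *-monoˡ-≤ Δ (light-bound u≢v ¬heavy) ⟩
      s * t * Δ                                                  ∎
      where
      bound : ∀ w → 𝟙 (share? u v w) ≤ sum λ b → 𝟙 (common? u v b) * 𝟙 (E? w b)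
      bound w = 𝟙-≤ (share? u v w) λ (b , Eu , Ev , Ew) → ≤-trans
        (≤-reflexive (sym (trans (sym (𝟙-× (common? u v b) (E? w b))) (𝟙-yes (common? u v b ×-dec E? w b) ((Eu , Ev) , Ew)))))
        (term≤sum (λ b → 𝟙 (common? u v b) * 𝟙 (E? w b)) b)

-- Stars in the second neighbourhood of a root

-- Stands in for the tangent line of x ^ (k + 1) at θ, that is, for convexity: the larger of a and θ
-- already dominates. This avoids subtraction at the price of a constant.
tangent : ∀ k a θ → θ ^ k * a ≤ a ^ suc k + θ ^ suc k
tangent k a θ with ≤-total a θ
... | inj₁ a≤θ = ≤-trans (*-monoʳ-≤ (θ ^ k) a≤θ) (≤-trans (≤-reflexive (*-comm (θ ^ k) θ)) (m≤n+m _ _))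
... | inj₂ θ≤a = ≤-trans (*-monoˡ-≤ a (^-monoˡ-≤ k θ≤a)) (≤-trans (≤-reflexive (*-comm (a ^ k) a)) (m≤m+n _ _))

-- Trades a factor θ for one more power of a, which is how `fans` are compared with `stars`.
cotangent : ∀ k a θ → θ * a ^ k ≤ a ^ suc k + θ ^ suc k
cotangent k a θ = ≤-trans (≤-reflexive (*-comm θ (a ^ k))) (≤-trans (tangent k θ a) (≤-reflexive (+-comm (θ ^ suc k) _)))

opaque
  unfolding 𝟙

  𝟙-split : {A B C D : Set} (a : Dec A) (b : Dec B) (c : Dec C) (d : Dec D) →
    𝟙 a * 𝟙 b ≤ 𝟙 (a ×-dec ¬? c) * 𝟙 (b ×-dec ¬? d) + (𝟙 a * (𝟙 b * 𝟙 c) + 𝟙 a * (𝟙 b * 𝟙 d))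
  𝟙-split (no _) b c d = z≤n
  𝟙-split (yes _) (no _) c d = z≤n
  𝟙-split (yes _) (yes _) (yes _) d = s≤s z≤n
  𝟙-split (yes _) (yes _) (no _) (yes _) = s≤s z≤n
  𝟙-split (yes _) (yes _) (no _) (no _) = s≤s z≤n

module Rooted {n : ℕ} (s′ t : ℕ) (2≤t : 2 ≤ t) {E : Fin n → Fin n → Set} (E? : ∀ u v → Dec (E u v))
  (noConfig : ¬ Config (suc s′) t E) (r : Fin n) where

  open ≤-Reasoning
  open Codegree (suc s′) t (s≤s z≤n) 2≤t E? noConfig

  s : ℕ
  s = suc s′

  S : Fin n → Set
  S u = r ≢ u × 1 ≤ h r u

  S? : Decidable S
  S? u = ¬? (r Fin.≟ u) ×-dec (1 ≤? h r u)

  m : ℕ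
  m = # S?

  edge? : ∀ z y → Dec (S y × Light y z)
  edge? z y = S? y ×-dec light? y z

  edges? : ∀ z z′ y → Dec ((S y × Light y z) × (S y × Light y z′))
  edges? z z′ y = edge? z y ×-dec edge? z′ y

  a : Fin n → Fin n → ℕ
  a z z′ = # (edges? z z′)

  -- Membership of the ys in S rides along with their lightness, so a single z certifies it.
  Z : Vec (Fin n) s → Fin n → Set
  Z ys z = S z × All (λ y → S y × Light y z) ys

  Z? : ∀ ys → Decidable (Z ys)
  Z? ys z = S? z ×-dec all? (edge? z) ys

  ∑S² : (Fin n → Fin n → ℕ) → ℕ
  ∑S² f = sum λ z → sum λ z′ → 𝟙 (S? z) * 𝟙 (S? z′) * f z z′

  ∑S²-mono : ∀ {f g} → (∀ z z′ → f z z′ ≤ g z z′) → ∑S² f ≤ ∑S² g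
  ∑S²-mono p = sum-mono λ z → sum-mono λ z′ → *-monoʳ-≤ (𝟙 (S? z) * 𝟙 (S? z′)) (p z z′)

  ∑S²-* : ∀ c f → ∑S² (λ z z′ → c * f z z′) ≡ c * ∑S² f
  ∑S²-* c f = trans (sum-cong-≗ λ z → trans (sum-cong-≗ λ z′ → pull (𝟙 (S? z) * 𝟙 (S? z′)) c (f z z′))
      (sym (*-distribˡ-sum c λ z′ → 𝟙 (S? z) * 𝟙 (S? z′) * f z z′)))
    (sym (*-distribˡ-sum c λ z → sum λ z′ → 𝟙 (S? z) * 𝟙 (S? z′) * f z z′))
    where pull : ∀ x c y → x * (c * y) ≡ c * (x * y)
          pull = solve-∀

  ∑S²-+ : ∀ f g → ∑S² (λ z z′ → f z z′ + g z z′) ≡ ∑S² f + ∑S² g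
  ∑S²-+ f g = trans (sum-cong-≗ λ z → trans (sum-cong-≗ λ z′ → *-distribˡ-+ (𝟙 (S? z) * 𝟙 (S? z′)) (f z z′) (g z z′))
      (∑-distrib-+ (λ z′ → 𝟙 (S? z) * 𝟙 (S? z′) * f z z′) _))
    (∑-distrib-+ (λ z → sum λ z′ → 𝟙 (S? z) * 𝟙 (S? z′) * f z z′) _)

  ∑S²-const : ∀ c → ∑S² (λ _ _ → c) ≡ m * m * c
  ∑S²-const c = sym (begin-equality
    m * m * c                                          ≡⟨ cong (_* c) (sum-product (λ z → 𝟙 (S? z)) (λ z → 𝟙 (S? z))) ⟩
    (sum λ z → sum λ z′ → 𝟙 (S? z) * 𝟙 (S? z′)) * c    ≡⟨ *-distribʳ-sum c _ ⟩
    (sum λ z → (sum λ z′ → 𝟙 (S? z) * 𝟙 (S? z′)) * c)  ≡⟨ (sum-cong-≗ λ z → *-distribʳ-sum c λ z′ → 𝟙 (S? z) * 𝟙 (S? z′)) ⟩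
    ∑S² (λ _ _ → c)                                    ∎)

  -- Cauchy-Schwarz over y in S: the squared number of light partners of y counts the pairs (z, z′)
  -- joined through y.
  lightPairs² : lightPairs S? * lightPairs S? ≤ m * ∑S² a
  lightPairs² = begin
    lightPairs S? * lightPairs S?                ≤⟨ cauchySchwarz S? f supp ⟩
    m * (sum λ y → f y * f y)                    ≡⟨ cong (m *_) (sym eq) ⟩
    m * ∑S² a                                    ∎
    where
    g : Fin n → Fin n → ℕ
    g y z = 𝟙 (S? y) * (𝟙 (S? z) * 𝟙 (light? y z))
    f : Fin n → ℕ
    f y = sum (g y)
    supp : ∀ y → ¬ S y → f y ≡ 0
    supp y ¬Sy = sum-0 λ z → cong (_* (𝟙 (S? z) * 𝟙 (light? y z))) (𝟙-no (S? y) ¬Sy)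
    term : ∀ y z z′ → 𝟙 (S? z) * 𝟙 (S? z′) * 𝟙 (edges? z z′ y) ≡ g y z * g y z′
    term y z z′ = begin-equality
      𝟙 (S? z) * 𝟙 (S? z′) * 𝟙 (edges? z z′ y)
        ≡⟨ cong (𝟙 (S? z) * 𝟙 (S? z′) *_) (trans (𝟙-× (edge? z y) (edge? z′ y)) (cong₂ _*_ (𝟙-× (S? y) (light? y z)) (𝟙-× (S? y) (light? y z′)))) ⟩
      𝟙 (S? z) * 𝟙 (S? z′) * ((𝟙 (S? y) * 𝟙 (light? y z)) * (𝟙 (S? y) * 𝟙 (light? y z′)))
        ≡⟨ shuffle (𝟙 (S? z)) (𝟙 (S? z′)) (𝟙 (S? y)) (𝟙 (light? y z)) (𝟙 (light? y z′)) ⟩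
      g y z * g y z′ ∎
      where shuffle : ∀ a b c d e → a * b * ((c * d) * (c * e)) ≡ (c * (a * d)) * (c * (b * e))
            shuffle = solve-∀
    eq : ∑S² a ≡ sum λ y → f y * f y
    eq = begin-equality
      (sum λ z → sum λ z′ → 𝟙 (S? z) * 𝟙 (S? z′) * a z z′)
        ≡⟨ (sum-cong-≗ λ z → sum-cong-≗ λ z′ → trans (*-distribˡ-sum (𝟙 (S? z) * 𝟙 (S? z′)) λ y → 𝟙 (edges? z z′ y)) (sum-cong-≗ λ y → term y z z′)) ⟩
      (sum λ z → sum λ z′ → sum λ y → g y z * g y z′)   ≡⟨ (sum-cong-≗ λ z → ∑-comm λ z′ y → g y z * g y z′) ⟩
      (sum λ z → sum λ y → sum λ z′ → g y z * g y z′)   ≡⟨ (∑-comm λ z y → sum λ z′ → g y z * g y z′) ⟩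
      (sum λ y → sum λ z → sum λ z′ → g y z * g y z′)   ≡⟨ (sum-cong-≗ λ y → sum-product (g y) (g y)) ⟨
      (sum λ y → f y * f y)                             ∎

  ∑Z² : ∀ ys → (Fin n → Fin n → ℕ) → ℕ
  ∑Z² ys f = sum λ z → sum λ z′ → 𝟙 (Z? ys z) * (𝟙 (Z? ys z′) * f z z′)

  ∑Z²-+ : ∀ ys f g → ∑Z² ys (λ z z′ → f z z′ + g z z′) ≡ ∑Z² ys f + ∑Z² ys g
  ∑Z²-+ ys f g = trans (sum-cong-≗ λ z → trans (sum-cong-≗ λ z′ → dist (𝟙 (Z? ys z)) (𝟙 (Z? ys z′)) (f z z′) (g z z′))
      (∑-distrib-+ (λ z′ → 𝟙 (Z? ys z) * (𝟙 (Z? ys z′) * f z z′)) _))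
    (∑-distrib-+ (λ z → sum λ z′ → 𝟙 (Z? ys z) * (𝟙 (Z? ys z′) * f z z′)) _)
    where dist : ∀ a b c d → a * (b * (c + d)) ≡ a * (b * c) + a * (b * d)
          dist = solve-∀

  -- Double counting: z and z′ both lie in `Z ys` exactly when they lie in S and every entry of ys
  -- is a common light neighbour of theirs in S.
  exchange : ∀ (f : Vec (Fin n) s → Fin n → Fin n → ℕ) →
    sumᵥ s (λ ys → ∑Z² ys (f ys)) ≡ ∑S² (λ z z′ → sumᵥ s λ ys → 𝟙 (all? (edges? z z′) ys) * f ys z z′)
  exchange f = begin-equality
    sumᵥ s (λ ys → sum λ z → sum λ z′ → 𝟙 (Z? ys z) * (𝟙 (Z? ys z′) * f ys z z′))
      ≡⟨ (sumᵥ-cong s λ ys → sum-cong-≗ λ z → sum-cong-≗ λ z′ → term ys z z′) ⟩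
    sumᵥ s (λ ys → sum λ z → sum λ z′ → c z z′ * F z z′ ys)
      ≡⟨ sum-sumᵥ s (λ z ys → sum λ z′ → c z z′ * F z z′ ys) ⟨
    (sum λ z → sumᵥ s λ ys → sum λ z′ → c z z′ * F z z′ ys)
      ≡⟨ (sum-cong-≗ λ z → sum-sumᵥ s λ z′ ys → c z z′ * F z z′ ys) ⟨
    (sum λ z → sum λ z′ → sumᵥ s λ ys → c z z′ * F z z′ ys)
      ≡⟨ (sum-cong-≗ λ z → sum-cong-≗ λ z′ → sumᵥ-* s (c z z′) (F z z′)) ⟩
    ∑S² (λ z z′ → sumᵥ s (F z z′)) ∎
    where
    c : Fin n → Fin n → ℕ
    c z z′ = 𝟙 (S? z) * 𝟙 (S? z′)
    F : Fin n → Fin n → Vec (Fin n) s → ℕ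
    F z z′ ys = 𝟙 (all? (edges? z z′) ys) * f ys z z′
    both : ∀ ys z z′ → 𝟙 (all? (edge? z) ys) * 𝟙 (all? (edge? z′) ys) ≡ 𝟙 (all? (edges? z z′) ys)
    both ys z z′ = trans (sym (𝟙-× (all? (edge? z) ys) (all? (edge? z′) ys)))
      (𝟙-cong (all? (edge? z) ys ×-dec all? (edge? z′) ys) (all? (edges? z z′) ys) All.zip All.unzip)
    term : ∀ ys z z′ → 𝟙 (Z? ys z) * (𝟙 (Z? ys z′) * f ys z z′) ≡ c z z′ * F z z′ ys
    term ys z z′ = begin-equality
      𝟙 (Z? ys z) * (𝟙 (Z? ys z′) * f ys z z′)
        ≡⟨ cong₂ (λ p q → p * (q * f ys z z′)) (𝟙-× (S? z) (all? (edge? z) ys)) (𝟙-× (S? z′) (all? (edge? z′) ys)) ⟩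
      (𝟙 (S? z) * 𝟙 (all? (edge? z) ys)) * ((𝟙 (S? z′) * 𝟙 (all? (edge? z′) ys)) * f ys z z′)
        ≡⟨ shuffle (𝟙 (S? z)) (𝟙 (all? (edge? z) ys)) (𝟙 (S? z′)) (𝟙 (all? (edge? z′) ys)) (f ys z z′) ⟩
      c z z′ * ((𝟙 (all? (edge? z) ys) * 𝟙 (all? (edge? z′) ys)) * f ys z z′)
        ≡⟨ cong (λ p → c z z′ * (p * f ys z z′)) (both ys z z′) ⟩
      c z z′ * F z z′ ys ∎
      where shuffle : ∀ a b c d e → (a * b) * ((c * d) * e) ≡ a * c * ((b * d) * e)
            shuffle = solve-∀

  -- Homomorphic copies of K(2,s) in the light graph on S: the centres z, z′ may be equal and the
  -- entries of the tuple may repeat.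
  stars : ℕ
  stars = ∑S² λ z z′ → a z z′ ^ s

  stars-≡ : stars ≡ sumᵥ s λ ys → # (Z? ys) * # (Z? ys)
  stars-≡ = begin-equality
    ∑S² (λ z z′ → a z z′ ^ s)
      ≡⟨ (sum-cong-≗ λ z → sum-cong-≗ λ z′ → cong (𝟙 (S? z) * 𝟙 (S? z′) *_)
           (trans (sym (Tuples.sumᵥ-all (edges? z z′) s)) (sumᵥ-cong s λ ys → sym (*-identityʳ _)))) ⟩
    ∑S² (λ z z′ → sumᵥ s λ ys → 𝟙 (all? (edges? z z′) ys) * 1)
      ≡⟨ exchange (λ _ _ _ → 1) ⟨
    sumᵥ s (λ ys → ∑Z² ys λ _ _ → 1)
      ≡⟨ (sumᵥ-cong s λ ys → trans (sum-cong-≗ λ z → sum-cong-≗ λ z′ → cong (𝟙 (Z? ys z) *_) (*-identityʳ (𝟙 (Z? ys z′)))) (sym (sum-product (λ z → 𝟙 (Z? ys z)) (λ z → 𝟙 (Z? ys z))))) ⟩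
    sumᵥ s (λ ys → # (Z? ys) * # (Z? ys)) ∎

  -- A Clash is a middle vertex shared by two leaves and a centre, a Meet one shared by two centres and a leaf;
  -- without either, the middle vertices b i j are automatically distinct.
  Clash : Fin n → Vec (Fin n) s → Set
  Clash z = SomePair (λ y y′ → Share y z y′)

  clash? : ∀ z → (ys : Vec (Fin n) s) → Dec (Clash z ys)
  clash? z = somePair? (λ y y′ → share? y z y′)

  Meet : Vec (Fin n) s → Fin n → Fin n → Set
  Meet ys z z′ = Any (Share z z′) ys

  meet? : ∀ ys z z′ → Dec (Meet ys z z′)
  meet? ys z z′ = any? (share? z z′) ys

  meet-sym : ∀ ys {z z′} → Meet ys z z′ → Meet ys z′ z
  meet-sym ys = Any.map λ (b , p , q , o) → b , q , p , o

  Z° : Vec (Fin n) s → Fin n → Set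
  Z° ys z = Z ys z × ¬ Clash z ys

  Z°? : ∀ ys → Decidable (Z° ys)
  Z°? ys z = Z? ys z ×-dec ¬? (clash? z ys)

  -- Each y and z form a light pair and so have a middle vertex. If b i j = b i′ j′, this vertex is
  -- adjacent to all the ys and zs involved, so i ≠ i′ would be a `Clash` at z j and j ≠ j′ a `Meet`
  -- at y i. Repeated ys or zs are excluded in the same way.
  noCleanClique : ∀ ys → ¬ Clique (λ z z′ → ¬ Heavy z z′ × ¬ Meet ys z z′) (Z° ys) t
  noCleanClique ys (f , f∈ , f-clean) = noConfig record
    { root = r ; ys = y ; zs = f ; bs = λ i j → proj₁ (mid i j)
    ; ys-inj = y-inj ; zs-inj = f-inj ; bs-inj = mid-inj
    ; ys≢zs = λ i j → proj₁ (light i j)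
    ; root≢ys = λ i → proj₁ (y∈S i) ; root≢zs = λ j → proj₁ (proj₁ (proj₁ (f∈ j)))
    ; ys-bs = λ i j → proj₁ (proj₂ (mid i j)) ; zs-bs = λ i j → proj₂ (proj₂ (mid i j))
    ; root-ys = λ i → joined (y∈S i) ; root-zs = λ j → joined (proj₁ (proj₁ (f∈ j))) }
    where
    y : Fin s → Fin n
    y = lookup ys
    joined : ∀ {u} → S u → ∃ λ v → E u v × E r v
    joined {u} (_ , p) with #-∃ (common? r u) p
    ... | v , Er , Eu = v , Eu , Er
    j₀ : Fin t
    j₀ = first 2≤t
      where first : ∀ {t} → 2 ≤ t → Fin t
            first (s≤s _) = zero
    light : ∀ i j → Light (y i) (f j)
    light i j = proj₂ (lookup⁺ (proj₂ (proj₁ (f∈ j))) i)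
    y∈S : ∀ i → S (y i)
    y∈S i = proj₁ (lookup⁺ (proj₂ (proj₁ (f∈ j₀))) i)
    mid : ∀ i j → ∃ λ b → E (y i) b × E (f j) b
    mid i j = #-∃ (common? (y i) (f j)) (proj₁ (proj₂ (light i j)))
    sameY : ∀ {i i′} j b → E (y i) b → E (y i′) b → E (f j) b → i ≡ i′
    sameY {i} {i′} j b p p′ o with i Fin.≟ i′
    ... | yes eq = eq
    ... | no i≢i′ = contradiction (somePair-lookup (λ (b , p , q , o) → b , o , q , p) ys i≢i′ (b , p , o , p′)) (proj₂ (f∈ j))
    sameZ : ∀ {j j′} i b → E (f j) b → E (f j′) b → E (y i) b → j ≡ j′
    sameZ {j} {j′} i b p p′ o with j Fin.≟ j′
    ... | yes eq = eq
    ... | no j≢j′ = contradiction (any-lookup ys i (b , p , p′ , o)) (proj₂ (f-clean j≢j′))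
    y-inj : ∀ {i i′} → y i ≡ y i′ → i ≡ i′
    y-inj {i} {i′} eq = sameY j₀ (proj₁ (mid i j₀)) (proj₁ (proj₂ (mid i j₀)))
      (subst (λ u → E u (proj₁ (mid i j₀))) eq (proj₁ (proj₂ (mid i j₀)))) (proj₂ (proj₂ (mid i j₀)))
    f-inj : ∀ {j j′} → f j ≡ f j′ → j ≡ j′
    f-inj {j} {j′} eq = sameZ zero (proj₁ (mid zero j)) (proj₂ (proj₂ (mid zero j)))
      (subst (λ u → E u (proj₁ (mid zero j))) eq (proj₂ (proj₂ (mid zero j)))) (proj₁ (proj₂ (mid zero j)))
    mid-inj : ∀ {i i′ j j′} → proj₁ (mid i j) ≡ proj₁ (mid i′ j′) → i ≡ i′ × j ≡ j′
    mid-inj {i} {i′} {j} {j′} eq with mid i j | mid i′ j′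
    mid-inj {i} {i′} {j} {j′} refl | b , p , q | .b , p′ , q′ = sameY j b p p′ q , sameZ i b q q′ p

  -- `Meet` at a single y, for the pairs to which `share-count` applies: heavy pairs form a colour
  -- of their own and the diagonal is counted apart.
  Near : Fin n → Fin n → Fin n → Set
  Near z z′ y = (z ≢ z′ × ¬ Heavy z z′) × Share z z′ y

  near? : ∀ z z′ y → Dec (Near z z′ y)
  near? z z′ y = (¬? (z Fin.≟ z′) ×-dec ¬? (heavy? z z′)) ×-dec share? z z′ y

  private
    dirty : Vec (Fin n) s → Fin n → Fin n → ℕ
    dirty ys z z′ = 𝟙 (z Fin.≟ z′) + 𝟙 (any? (near? z z′) ys)

  -- Pairs are heavy, clean or dirty, and large cliques of the first two kinds are excluded. The sum
  -- over dirty pairs is then enlarged from `Z°` to `Z`, for which `exchange` is available.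
  cleanBound : ∀ ys → # (Z°? ys) * # (Z°? ys) ≤ q₀ * ∑Z² ys (dirty ys)
  cleanBound ys with SS.supersaturation (suc (s + t)) t (Z°? ys)
    where
    Clean Dirty : Fin n → Fin n → Set
    Clean z z′ = ¬ Heavy z z′ × ¬ Meet ys z z′
    Dirty z z′ = ¬ Heavy z z′ × Meet ys z z′
    dirty? : ∀ z z′ → Dec (Dirty z z′)
    dirty? z z′ = ¬? (heavy? z z′) ×-dec meet? ys z z′
    cover : ∀ z z′ → Heavy z z′ ⊎ Clean z z′ ⊎ Dirty z z′
    cover z z′ with heavy? z z′ | meet? ys z z′
    ... | yes p | _ = inj₁ p
    ... | no ¬p | no ¬q = inj₂ (inj₁ (¬p , ¬q))
    ... | no ¬p | yes q = inj₂ (inj₂ (¬p , q))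
    module SS = Supersaturation heavy? heavy-sym
      (λ z z′ → ¬? (heavy? z z′) ×-dec ¬? (meet? ys z z′)) (λ (p , q) → p ∘ heavy-sym , q ∘ meet-sym ys) dirty? cover
  ... | inj₁ c = ⊥-elim (noHeavyClique {Z° ys} c)
  ... | inj₂ (inj₁ c) = ⊥-elim (noCleanClique ys c)
  ... | inj₂ (inj₂ p) = ≤-trans p (*-monoʳ-≤ q₀ (sum-mono λ z → sum-mono λ z′ →
          *-mono-≤ (𝟙-mono (Z°? ys z) (Z? ys z) proj₁) (*-mono-≤ (𝟙-mono (Z°? ys z′) (Z? ys z′) proj₁) (bound z z′))))
    where
    bound : ∀ z z′ → 𝟙 (¬? (heavy? z z′) ×-dec meet? ys z z′) ≤ dirty ys z z′
    bound z z′ = 𝟙-≤ (¬? (heavy? z z′) ×-dec meet? ys z z′) λ (¬heavy , meet) → case ¬heavy meet (z Fin.≟ z′)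
      where
      case : ¬ Heavy z z′ → Meet ys z z′ → Dec (z ≡ z′) → 1 ≤ dirty ys z z′
      case _ _ (yes eq) = ≤-trans (≤-reflexive (sym (𝟙-yes (z Fin.≟ z′) eq))) (m≤m+n _ _)
      case ¬heavy meet (no z≢z′) = ≤-trans
        (≤-reflexive (sym (𝟙-yes (any? (near? z z′) ys) (Any.map ((z≢z′ , ¬heavy) ,_) meet)))) (m≤n+m _ (𝟙 (z Fin.≟ z′)))

  -- Pairs of centres with a `Clash` at either end are set aside, by symmetry at most twice those
  -- with one at z; `cleanBound` handles the rest, its diagonal giving the linear term.
  tupleBound : ∀ ys → # (Z? ys) * # (Z? ys) ≤
    q₀ * (# (Z? ys) + ∑Z² ys (λ z z′ → 𝟙 (any? (near? z z′) ys))) + 2 * ∑Z² ys (λ z z′ → 𝟙 (clash? z ys))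
  tupleBound ys = begin
    # (Z? ys) * # (Z? ys)
      ≡⟨ sum-product (λ z → 𝟙 (Z? ys z)) (λ z → 𝟙 (Z? ys z)) ⟩
    (sum λ z → sum λ z′ → 𝟙 (Z? ys z) * 𝟙 (Z? ys z′))
      ≤⟨ (sum-mono λ z → sum-mono λ z′ → 𝟙-split (Z? ys z) (Z? ys z′) (clash? z ys) (clash? z′ ys)) ⟩
    (sum λ z → sum λ z′ → 𝟙 (Z°? ys z) * 𝟙 (Z°? ys z′) + (u z z′ + v z z′))
      ≡⟨ trans (sum-cong-≗ λ z → ∑-distrib-+ (λ z′ → 𝟙 (Z°? ys z) * 𝟙 (Z°? ys z′)) _) (∑-distrib-+ (λ z → sum λ z′ → 𝟙 (Z°? ys z) * 𝟙 (Z°? ys z′)) _) ⟩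
    (sum λ z → sum λ z′ → 𝟙 (Z°? ys z) * 𝟙 (Z°? ys z′)) + (sum λ z → sum λ z′ → u z z′ + v z z′)
      ≡⟨ cong₂ _+_ (sym (sum-product (λ z → 𝟙 (Z°? ys z)) (λ z → 𝟙 (Z°? ys z))))
           (trans (sum-cong-≗ λ z → ∑-distrib-+ (u z) (v z)) (∑-distrib-+ (λ z → sum (u z)) _)) ⟩
    # (Z°? ys) * # (Z°? ys) + (X + (sum λ z → sum λ z′ → v z z′))
      ≡⟨ cong (λ x → # (Z°? ys) * # (Z°? ys) + (X + x)) swap ⟩
    # (Z°? ys) * # (Z°? ys) + (X + (X + 0))
      ≤⟨ +-monoˡ-≤ (2 * X) (≤-trans (cleanBound ys) (*-monoʳ-≤ q₀ (≤-trans (≤-reflexive (∑Z²-+ ys _ _)) (+-monoˡ-≤ _ diagonal)))) ⟩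
    q₀ * (# (Z? ys) + ∑Z² ys (λ z z′ → 𝟙 (any? (near? z z′) ys))) + 2 * X ∎
    where
    u v : Fin n → Fin n → ℕ
    u z z′ = 𝟙 (Z? ys z) * (𝟙 (Z? ys z′) * 𝟙 (clash? z ys))
    v z z′ = 𝟙 (Z? ys z) * (𝟙 (Z? ys z′) * 𝟙 (clash? z′ ys))
    X : ℕ
    X = ∑Z² ys (λ z z′ → 𝟙 (clash? z ys))
    exch : ∀ a b c → a * (b * c) ≡ b * (a * c)
    exch = solve-∀
    swap : (sum λ z → sum λ z′ → v z z′) ≡ X + 0
    swap = trans (∑-comm v) (trans (sum-cong-≗ λ z → sum-cong-≗ λ z′ → exch (𝟙 (Z? ys z′)) (𝟙 (Z? ys z)) (𝟙 (clash? z ys))) (sym (+-identityʳ X)))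
    diagonal : ∑Z² ys (λ z z′ → 𝟙 (z Fin.≟ z′)) ≤ # (Z? ys)
    diagonal = begin
      (sum λ z → sum λ z′ → 𝟙 (Z? ys z) * (𝟙 (Z? ys z′) * 𝟙 (z Fin.≟ z′)))
        ≤⟨ (sum-mono λ z → sum-mono λ z′ → *-monoʳ-≤ (𝟙 (Z? ys z)) (≤-trans (*-monoˡ-≤ _ (𝟙≤1 (Z? ys z′))) (≤-reflexive (*-identityˡ _)))) ⟩
      (sum λ z → sum λ z′ → 𝟙 (Z? ys z) * 𝟙 (z Fin.≟ z′))
        ≡⟨ (sum-cong-≗ λ z → trans (sym (*-distribˡ-sum (𝟙 (Z? ys z)) λ z′ → 𝟙 (z Fin.≟ z′))) (trans (cong (𝟙 (Z? ys z) *_) (#-≡ z)) (*-identityʳ _))) ⟩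
      # (Z? ys) ∎

  -- What remains of a ^ s once one entry of the tuple is confined to O(Δ) values.
  fans : ℕ
  fans = ∑S² λ z z′ → a z z′ ^ s′

  -- The stars whose two centres coincide.
  simpleStars : ℕ
  simpleStars = sumᵥ s λ ys → # (Z? ys)

  module _ (Δ : ℕ) (degree≤Δ : ∀ b → # (λ u → E? u b) ≤ Δ) where

    private
      M : ℕ
      M = s * t * Δ

    nearBound : sumᵥ s (λ ys → ∑Z² ys λ z z′ → 𝟙 (any? (near? z z′) ys)) ≤ s * M * fans
    nearBound = begin
      sumᵥ s (λ ys → ∑Z² ys λ z z′ → 𝟙 (any? (near? z z′) ys))
        ≡⟨ exchange (λ ys z z′ → 𝟙 (any? (near? z z′) ys)) ⟩
      ∑S² (λ z z′ → sumᵥ s λ ys → 𝟙 (all? (edges? z z′) ys) * 𝟙 (any? (near? z z′) ys))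
        ≤⟨ (∑S²-mono λ z z′ → Tuples.any-bound (edges? z z′) (near? z z′) (count z z′) s′) ⟩
      ∑S² (λ z z′ → s * M * a z z′ ^ s′)
        ≡⟨ ∑S²-* (s * M) (λ z z′ → a z z′ ^ s′) ⟩
      s * M * fans ∎
      where
      count : ∀ z z′ → (sum λ y → 𝟙 (edges? z z′ y) * 𝟙 (near? z z′ y)) ≤ M
      count z z′ = begin
        (sum λ y → 𝟙 (edges? z z′ y) * 𝟙 (near? z z′ y))
          ≤⟨ (sum-mono λ y → ≤-trans (*-monoˡ-≤ _ (𝟙≤1 (edges? z z′ y))) (≤-reflexive (trans (*-identityˡ _) (𝟙-× (¬? (z Fin.≟ z′) ×-dec ¬? (heavy? z z′)) (share? z z′ y))))) ⟩
        (sum λ y → 𝟙 (¬? (z Fin.≟ z′) ×-dec ¬? (heavy? z z′)) * 𝟙 (share? z z′ y))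
          ≡⟨ *-distribˡ-sum (𝟙 (¬? (z Fin.≟ z′) ×-dec ¬? (heavy? z z′))) (λ y → 𝟙 (share? z z′ y)) ⟨
        𝟙 (¬? (z Fin.≟ z′) ×-dec ¬? (heavy? z z′)) * # (share? z z′)
          ≤⟨ 𝟙-*-≤ (¬? (z Fin.≟ z′) ×-dec ¬? (heavy? z z′)) (λ (z≢z′ , ¬heavy) → share-count Δ degree≤Δ z≢z′ ¬heavy) ⟩
        M ∎

    clashBound : sumᵥ s (λ ys → ∑Z² ys λ z z′ → 𝟙 (clash? z ys)) ≤ s * s * M * fans
    clashBound = begin
      sumᵥ s (λ ys → ∑Z² ys λ z z′ → 𝟙 (clash? z ys))
        ≡⟨ exchange (λ ys z z′ → 𝟙 (clash? z ys)) ⟩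
      ∑S² (λ z z′ → sumᵥ s λ ys → 𝟙 (all? (edges? z z′) ys) * 𝟙 (clash? z ys))
        ≤⟨ (∑S²-mono λ z z′ → Tuples.somePair-bound (edges? z z′) (λ y y′ → share? y z y′) (count z z′) s′) ⟩
      ∑S² (λ z z′ → s * s * M * a z z′ ^ s′)
        ≡⟨ ∑S²-* (s * s * M) (λ z z′ → a z z′ ^ s′) ⟩
      s * s * M * fans ∎
      where
      count : ∀ z z′ y → (S y × Light y z) × (S y × Light y z′) → (sum λ y′ → 𝟙 (edges? z z′ y′) * 𝟙 (share? y z y′)) ≤ M
      count z z′ y ((_ , y≢z , _ , ¬heavy) , _) = ≤-trans
        (sum-mono λ y′ → ≤-trans (*-monoˡ-≤ _ (𝟙≤1 (edges? z z′ y′))) (≤-reflexive (*-identityˡ _))) (share-count Δ degree≤Δ y≢z ¬heavy)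

    starsBound : stars ≤ q₀ * (simpleStars + s * M * fans) + 2 * (s * s * M * fans)
    starsBound = begin
      stars
        ≡⟨ stars-≡ ⟩
      sumᵥ s (λ ys → # (Z? ys) * # (Z? ys))
        ≤⟨ sumᵥ-mono s tupleBound ⟩
      sumᵥ s (λ ys → q₀ * (# (Z? ys) + nr ys) + 2 * cl ys)
        ≡⟨ trans (sumᵥ-+ s (λ ys → q₀ * (# (Z? ys) + nr ys)) (λ ys → 2 * cl ys)) (cong₂ _+_ (sumᵥ-* s q₀ λ ys → # (Z? ys) + nr ys) (sumᵥ-* s 2 cl)) ⟩
      q₀ * sumᵥ s (λ ys → # (Z? ys) + nr ys) + 2 * sumᵥ s cl
        ≡⟨ cong (λ x → q₀ * x + 2 * sumᵥ s cl) (sumᵥ-+ s (λ ys → # (Z? ys)) nr) ⟩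
      q₀ * (simpleStars + sumᵥ s nr) + 2 * sumᵥ s cl
        ≤⟨ +-mono-≤ (*-monoʳ-≤ q₀ (+-monoʳ-≤ simpleStars nearBound)) (*-monoʳ-≤ 2 clashBound) ⟩
      q₀ * (simpleStars + s * M * fans) + 2 * (s * s * M * fans) ∎
      where
      nr cl : Vec (Fin n) s → ℕ
      nr ys = ∑Z² ys λ z z′ → 𝟙 (any? (near? z z′) ys)
      cl ys = ∑Z² ys λ z z′ → 𝟙 (clash? z ys)

    -- AM-GM for each tuple, K x ≤ x² + K²; the second term is charged only to tuples in S, as
    -- otherwise `Z ys` is empty. A large K makes the simple stars a small fraction of all stars, up
    -- to the last term.
    simpleStarsBound : ∀ K → K * simpleStars ≤ stars + K * K * m ^ s
    simpleStarsBound K = begin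
      K * simpleStars                                              ≡⟨ sumᵥ-* s K (λ ys → # (Z? ys)) ⟨
      sumᵥ s (λ ys → K * # (Z? ys))                                ≤⟨ sumᵥ-mono s bound ⟩
      sumᵥ s (λ ys → # (Z? ys) * # (Z? ys) + K * K * 𝟙 (all? S? ys))
        ≡⟨ trans (sumᵥ-+ s (λ ys → # (Z? ys) * # (Z? ys)) _) (cong₂ _+_ (sym stars-≡) (trans (sumᵥ-* s (K * K) λ ys → 𝟙 (all? S? ys)) (cong (K * K *_) (Tuples.sumᵥ-all S? s)))) ⟩
      stars + K * K * m ^ s                                        ∎
      where
      am-gm : ∀ x → K * x ≤ x * x + K * K
      am-gm x = ≤-trans (m≤n*m (K * x) 2) (≤-trans (2ab≤a²+b² K x) (≤-reflexive (+-comm (K * K) (x * x))))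
      bound : ∀ ys → K * # (Z? ys) ≤ # (Z? ys) * # (Z? ys) + K * K * 𝟙 (all? S? ys)
      bound ys = case (all? S? ys)
        where
        case : Dec (All S ys) → K * # (Z? ys) ≤ # (Z? ys) * # (Z? ys) + K * K * 𝟙 (all? S? ys)
        case (yes p) rewrite 𝟙-yes (all? S? ys) p | *-identityʳ (K * K) = am-gm (# (Z? ys))
        case (no ¬p) rewrite sum-0 {f = λ z → 𝟙 (Z? ys z)} (λ z → 𝟙-no (Z? ys z) λ (_ , p) → ¬p (All.map proj₁ p)) | *-zeroʳ K = z≤n

    -- The degenerate stars number O(Δ) · ∑ a ^ (s - 1), which is small against ∑ a ^ s once the average
    -- codegree 2θ exceeds a large multiple of Δ.
    manyStars-contradiction : ∀ θ → 1 ≤ θ → 1 ≤ m → 2 * (m * m * θ) ≤ ∑S² a →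
      8 * ((q₀ * s + 2 * (s * s)) * (s * t)) * Δ ≤ θ → 8 * q₀ * (8 * q₀) * m ^ s ≤ m * m * θ ^ s → ⊥
    manyStars-contradiction θ 1≤θ 1≤m dense θ-large m-large = <⇒≱ (≤-trans 1≤m²θˢ m²θˢ≤W) (+-cancelˡ-≤ (7 * W) W 0 (begin
      -- Eight times `stars` turns out to be at most four times `stars`: two come from the simple
      -- stars, taken with K = 8 q₀, and two from the degenerate ones.
      7 * W + W                                                                   ≡⟨ eq₁ W ⟩
      8 * W                                                                       ≤⟨ *-monoʳ-≤ 8 starsBound ⟩
      8 * (q₀ * (simpleStars + s * M * fans) + 2 * (s * s * M * fans))            ≡⟨ eq₂ q₀ simpleStars s (s * t) Δ fans ⟩
      8 * q₀ * simpleStars + 8 * ((q₀ * s + 2 * (s * s)) * (s * t)) * Δ * fans    ≤⟨ +-mono-≤ (simpleStarsBound (8 * q₀)) (*-monoˡ-≤ fans θ-large) ⟩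
      (W + 8 * q₀ * (8 * q₀) * m ^ s) + θ * fans                                  ≤⟨ +-mono-≤ (+-monoʳ-≤ W (≤-trans m-large m²θˢ≤W)) fansBound ⟩
      (W + W) + (W + W)                                                           ≤⟨ m≤m+n _ (3 * W) ⟩
      (W + W) + (W + W) + 3 * W                                                   ≡⟨ eq₃ W ⟩
      7 * W + 0                                                                   ∎))
      where
      W = stars
      eq₁ : ∀ W → 7 * W + W ≡ 8 * W
      eq₁ = solve-∀
      eq₂ : ∀ q N s h Δ F → 8 * (q * (N + s * (h * Δ) * F) + 2 * (s * s * (h * Δ) * F)) ≡ 8 * q * N + 8 * ((q * s + 2 * (s * s)) * h) * Δ * F
      eq₂ = solve-∀
      eq₃ : ∀ W → (W + W) + (W + W) + 3 * W ≡ 7 * W + 0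
      eq₃ = solve-∀
      1≤m²θˢ : 1 ≤ m * m * θ ^ s
      1≤m²θˢ = *-mono-≤ (*-mono-≤ 1≤m 1≤m) (≤-trans (≤-reflexive (sym (^-zeroˡ s))) (^-monoˡ-≤ s 1≤θ))
      m²θˢ≤W : m * m * θ ^ s ≤ W
      -- `tangent` costs one m² θˢ; an average codegree of 2θ leaves another one.
      m²θˢ≤W = +-cancelʳ-≤ (m * m * θ ^ s) _ _ (begin
        m * m * θ ^ s + m * m * θ ^ s           ≡⟨ eq₄ m θ (θ ^ s′) ⟩
        θ ^ s′ * (2 * (m * m * θ))              ≤⟨ *-monoʳ-≤ (θ ^ s′) dense ⟩
        θ ^ s′ * ∑S² a                          ≡⟨ ∑S²-* (θ ^ s′) a ⟨
        ∑S² (λ z z′ → θ ^ s′ * a z z′)          ≤⟨ (∑S²-mono λ z z′ → tangent s′ (a z z′) θ) ⟩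
        ∑S² (λ z z′ → a z z′ ^ s + θ ^ s)       ≡⟨ trans (∑S²-+ (λ z z′ → a z z′ ^ s) (λ _ _ → θ ^ s)) (cong (W +_) (∑S²-const (θ ^ s))) ⟩
        W + m * m * θ ^ s                       ∎)
        where eq₄ : ∀ m θ x → m * m * (θ * x) + m * m * (θ * x) ≡ x * (2 * (m * m * θ))
              eq₄ = solve-∀
      fansBound : θ * fans ≤ W + W
      fansBound = begin
        θ * fans                                ≡⟨ ∑S²-* θ (λ z z′ → a z z′ ^ s′) ⟨
        ∑S² (λ z z′ → θ * a z z′ ^ s′)          ≤⟨ (∑S²-mono λ z z′ → cotangent s′ (a z z′) θ) ⟩
        ∑S² (λ z z′ → a z z′ ^ s + θ ^ s)       ≡⟨ trans (∑S²-+ (λ z z′ → a z z′ ^ s) (λ _ _ → θ ^ s)) (cong (W +_) (∑S²-const (θ ^ s))) ⟩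
        W + m * m * θ ^ s                       ≤⟨ +-monoʳ-≤ W m²θˢ≤W ⟩
        W + W                                   ∎

-- Almost regular bipartite graphs

^-pos : ∀ {m} k → 1 ≤ m → 1 ≤ m ^ k
^-pos k 1≤m = ≤-trans (≤-reflexive (sym (^-zeroˡ k))) (^-monoˡ-≤ k 1≤m)

*-^ : ∀ m n k → (m * n) ^ k ≡ m ^ k * n ^ k
*-^ m n zero = refl
*-^ m n (suc k) = trans (cong (m * n *_) (*-^ m n k)) (eq m n (m ^ k) (n ^ k))
  where eq : ∀ a b c d → a * b * (c * d) ≡ a * c * (b * d)
        eq = solve-∀

*-cancelˡ-≤′ : ∀ k {m n} → 1 ≤ k → k * m ≤ k * n → m ≤ n
*-cancelˡ-≤′ (suc k) _ = *-cancelˡ-≤ (suc k)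

-- The factor lost in `manyLight`.
codegreeConstant : ℕ → ℕ → ℕ
codegreeConstant s t = 2 * (cliqueConstant s t * (s * t))

-- The coefficient of Δ times `fans` in eight copies of `starsBound`.
overlapConstant : ℕ → ℕ → ℕ
overlapConstant s t = 8 * ((cliqueConstant s t * s + 2 * (s * s)) * (s * t))

module Core {n′ : ℕ} (s′ t : ℕ) (2≤t : 2 ≤ t) {E : Fin (suc n′) → Fin (suc n′) → Set} (E? : ∀ u v → Dec (E u v))
  (noConfig : ¬ Config (suc s′) t E) {B : Fin (suc n′) → Set} (B? : Decidable B) (E⇒B : ∀ {u b} → E u b → B b) where

  open ≤-Reasoning
  open Codegree (suc s′) t (s≤s z≤n) 2≤t E? noConfig

  private
    module R r = Rooted s′ t 2≤t E? noConfig r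
    n⁺ = suc n′
    s = suc s′
    C = codegreeConstant s t
    N = # B?

  edges : ℕ
  edges = sum λ b → # λ u → E? u b

  -- `manyLight` on all vertices, then averaging: the root is a vertex with the most light partners,
  -- and these lie in its second neighbourhood.
  richRoot : 2 * (N * q₀) ≤ edges → ∃ λ r → edges * edges ≤ C * (N * (n⁺ * R.m r))
  richRoot large = r , (begin
    edges * edges                            ≡⟨ cong₂ _*_ sum-q sum-q ⟨
    sum (q ⊤?) * sum (q ⊤?)                  ≤⟨ manyLight ⊤? B? E⇒B (subst (2 * (N * q₀) ≤_) (sym sum-q) large) ⟩
    C * (N * lightPairs ⊤?)                  ≤⟨ *-monoʳ-≤ C (*-monoʳ-≤ N r-max) ⟩
    C * (N * (n⁺ * sum (lightAt r)))          ≤⟨ *-monoʳ-≤ C (*-monoʳ-≤ N (*-monoʳ-≤ n⁺ (sum-mono bound))) ⟩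
    C * (N * (n⁺ * R.m r))                    ∎)
    where
    ⊤? : Decidable {A = Fin n⁺} (λ _ → ⊤)
    ⊤? _ = yes tt
    sum-q : sum (q ⊤?) ≡ edges
    sum-q = sum-cong-≗ λ b → sum-cong-≗ λ u → 𝟙-cong (yes tt ×-dec E? u b) (E? u b) proj₂ (tt ,_)
    lightAt : Fin n⁺ → Fin n⁺ → ℕ
    lightAt u v = 𝟙 (⊤? u) * (𝟙 (⊤? v) * 𝟙 (light? u v))
    r = proj₁ (sum-max λ u → sum (lightAt u))
    r-max = proj₂ (sum-max λ u → sum (lightAt u))
    bound : ∀ v → lightAt r v ≤ 𝟙 (R.S? r v)
    bound v = ≤-trans (≤-reflexive (𝟙-×₃ (⊤? r) (⊤? v) (light? r v)))
      (𝟙-mono (⊤? r ×-dec ⊤? v ×-dec light? r v) (R.S? r v) λ (_ , _ , r≢v , 1≤h , _) → r≢v , 1≤h)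

  module _ (r : Fin n⁺) (δ : ℕ) (δ≤degree : ∀ u → (∃ λ b → E u b) → δ ≤ # (E? u)) where

    open R r using (m; S; S?; ∑S²; a; lightPairs²; manyStars-contradiction)

    sum-q≥ : m * δ ≤ sum (q S?)
    sum-q≥ = begin
      m * δ                                      ≡⟨ *-distribʳ-sum δ (λ u → 𝟙 (S? u)) ⟩
      (sum λ u → 𝟙 (S? u) * δ)                   ≤⟨ (sum-mono λ u → 𝟙-*-mono (S? u) λ (_ , 1≤h) → δ≤degree u (neighbour u 1≤h)) ⟩
      (sum λ u → 𝟙 (S? u) * # (E? u))            ≡⟨ (sum-cong-≗ λ u → trans (*-distribˡ-sum (𝟙 (S? u)) λ b → 𝟙 (E? u b)) (sum-cong-≗ λ b → sym (𝟙-× (S? u) (E? u b)))) ⟩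
      (sum λ u → sum λ b → 𝟙 (S? u ×-dec E? u b)) ≡⟨ ∑-comm (λ u b → 𝟙 (S? u ×-dec E? u b)) ⟩
      sum (q S?)                                 ∎
      where
      neighbour : ∀ u → 1 ≤ h r u → ∃ λ b → E u b
      neighbour u 1≤h with #-∃ (common? r u) 1≤h
      ... | b , _ , Eu = b , Eu

    -- Degrees at least δ give, by `manyLight`, of order (m δ)² / N light pairs in S; squaring and
    -- `lightPairs²` turn this into an average codegree of at least m δ⁴ / (C N)².
    manyCodegrees : 1 ≤ m → 2 * (N * q₀) ≤ m * δ → m * m * m * ((δ * δ) * (δ * δ)) ≤ C * C * (N * N) * ∑S² a
    manyCodegrees 1≤m large = *-cancelˡ-≤′ m 1≤m (begin
      m * (m * m * m * ((δ * δ) * (δ * δ)))                    ≡⟨ eq₁ m δ ⟩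
      (m * δ * (m * δ)) * (m * δ * (m * δ))                    ≤⟨ *-mono-≤ lightBound lightBound ⟩
      (C * (N * L)) * (C * (N * L))                            ≡⟨ eq₂ C N L ⟩
      C * C * (N * N) * (L * L)                                ≤⟨ *-monoʳ-≤ (C * C * (N * N)) lightPairs² ⟩
      C * C * (N * N) * (m * ∑S² a)                            ≡⟨ eq₃ (C * C * (N * N)) m (∑S² a) ⟩
      m * (C * C * (N * N) * ∑S² a)                            ∎)
      where
      L = lightPairs S?
      eq₁ : ∀ m δ → m * (m * m * m * ((δ * δ) * (δ * δ))) ≡ (m * δ * (m * δ)) * (m * δ * (m * δ))
      eq₁ = solve-∀
      eq₂ : ∀ C N L → (C * (N * L)) * (C * (N * L)) ≡ C * C * (N * N) * (L * L)
      eq₂ = solve-∀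
      eq₃ : ∀ x m y → x * (m * y) ≡ m * (x * y)
      eq₃ = solve-∀
      lightBound : m * δ * (m * δ) ≤ C * (N * L)
      lightBound = ≤-trans (*-mono-≤ sum-q≥ sum-q≥) (manyLight S? B? E⇒B (≤-trans large sum-q≥))

    module _ (Δ : ℕ) (degree≤Δ : ∀ b → # (λ u → E? u b) ≤ Δ) where

      private
        X = m * ((δ * δ) * (δ * δ))
        Y = 2 * (C * C * (N * N))

      -- θ is half the average guaranteed by `manyCodegrees`, rounded down. As it is of order m δ⁴ /
      -- N², the factor m ^ s cancels from the last condition of `manyStars-contradiction`, which
      -- leaves the last hypothesis here.
      rootContradiction : 1 ≤ m → 1 ≤ Y → 1 ≤ overlapConstant s t * Δ → 2 * (N * q₀) ≤ m * δ →
        overlapConstant s t * Δ * Y ≤ X →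
        8 * q₀ * (8 * q₀) * (2 * Y) ^ s ≤ m * m * ((δ * δ) * (δ * δ)) ^ s → ⊥
      rootContradiction 1≤m 1≤Y 1≤KΔ large-q large-Δ large-m =
        manyStars-contradiction Δ degree≤Δ θ (≤-trans 1≤KΔ KΔ≤θ) 1≤m dense KΔ≤θ
          (*-cancelˡ-≤′ ((2 * Y) ^ s) (^-pos s (≤-trans 1≤Y (m≤n*m Y 2))) (begin
            (2 * Y) ^ s * (8 * q₀ * (8 * q₀) * m ^ s)           ≡⟨ eq₁ ((2 * Y) ^ s) (8 * q₀ * (8 * q₀)) (m ^ s) ⟩
            m ^ s * (8 * q₀ * (8 * q₀) * (2 * Y) ^ s)           ≤⟨ *-monoʳ-≤ (m ^ s) large-m ⟩
            m ^ s * (m * m * ((δ * δ) * (δ * δ)) ^ s)           ≡⟨ eq₂ (m ^ s) (m * m) (((δ * δ) * (δ * δ)) ^ s) ⟩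
            m * m * (m ^ s * ((δ * δ) * (δ * δ)) ^ s)           ≡⟨ cong (m * m *_) (*-^ m ((δ * δ) * (δ * δ)) s) ⟨
            m * m * X ^ s                                       ≤⟨ *-monoʳ-≤ (m * m) (^-monoˡ-≤ s X≤2Yθ) ⟩
            m * m * (2 * Y * θ) ^ s                             ≡⟨ cong (m * m *_) (*-^ (2 * Y) θ s) ⟩
            m * m * ((2 * Y) ^ s * θ ^ s)                       ≡⟨ eq₂ ((2 * Y) ^ s) (m * m) (θ ^ s) ⟨
            (2 * Y) ^ s * (m * m * θ ^ s)                       ∎))
        where
        instance
          Y≢0 : NonZero Y
          Y≢0 = >-nonZero 1≤Y
        θ : ℕ
        θ = X / Y
        eq₁ : ∀ a b c → a * (b * c) ≡ c * (b * a)
        eq₁ = solve-∀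
        eq₂ : ∀ a b c → a * (b * c) ≡ b * (a * c)
        eq₂ = solve-∀
        KΔ≤θ : overlapConstant s t * Δ ≤ θ
        KΔ≤θ = ≤-trans (≤-reflexive (sym (m*n/n≡m (overlapConstant s t * Δ) Y))) (/-monoˡ-≤ Y large-Δ)
        -- As θ ≥ 1, rounding down costs at most a factor 2.
        X≤2Yθ : X ≤ 2 * Y * θ
        X≤2Yθ = begin
          X                    ≡⟨ m≡m%n+[m/n]*n X Y ⟩
          X % Y + θ * Y        ≤⟨ +-monoˡ-≤ (θ * Y) (≤-trans (<⇒≤ (m%n<n X Y)) (m≤n*m Y θ ⦃ >-nonZero (≤-trans 1≤KΔ KΔ≤θ) ⦄)) ⟩
          θ * Y + θ * Y        ≡⟨ eq₃ θ Y ⟩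
          2 * Y * θ            ∎
          where eq₃ : ∀ a b → a * b + a * b ≡ 2 * b * a
                eq₃ = solve-∀
        1≤CN : 1 ≤ C * C * (N * N)
        1≤CN = n≢0⇒n>0 λ eq → <⇒≱ 1≤Y (≤-reflexive (cong (2 *_) eq))
        dense : 2 * (m * m * θ) ≤ ∑S² a
        dense = *-cancelˡ-≤′ (C * C * (N * N)) 1≤CN (begin
          C * C * (N * N) * (2 * (m * m * θ))              ≡⟨ eq₄ (C * C * (N * N)) (m * m) θ ⟩
          m * m * (θ * Y)                                  ≤⟨ *-monoʳ-≤ (m * m) (m/n*n≤m X Y) ⟩
          m * m * (m * ((δ * δ) * (δ * δ)))                ≡⟨ *-assoc (m * m) m ((δ * δ) * (δ * δ)) ⟨
          m * m * m * ((δ * δ) * (δ * δ))                  ≤⟨ manyCodegrees 1≤m large-q ⟩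
          C * C * (N * N) * ∑S² a                          ∎)
          where eq₄ : ∀ c b θ → c * (2 * (b * θ)) ≡ b * (θ * (2 * c))
                eq₄ = solve-∀

-- Density conditions without denominators

sq-^ : ∀ a k → (a * a) ^ k ≡ a ^ (2 * k)
sq-^ a k = trans (cong (λ x → (a * x) ^ k) (sym (*-identityʳ a))) (^-*-assoc a 2 k)

-- The inputs are m ≥ f² / (4CNn), δ ≥ f / (4n) and Δ ≤ 8f / N, cleared of denominators.
module Arithmetic {n N m δ Δ f C : ℕ} (1≤n : 1 ≤ n) (1≤N : 1 ≤ N) (1≤C : 1 ≤ C)
  (m-large : f * f ≤ 4 * (C * (N * (n * m)))) (δ-large : f ≤ 4 * (n * δ)) (Δ-small : N * Δ ≤ 8 * f) where

  open ≤-Reasoning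

  -- For `manyLight` inside S: the bounds on m and δ multiply to f ^ 3.
  mδ-bound : ∀ q → 32 * (C * q) * (n ^ 2 * N ^ 2) ≤ f ^ 3 → 2 * (N * q) ≤ m * δ
  mδ-bound q h = *-cancelˡ-≤′ (16 * (C * (N * (n * n)))) (*-mono-≤ {1} {16} (s≤s z≤n) (*-mono-≤ 1≤C (*-mono-≤ 1≤N (*-mono-≤ 1≤n 1≤n)))) (begin
    16 * (C * (N * (n * n))) * (2 * (N * q))            ≡⟨ eq₁ C N n q ⟩
    32 * (C * q) * (n ^ 2 * N ^ 2)                      ≤⟨ h ⟩
    f ^ 3                                               ≡⟨ eq₂ f ⟩
    f * f * f                                           ≤⟨ *-mono-≤ m-large δ-large ⟩
    4 * (C * (N * (n * m))) * (4 * (n * δ))             ≡⟨ eq₃ C N n m δ ⟩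
    16 * (C * (N * (n * n))) * (m * δ)                  ∎)
    where
    eq₁ : ∀ C N n q → 16 * (C * (N * (n * n))) * (2 * (N * q)) ≡ 32 * (C * q) * (n * (n * 1) * (N * (N * 1)))
    eq₁ = solve-∀
    eq₂ : ∀ f → f * (f * (f * 1)) ≡ f * f * f
    eq₂ = solve-∀
    eq₃ : ∀ C N n m δ → 4 * (C * (N * (n * m))) * (4 * (n * δ)) ≡ 16 * (C * (N * (n * n))) * (m * δ)
    eq₃ = solve-∀

  -- For θ against Δ: the bound on m and the fourth power of that on δ give f ^ 6, of which
  -- `Δ-small` uses up one factor.
  mδ⁴-bound : ∀ K → 16384 * (C * C * C * K) * (n ^ 5 * N ^ 2) ≤ f ^ 5 →
    K * Δ * (2 * (C * C * (N * N))) ≤ m * ((δ * δ) * (δ * δ))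
  mδ⁴-bound K h = *-cancelˡ-≤′ U (*-mono-≤ {1} {1024} (s≤s z≤n) (*-mono-≤ 1≤C (*-mono-≤ 1≤N (^-pos 5 1≤n)))) (begin
    U * (K * Δ * (2 * (C * C * (N * N))))                   ≡⟨ eq₁ C N (n ^ 5) K Δ ⟩
    2048 * (C * C * C * K) * (n ^ 5 * N ^ 2) * (N * Δ)      ≤⟨ *-monoʳ-≤ (2048 * (C * C * C * K) * (n ^ 5 * N ^ 2)) Δ-small ⟩
    2048 * (C * C * C * K) * (n ^ 5 * N ^ 2) * (8 * f)      ≡⟨ eq₂ (C * C * C * K) (n ^ 5 * N ^ 2) f ⟩
    16384 * (C * C * C * K) * (n ^ 5 * N ^ 2) * f           ≤⟨ *-monoˡ-≤ f h ⟩
    f ^ 5 * f                                               ≡⟨ eq₃ f ⟩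
    f * f * ((f * f) * (f * f))                             ≤⟨ *-mono-≤ m-large (*-mono-≤ (*-mono-≤ δ-large δ-large) (*-mono-≤ δ-large δ-large)) ⟩
    4 * (C * (N * (n * m))) * ((4 * (n * δ) * (4 * (n * δ))) * (4 * (n * δ) * (4 * (n * δ))))  ≡⟨ eq₄ C N n m δ ⟩
    U * (m * ((δ * δ) * (δ * δ)))                           ∎)
    where
    U = 1024 * (C * (N * n ^ 5))
    eq₁ : ∀ C N w K Δ → 1024 * (C * (N * w)) * (K * Δ * (2 * (C * C * (N * N)))) ≡ 2048 * (C * C * C * K) * (w * (N * (N * 1))) * (N * Δ)
    eq₁ = solve-∀
    eq₂ : ∀ a b f → 2048 * a * b * (8 * f) ≡ 16384 * a * b * f
    eq₂ = solve-∀
    eq₃ : ∀ f → f * (f * (f * (f * (f * 1)))) * f ≡ f * f * ((f * f) * (f * f))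
    eq₃ = solve-∀
    eq₄ : ∀ C N n m δ → 4 * (C * (N * (n * m))) * ((4 * (n * δ) * (4 * (n * δ))) * (4 * (n * δ) * (4 * (n * δ)))) ≡
      1024 * (C * (N * (n * (n * (n * (n * (n * 1))))))) * (m * ((δ * δ) * (δ * δ)))
    eq₄ = solve-∀

  -- Both sides are squares; their roots, compared in `half`, set m δ ^ (2s) against N ^ s, hence f
  -- ^ (2s + 2) against n ^ (2s + 1) N ^ (s + 1).
  mδ²ˢ-bound : ∀ s q → q * (4 * C) * (32 * C) ^ s * (n ^ suc (2 * s) * N ^ suc s) ≤ f ^ (2 * suc s) →
    q * q * (2 * (2 * (C * C * (N * N)))) ^ s ≤ m * m * ((δ * δ) * (δ * δ)) ^ s
  mδ²ˢ-bound s q h = begin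
    q * q * (2 * (2 * (C * C * (N * N)))) ^ s                ≡⟨ cong (λ x → q * q * x ^ s) (eq₁ C N) ⟩
    q * q * (2 * C * N * (2 * C * N)) ^ s                    ≡⟨ cong (q * q *_) (*-^ (2 * C * N) (2 * C * N) s) ⟩
    q * q * (G * G)                                          ≡⟨ eq₂ q G ⟩
    (q * G) * (q * G)                                        ≤⟨ *-mono-≤ half half ⟩
    (m * (δ * δ) ^ s) * (m * (δ * δ) ^ s)                    ≡⟨ eq₂ m ((δ * δ) ^ s) ⟨
    m * m * ((δ * δ) ^ s * (δ * δ) ^ s)                      ≡⟨ cong (m * m *_) (*-^ (δ * δ) (δ * δ) s) ⟨
    m * m * ((δ * δ) * (δ * δ)) ^ s                          ∎
    where
    G = (2 * C * N) ^ s
    H = (16 * (n * n)) ^ s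
    U = 4 * (C * (N * n)) * H
    eq₁ : ∀ C N → 2 * (2 * (C * C * (N * N))) ≡ 2 * C * N * (2 * C * N)
    eq₁ = solve-∀
    eq₂ : ∀ q G → q * q * (G * G) ≡ (q * G) * (q * G)
    eq₂ = solve-∀
    eq₃ : ∀ C N n q G H → 4 * (C * (N * n)) * H * (q * G) ≡ q * (4 * C) * (N * n) * (G * H)
    eq₃ = solve-∀
    eq₄ : ∀ C N n → 2 * C * N * (16 * (n * n)) ≡ 32 * C * (N * (n * n))
    eq₄ = solve-∀
    eq₅ : ∀ a N n A B D → a * (N * n) * (A * (B * D)) ≡ a * A * (n * D * (N * B))
    eq₅ = solve-∀
    eq₆ : ∀ n δ → 4 * (n * δ) * (4 * (n * δ)) ≡ 16 * (n * n) * (δ * δ)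
    eq₆ = solve-∀
    eq₇ : ∀ C N n m H D → 4 * (C * (N * (n * m))) * (H * D) ≡ 4 * (C * (N * n)) * H * (m * D)
    eq₇ = solve-∀
    half : q * G ≤ m * (δ * δ) ^ s
    half = *-cancelˡ-≤′ U (*-mono-≤ (*-mono-≤ {1} {4} (s≤s z≤n) (*-mono-≤ 1≤C (*-mono-≤ 1≤N 1≤n))) (^-pos s (*-mono-≤ {1} {16} (s≤s z≤n) (*-mono-≤ 1≤n 1≤n)))) (begin
      U * (q * G)                                                        ≡⟨ eq₃ C N n q G H ⟩
      q * (4 * C) * (N * n) * (G * H)                                    ≡⟨ cong (q * (4 * C) * (N * n) *_) (*-^ (2 * C * N) (16 * (n * n)) s) ⟨
      q * (4 * C) * (N * n) * (2 * C * N * (16 * (n * n))) ^ s           ≡⟨ cong (λ x → q * (4 * C) * (N * n) * x ^ s) (eq₄ C N n) ⟩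
      q * (4 * C) * (N * n) * (32 * C * (N * (n * n))) ^ s               ≡⟨ cong (q * (4 * C) * (N * n) *_) (trans (*-^ (32 * C) (N * (n * n)) s) (cong ((32 * C) ^ s *_) (*-^ N (n * n) s))) ⟩
      q * (4 * C) * (N * n) * ((32 * C) ^ s * (N ^ s * (n * n) ^ s))     ≡⟨ eq₅ (q * (4 * C)) N n ((32 * C) ^ s) (N ^ s) ((n * n) ^ s) ⟩
      q * (4 * C) * (32 * C) ^ s * (n * (n * n) ^ s * (N * N ^ s))       ≡⟨ cong (λ x → q * (4 * C) * (32 * C) ^ s * (n * x * (N * N ^ s))) (sq-^ n s) ⟩
      q * (4 * C) * (32 * C) ^ s * (n ^ suc (2 * s) * N ^ suc s)         ≤⟨ h ⟩
      f ^ (2 * suc s)                                                    ≡⟨ sq-^ f (suc s) ⟨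
      f * f * (f * f) ^ s                                                ≤⟨ *-mono-≤ m-large (^-monoˡ-≤ s (*-mono-≤ δ-large δ-large)) ⟩
      4 * (C * (N * (n * m))) * (4 * (n * δ) * (4 * (n * δ))) ^ s        ≡⟨ cong (λ x → 4 * (C * (N * (n * m))) * x ^ s) (eq₆ n δ) ⟩
      4 * (C * (N * (n * m))) * (16 * (n * n) * (δ * δ)) ^ s             ≡⟨ cong (4 * (C * (N * (n * m))) *_) (*-^ (16 * (n * n)) (δ * δ) s) ⟩
      4 * (C * (N * (n * m))) * (H * (δ * δ) ^ s)                        ≡⟨ eq₇ C N n m H ((δ * δ) ^ s) ⟩
      U * (m * (δ * δ) ^ s)                                              ∎)

1≤cliqueConstant : ∀ s t → 1 ≤ cliqueConstant s t
1≤cliqueConstant s t = ^-pos (suc (s + t) + t) (s≤s z≤n)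

1≤s*t : ∀ s′ t → 2 ≤ t → 1 ≤ suc s′ * t
1≤s*t s′ t 2≤t = *-mono-≤ {1} {suc s′} (s≤s z≤n) (≤-trans (s≤s z≤n) 2≤t)

1≤codegreeConstant : ∀ s′ t → 2 ≤ t → 1 ≤ codegreeConstant (suc s′) t
1≤codegreeConstant s′ t 2≤t = *-mono-≤ {1} {2} (s≤s z≤n) (*-mono-≤ (1≤cliqueConstant (suc s′) t) (1≤s*t s′ t 2≤t))

1≤overlapConstant : ∀ s′ t → 2 ≤ t → 1 ≤ overlapConstant (suc s′) t
1≤overlapConstant s′ t 2≤t = *-mono-≤ {1} {8} (s≤s z≤n) (*-mono-≤
  (≤-trans (*-mono-≤ {1} {_} {1} {suc s′} (1≤cliqueConstant (suc s′) t) (s≤s z≤n)) (m≤m+n _ _)) (1≤s*t s′ t 2≤t))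

opaque
  -- Constants of the four requirements; a numerical subscript is the power of f it belongs to, and
  -- `cₛ` belongs to 2(s + 1).
  c₁ c₃ c₅ cₛ : ℕ → ℕ → ℕ
  c₁ s t = 4 * cliqueConstant s t
  c₃ s t = 32 * (codegreeConstant s t * cliqueConstant s t)
  c₅ s t = 16384 * (codegreeConstant s t * codegreeConstant s t * codegreeConstant s t * overlapConstant s t)
  cₛ s t = 8 * cliqueConstant s t * (4 * codegreeConstant s t) * (32 * codegreeConstant s t) ^ s

  1≤c₁ : ∀ s t → 1 ≤ c₁ s t
  1≤c₁ s t = *-mono-≤ {1} {4} (s≤s z≤n) (1≤cliqueConstant s t)

  -- 32 = 2 ^ 5 lets `2n≤f` be read off the requirement on f ^ 5.
  32≤c₅ : ∀ s′ t → 2 ≤ t → 32 ≤ c₅ (suc s′) t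
  32≤c₅ s′ t 2≤t = ≤-trans (m≤m+n 32 16352) (m≤m*n 16384 (C * C * C * overlapConstant (suc s′) t) ⦃ >-nonZero
    (*-mono-≤ (*-mono-≤ (*-mono-≤ (1≤codegreeConstant s′ t 2≤t) (1≤codegreeConstant s′ t 2≤t)) (1≤codegreeConstant s′ t 2≤t)) (1≤overlapConstant s′ t 2≤t)) ⦄)
    where
    C : ℕ
    C = codegreeConstant (suc s′) t

  -- In use f counts the edges before vertices of small degree are deleted, which loses at most half
  -- of them. The four bounds serve the root, the light pairs in S, θ against Δ, and the simple
  -- stars.
  almostRegular : ∀ {n′} s′ t → 2 ≤ t → {E : Fin (suc n′) → Fin (suc n′) → Set} (E? : ∀ u v → Dec (E u v)) →
    ¬ Config (suc s′) t E → {B : Fin (suc n′) → Set} (B? : Decidable B) → (∀ {u b} → E u b → B b) →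
    ∀ f δ Δ → (∀ u → (∃ λ b → E u b) → δ ≤ # (E? u)) → (∀ b → # (λ u → E? u b) ≤ Δ) →
    f ≤ 2 * (sum λ b → # λ u → E? u b) → f ≤ 4 * (suc n′ * δ) → # B? * Δ ≤ 8 * f → 1 ≤ # B? → 1 ≤ Δ →
    let n⁺ = suc n′ ; s = suc s′ ; N = # B? in
    c₁ s t * (n⁺ ^ 0 * N ^ 1) ≤ f ^ 1 → c₃ s t * (n⁺ ^ 2 * N ^ 2) ≤ f ^ 3 → c₅ s t * (n⁺ ^ 5 * N ^ 2) ≤ f ^ 5 →
    cₛ s t * (n⁺ ^ suc (2 * s) * N ^ suc s) ≤ f ^ (2 * suc s) → ⊥
  almostRegular {n′} s′ t 2≤t E? noConfig B? E⇒B f δ Δ δ≤degree degree≤Δ f≤2e f≤4nδ NΔ≤8f 1≤N 1≤Δ F₁ F₃ F₅ Fₛ =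
    rootContradiction r δ δ≤degree Δ degree≤Δ 1≤m
      (*-mono-≤ {1} {2} (s≤s z≤n) (*-mono-≤ (*-mono-≤ 1≤C 1≤C) (*-mono-≤ 1≤N 1≤N)))
      (*-mono-≤ (1≤overlapConstant s′ t 2≤t) 1≤Δ) (A.mδ-bound q F₃) (A.mδ⁴-bound (overlapConstant s t) F₅) (A.mδ²ˢ-bound s (8 * q) Fₛ)
    where
    open ≤-Reasoning
    open Core s′ t 2≤t E? noConfig B? E⇒B
    s n⁺ N q C m : ℕ
    r : Fin (suc n′)
    s = suc s′
    n⁺ = suc n′
    N = # B?
    q = cliqueConstant s t
    C = codegreeConstant s t
    1≤q : 1 ≤ q
    1≤q = 1≤cliqueConstant s t
    1≤C : 1 ≤ C
    1≤C = 1≤codegreeConstant s′ t 2≤t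
    4qN≤f : 4 * q * N ≤ f
    4qN≤f = ≤-trans (≤-reflexive (eq (4 * q) N)) (≤-trans F₁ (≤-reflexive (*-identityʳ f)))
      where eq : ∀ q N → q * N ≡ q * (1 * (N * 1))
            eq = solve-∀
    root : ∃ λ r → edges * edges ≤ C * (N * (n⁺ * Rooted.m s′ t 2≤t E? noConfig r))
    root = richRoot (*-cancelˡ-≤ 2 (begin
      2 * (2 * (N * q))   ≡⟨ eq N q ⟩
      4 * q * N           ≤⟨ 4qN≤f ⟩
      f                   ≤⟨ f≤2e ⟩
      2 * edges           ∎))
      where eq : ∀ N q → 2 * (2 * (N * q)) ≡ 4 * q * N
            eq = solve-∀
    r = proj₁ root
    m = Rooted.m s′ t 2≤t E? noConfig r
    f²-bound : f * f ≤ 4 * (C * (N * (n⁺ * m)))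
    f²-bound = begin
      f * f                               ≤⟨ *-mono-≤ f≤2e f≤2e ⟩
      2 * edges * (2 * edges)             ≡⟨ eq edges ⟩
      4 * (edges * edges)                 ≤⟨ *-monoʳ-≤ 4 (proj₂ root) ⟩
      4 * (C * (N * (n⁺ * m)))             ∎
      where eq : ∀ e → 2 * e * (2 * e) ≡ 4 * (e * e)
            eq = solve-∀
    1≤f : 1 ≤ f
    1≤f = ≤-trans (*-mono-≤ (*-mono-≤ {1} {4} (s≤s z≤n) 1≤q) 1≤N) 4qN≤f
    1≤m : 1 ≤ m
    1≤m = n≢0⇒n>0 λ m≡0 → <⇒≱ (*-mono-≤ 1≤f 1≤f) (≤-trans f²-bound (≤-reflexive (trans (cong (λ x → 4 * (C * (N * (n⁺ * x)))) m≡0) (eq C N n⁺))))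
      where eq : ∀ C N n⁺ → 4 * (C * (N * (n⁺ * 0))) ≡ 0
            eq = solve-∀
    module A = Arithmetic {n⁺} {N} {m} {δ} {Δ} {f} {C} (s≤s z≤n) 1≤N 1≤C f²-bound f≤4nδ NΔ≤8f

-- Regularisation

Config-mono : ∀ {n s t} {E F : Fin n → Fin n → Set} → (∀ {u v} → E u v → F u v) → Config s t E → Config s t F
Config-mono {E = E} {F} E⊆F c = record
  { root = root ; ys = ys ; zs = zs ; bs = bs ; ys-inj = ys-inj ; zs-inj = zs-inj ; bs-inj = bs-inj
  ; ys≢zs = ys≢zs ; root≢ys = root≢ys ; root≢zs = root≢zs
  ; ys-bs = λ i j → E⊆F (ys-bs i j) ; zs-bs = λ i j → E⊆F (zs-bs i j)
  ; root-ys = λ i → both (root-ys i) ; root-zs = λ j → both (root-zs j) }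
  where
  open Config c
  both : ∀ {u w} → (∃ λ v → E u v × E w v) → ∃ λ v → F u v × F w v
  both (v , p , q) = v , E⊆F p , E⊆F q

≤/ : ∀ {a} b c .⦃ _ : NonZero c ⦄ → a * c ≤ b → a ≤ b / c
≤/ {a} b c h = ≤-trans (≤-reflexive (sym (m*n/n≡m a c))) (/-monoˡ-≤ c h)

≤2[/] : ∀ a b .⦃ _ : NonZero b ⦄ → b ≤ a → a ≤ 2 * (a / b * b)
≤2[/] a b b≤a = begin
  a                          ≡⟨ m≡m%n+[m/n]*n a b ⟩
  a % b + a / b * b          ≤⟨ +-monoˡ-≤ (a / b * b) (≤-trans (<⇒≤ (m%n<n a b)) (m≤n*m b (a / b) ⦃ >-nonZero (≤/ a b (≤-trans (≤-reflexive (*-identityˡ b)) b≤a)) ⦄)) ⟩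
  a / b * b + a / b * b      ≡⟨ cong (a / b * b +_) (+-identityʳ _) ⟨
  2 * (a / b * b)            ∎
  where open ≤-Reasoning

n<8^n : ∀ n → n < 8 ^ n
n<8^n zero = s≤s z≤n
n<8^n (suc n) = ≤-trans (s≤s (n<8^n n)) (≤-trans (+-monoˡ-≤ (8 ^ n) (^-pos n (s≤s z≤n))) (+-monoʳ-≤ (8 ^ n) (m≤m+n _ _)))

module Levels {n : ℕ} (1≤n : 1 ≤ n) (d : Fin n → ℕ) (1≤e : 1 ≤ sum d) where

  open ≤-Reasoning

  e : ℕ
  e = sum d

  High : ℕ → Fin n → Set
  High i b = 8 ^ i * e ≤ 4 * (n * d b)

  high? : ∀ i → Decidable (High i)
  high? i b = 8 ^ i * e ≤? 4 * (n * d b)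

  level? : ∀ i b → Dec (High i b × ¬ High (suc i) b)
  level? i b = high? i b ×-dec ¬? (high? (suc i) b)

  above at : ℕ → ℕ
  above i = sum λ b → 𝟙 (high? i b) * d b
  at i = sum λ b → 𝟙 (level? i b) * d b

  above-split : ∀ i → above i ≤ at i + above (suc i)
  above-split i = ≤-trans (sum-mono bound) (≤-reflexive (∑-distrib-+ (λ b → 𝟙 (level? i b) * d b) _))
    where
    bound : ∀ b → 𝟙 (high? i b) * d b ≤ 𝟙 (level? i b) * d b + 𝟙 (high? (suc i) b) * d b
    bound b = ≤-trans (*-monoˡ-≤ (d b) (𝟙-≤ (high? i b) λ p → case p (high? (suc i) b)))
      (≤-reflexive (*-distribʳ-+ (d b) (𝟙 (level? i b)) _))
      where
      case : High i b → Dec (High (suc i) b) → 1 ≤ 𝟙 (level? i b) + 𝟙 (high? (suc i) b)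
      case _ (yes q) = ≤-trans (≤-reflexive (sym (𝟙-yes (high? (suc i) b) q))) (m≤n+m _ _)
      case p (no ¬q) = ≤-trans (≤-reflexive (sym (𝟙-yes (level? i b) (p , ¬q)))) (m≤m+n _ _)

  -- Vertices of degree below e / 4n carry together at most e / 4 edges.
  above-zero : e ≤ 2 * above 0
  above-zero = *-cancelˡ-≤ 2 (+-cancelʳ-≤ (2 * e) _ _ (begin
    2 * e + 2 * e                           ≡⟨ eq₁ e ⟩
    4 * e                                   ≤⟨ *-monoʳ-≤ 4 split ⟩
    4 * (above 0 + low)                     ≡⟨ eq₂ (above 0) low ⟩
    2 * (2 * above 0) + 4 * low             ≤⟨ +-monoʳ-≤ (2 * (2 * above 0)) (≤-trans low-small (m≤n*m e 2)) ⟩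
    2 * (2 * above 0) + 2 * e               ∎))
    where
    low : ℕ
    low = sum λ b → 𝟙 (¬? (high? 0 b)) * d b
    eq₁ : ∀ e → 2 * e + 2 * e ≡ 4 * e
    eq₁ = solve-∀
    eq₂ : ∀ a l → 4 * (a + l) ≡ 2 * (2 * a) + 4 * l
    eq₂ = solve-∀
    split : e ≤ above 0 + low
    split = ≤-trans (sum-mono bound) (≤-reflexive (∑-distrib-+ (λ b → 𝟙 (high? 0 b) * d b) _))
      where
      bound : ∀ b → d b ≤ 𝟙 (high? 0 b) * d b + 𝟙 (¬? (high? 0 b)) * d b
      bound b = ≤-trans (≤-reflexive (sym (*-identityˡ (d b)))) (≤-trans (*-monoˡ-≤ (d b) (case (high? 0 b))) (≤-reflexive (*-distribʳ-+ (d b) (𝟙 (high? 0 b)) _)))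
        where
        case : Dec (High 0 b) → 1 ≤ 𝟙 (high? 0 b) + 𝟙 (¬? (high? 0 b))
        case (yes p) = ≤-trans (≤-reflexive (sym (𝟙-yes (high? 0 b) p))) (m≤m+n _ _)
        case (no ¬p) = ≤-trans (≤-reflexive (sym (𝟙-yes (¬? (high? 0 b)) ¬p))) (m≤n+m _ _)
    pull : ∀ n x y → 4 * n * (x * y) ≡ x * (4 * (n * y))
    pull = solve-∀
    low-small : 4 * low ≤ e
    low-small = *-cancelˡ-≤′ n 1≤n (begin
      n * (4 * low)                                            ≡⟨ trans (sym (*-assoc n 4 low)) (cong (_* low) (*-comm n 4)) ⟩
      4 * n * low                                              ≡⟨ *-distribˡ-sum (4 * n) _ ⟩
      (sum λ b → 4 * n * (𝟙 (¬? (high? 0 b)) * d b))           ≡⟨ (sum-cong-≗ λ b → pull n (𝟙 (¬? (high? 0 b))) (d b)) ⟩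
      (sum λ b → 𝟙 (¬? (high? 0 b)) * (4 * (n * d b)))         ≤⟨ (sum-mono λ b → 𝟙-*-≤ (¬? (high? 0 b)) λ ¬p → ≤-trans (<⇒≤ (≰⇒> ¬p)) (≤-reflexive (*-identityˡ e))) ⟩
      (sum {n} λ _ → e)                                        ≡⟨ sum-const n e ⟩
      n * e                                                    ∎)

  above-∞ : ∀ i → 4 * n < 8 ^ i → above i ≡ 0
  above-∞ i h = sum-0 λ b → cong (_* d b) (𝟙-no (high? i b) λ p → <⇒≱ (*-monoˡ-< e ⦃ >-nonZero 1≤e ⦄ h) (begin
    8 ^ i * e           ≤⟨ p ⟩
    4 * (n * d b)       ≡⟨ *-assoc 4 n (d b) ⟨
    4 * n * d b         ≤⟨ *-monoʳ-≤ (4 * n) (term≤sum d b) ⟩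
    4 * n * e           ∎))

  -- If level i carries less than e / 2^(i+2) edges, then of the e / 2^(i+1) edges above its
  -- threshold at least half lie above the next one. Once 8 ^ i exceeds 4n nothing is above, so the
  -- search succeeds.
  popularLevel : ∃ λ i → e ≤ 2 ^ (2 + i) * at i
  popularLevel = search (4 * n) 0 (≤-trans (n<8^n (4 * n)) (≤-reflexive (cong (8 ^_) (sym (+-identityʳ (4 * n)))))) above-zero
    where
    search : ∀ fuel i → 4 * n < 8 ^ (fuel + i) → e ≤ 2 ^ (1 + i) * above i → ∃ λ i → e ≤ 2 ^ (2 + i) * at i
    search zero i far h = contradiction (≤-trans 1≤e (≤-trans h (≤-reflexive (trans (cong (2 ^ (1 + i) *_) (above-∞ i far)) (*-zeroʳ (2 ^ (1 + i))))))) λ ()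
    search (suc fuel) i far h with e ≤? 2 ^ (2 + i) * at i
    ... | yes p = i , p
    ... | no ¬p = search fuel (suc i) (≤-trans far (≤-reflexive (cong (8 ^_) (sym (+-suc fuel i))))) (+-cancelˡ-≤ e _ _ (begin
      e + e                                                             ≤⟨ +-mono-≤ h h ⟩
      2 ^ (1 + i) * above i + 2 ^ (1 + i) * above i                     ≡⟨ eq (2 ^ (1 + i)) (above i) ⟩
      2 ^ (2 + i) * above i                                             ≤⟨ *-monoʳ-≤ (2 ^ (2 + i)) (above-split i) ⟩
      2 ^ (2 + i) * (at i + above (suc i))                              ≡⟨ *-distribˡ-+ (2 ^ (2 + i)) (at i) _ ⟩
      2 ^ (2 + i) * at i + 2 ^ (2 + i) * above (suc i)                  ≤⟨ +-monoˡ-≤ _ (<⇒≤ (≰⇒> ¬p)) ⟩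
      e + 2 ^ (2 + i) * above (suc i)                                   ∎))
      where eq : ∀ x y → x * y + x * y ≡ 2 * x * y
            eq = solve-∀

-- A level of index i carries an edge fraction 1/(4ρ) on at most 4n/ρ³ vertices, where ρ = 2 ^ i.
transfer : ∀ {e f N ρ} n c p a k → 1 ≤ ρ → e ≤ 4 * ρ * f → ρ ^ 3 * N ≤ 4 * n → p ≤ 3 * k →
  4 ^ (p + k) * c * n ^ (a + k) ≤ e ^ p → c * (n ^ a * N ^ k) ≤ f ^ p
transfer {e} {f} {N} {ρ} n c p a k 1≤ρ e≤ N≤ p≤3k h =
  *-cancelˡ-≤′ (4 ^ p * (ρ ^ 3) ^ k) (*-mono-≤ (^-pos p (s≤s z≤n)) (^-pos k (^-pos 3 1≤ρ))) (begin
    4 ^ p * (ρ ^ 3) ^ k * (c * (n ^ a * N ^ k))        ≡⟨ eq₁ (4 ^ p) ((ρ ^ 3) ^ k) c (n ^ a) (N ^ k) ⟩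
    4 ^ p * c * n ^ a * ((ρ ^ 3) ^ k * N ^ k)          ≡⟨ cong (4 ^ p * c * n ^ a *_) (*-^ (ρ ^ 3) N k) ⟨
    4 ^ p * c * n ^ a * (ρ ^ 3 * N) ^ k                ≤⟨ *-monoʳ-≤ (4 ^ p * c * n ^ a) (^-monoˡ-≤ k N≤) ⟩
    4 ^ p * c * n ^ a * (4 * n) ^ k                    ≡⟨ cong (4 ^ p * c * n ^ a *_) (*-^ 4 n k) ⟩
    4 ^ p * c * n ^ a * (4 ^ k * n ^ k)                ≡⟨ eq₂ (4 ^ p) c (n ^ a) (4 ^ k) (n ^ k) ⟩
    4 ^ p * 4 ^ k * c * (n ^ a * n ^ k)                ≡⟨ cong₂ (λ x y → x * c * y) (^-distribˡ-+-* 4 p k) (^-distribˡ-+-* n a k) ⟨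
    4 ^ (p + k) * c * n ^ (a + k)                      ≤⟨ h ⟩
    e ^ p                                              ≤⟨ ^-monoˡ-≤ p e≤ ⟩
    (4 * ρ * f) ^ p                                    ≡⟨ trans (*-^ (4 * ρ) f p) (cong (_* f ^ p) (*-^ 4 ρ p)) ⟩
    -- The factor ρ ^ p lost in edges is repaid by the (ρ ^ 3) ^ k gained in the size of B, as p ≤
    -- 3k.
    4 ^ p * ρ ^ p * f ^ p                              ≤⟨ *-monoˡ-≤ (f ^ p) (*-monoʳ-≤ (4 ^ p) (≤-trans (^-monoʳ-≤ ρ ⦃ >-nonZero 1≤ρ ⦄ p≤3k) (≤-reflexive (sym (^-*-assoc ρ 3 k))))) ⟩
    4 ^ p * (ρ ^ 3) ^ k * f ^ p                        ∎)
  where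
  open ≤-Reasoning
  eq₁ : ∀ x y c z w → x * y * (c * (z * w)) ≡ x * c * z * (y * w)
  eq₁ = solve-∀
  eq₂ : ∀ x c z y w → x * c * z * (y * w) ≡ x * y * c * (z * w)
  eq₂ = solve-∀

module Regularise {n′ : ℕ} (s′ t : ℕ) (2≤t : 2 ≤ t) {E : Fin (suc n′) → Fin (suc n′) → Set} (E? : ∀ u v → Dec (E u v))
  (noConfig : ¬ Config (suc s′) t E) where

  open ≤-Reasoning

  private
    n⁺ = suc n′
    s = suc s′

  d : Fin n⁺ → ℕ
  d b = # λ u → E? u b

  -- The hypotheses no longer mention N: `transfer` turns each into the requirement at the popular
  -- level.
  sparse : 4 ^ 2 * c₁ s t * n⁺ ^ 1 ≤ sum d ^ 1 → 4 ^ 5 * c₃ s t * n⁺ ^ 4 ≤ sum d ^ 3 → 4 ^ 7 * c₅ s t * n⁺ ^ 7 ≤ sum d ^ 5 →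
    4 ^ (2 * suc s + suc s) * cₛ s t * n⁺ ^ (suc (2 * s) + suc s) ≤ sum d ^ (2 * suc s) → ⊥
  sparse G₁ G₃ G₅ Gₛ = atLevel popularLevel
    where
    n≤e : n⁺ ≤ sum d
    n≤e = begin
      n⁺                       ≤⟨ m≤n*m n⁺ (4 ^ 2 * c₁ s t) ⦃ >-nonZero (*-mono-≤ {1} {16} (s≤s z≤n) (1≤c₁ s t)) ⦄ ⟩
      4 ^ 2 * c₁ s t * n⁺      ≡⟨ cong (4 ^ 2 * c₁ s t *_) (*-identityʳ n⁺) ⟨
      4 ^ 2 * c₁ s t * n⁺ ^ 1  ≤⟨ G₁ ⟩
      sum d ^ 1               ≡⟨ *-identityʳ (sum d) ⟩
      sum d                   ∎
    1≤e : 1 ≤ sum d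
    1≤e = ≤-trans (s≤s z≤n) n≤e
    open Levels {n⁺} (s≤s z≤n) d 1≤e
    atLevel : (∃ λ i → e ≤ 2 ^ (2 + i) * at i) → ⊥
    atLevel (i , popular) = almostRegular s′ t 2≤t E₂? (noConfig ∘ Config-mono proj₁) B? (λ (_ , Bb , _) → Bb)
      f δ Δ δ≤degree degree≤Δ f≤2e₂ f≤4nδ NΔ≤8f 1≤N 1≤Δ
      (transfer n⁺ (c₁ s t) 1 0 1 1≤ρ e≤4ρf ρ³N≤4n (s≤s z≤n) G₁) (transfer n⁺ (c₃ s t) 3 2 2 1≤ρ e≤4ρf ρ³N≤4n (m≤m+n 3 3) G₃) F₅
      (transfer n⁺ (cₛ s t) (2 * suc s) (suc (2 * s)) (suc s) 1≤ρ e≤4ρf ρ³N≤4n (*-monoˡ-≤ (suc s) {2} {3} (n≤1+n 2)) Gₛ)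
      where
      f = at i
      ρ = 2 ^ i
      1≤ρ : 1 ≤ ρ
      1≤ρ = ^-pos i (s≤s z≤n)
      ρ³ : 8 ^ i ≡ ρ ^ 3
      ρ³ = trans (^-*-assoc 2 3 i) (trans (cong (2 ^_) (*-comm 3 i)) (sym (^-*-assoc 2 i 3)))
      e≤4ρf : e ≤ 4 * ρ * f
      e≤4ρf = ≤-trans (popular) (≤-reflexive (cong (_* f) (eq ρ)))
        where eq : ∀ x → 2 * (2 * x) ≡ 4 * x
              eq = solve-∀
      B? : ∀ b → Dec (High i b × ¬ High (suc i) b)
      B? = level? i
      N = # B?
      f≤e : f ≤ e
      f≤e = sum-mono λ b → 𝟙-*-≤ (B? b) λ _ → ≤-refl
      N8ⁱe≤4nf : N * (8 ^ i * e) ≤ 4 * n⁺ * f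
      N8ⁱe≤4nf = begin
        N * (8 ^ i * e)                                ≡⟨ *-distribʳ-sum (8 ^ i * e) _ ⟩
        (sum λ b → 𝟙 (B? b) * (8 ^ i * e))             ≤⟨ (sum-mono λ b → 𝟙-*-mono (B? b) proj₁) ⟩
        (sum λ b → 𝟙 (B? b) * (4 * (n⁺ * d b)))         ≡⟨ (sum-cong-≗ λ b → eq (𝟙 (B? b)) n⁺ (d b)) ⟩
        (sum λ b → 4 * n⁺ * (𝟙 (B? b) * d b))           ≡⟨ *-distribˡ-sum (4 * n⁺) (λ b → 𝟙 (B? b) * d b) ⟨
        4 * n⁺ * f                                      ∎
        where eq : ∀ x n⁺ y → x * (4 * (n⁺ * y)) ≡ 4 * n⁺ * (x * y)
              eq = solve-∀
      ρ³N≤4n : ρ ^ 3 * N ≤ 4 * n⁺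
      ρ³N≤4n = *-cancelˡ-≤′ e 1≤e (begin
        e * (ρ ^ 3 * N)       ≡⟨ cong (λ x → e * (x * N)) ρ³ ⟨
        e * (8 ^ i * N)       ≡⟨ eq e (8 ^ i) N ⟩
        N * (8 ^ i * e)       ≤⟨ N8ⁱe≤4nf ⟩
        4 * n⁺ * f             ≤⟨ *-monoʳ-≤ (4 * n⁺) f≤e ⟩
        4 * n⁺ * e             ≡⟨ *-comm (4 * n⁺) e ⟩
        e * (4 * n⁺)           ∎)
        where eq : ∀ e x N → e * (x * N) ≡ N * (x * e)
              eq = solve-∀
      F₅ : c₅ s t * (n⁺ ^ 5 * N ^ 2) ≤ f ^ 5
      F₅ = transfer n⁺ (c₅ s t) 5 5 2 1≤ρ e≤4ρf ρ³N≤4n (n≤1+n 5) G₅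
      1≤f : 1 ≤ f
      1≤f = n≢0⇒n>0 λ f≡0 → <⇒≱ 1≤e (≤-trans e≤4ρf (≤-reflexive (trans (cong (4 * ρ *_) f≡0) (*-zeroʳ (4 * ρ)))))
      1≤N : 1 ≤ N
      1≤N = n≢0⇒n>0 λ N≡0 → <⇒≱ 1≤f (≤-reflexive (sum-0 λ b → cong (_* d b) (𝟙-no (B? b) λ p → <⇒≱ (∃-# B? (b , p)) (≤-reflexive N≡0))))
      Δ : ℕ
      -- The upper threshold 8^(i+1) e / 4n of the level.
      Δ = 2 * (8 ^ i * e) / n⁺
      1≤Δ : 1 ≤ Δ
      1≤Δ = ≤/ (2 * (8 ^ i * e)) n⁺ (≤-trans (≤-reflexive (*-identityˡ n⁺)) (≤-trans n≤e (≤-trans (m≤n*m e (8 ^ i) ⦃ m^n≢0 8 i ⦄) (m≤n*m (8 ^ i * e) 2))))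
      d≤Δ : ∀ b → High i b × ¬ High (suc i) b → d b ≤ Δ
      d≤Δ b (_ , ¬high) = ≤/ (2 * (8 ^ i * e)) n⁺ (*-cancelˡ-≤ 4 (begin
        4 * (d b * n⁺)                ≡⟨ cong (4 *_) (*-comm (d b) n⁺) ⟩
        4 * (n⁺ * d b)                ≤⟨ <⇒≤ (≰⇒> ¬high) ⟩
        8 * 8 ^ i * e                ≡⟨ eq (8 ^ i) e ⟩
        4 * (2 * (8 ^ i * e))        ∎))
        where eq : ∀ x e → 8 * x * e ≡ 4 * (2 * (x * e))
              eq = solve-∀
      NΔ≤8f : N * Δ ≤ 8 * f
      NΔ≤8f = *-cancelˡ-≤ n⁺ (begin
        n⁺ * (N * Δ)                  ≡⟨ eq₁ n⁺ N Δ ⟩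
        N * (Δ * n⁺)                  ≤⟨ *-monoʳ-≤ N (m/n*n≤m (2 * (8 ^ i * e)) n⁺) ⟩
        N * (2 * (8 ^ i * e))        ≡⟨ eq₂ N (8 ^ i * e) ⟩
        2 * (N * (8 ^ i * e))        ≤⟨ *-monoʳ-≤ 2 N8ⁱe≤4nf ⟩
        2 * (4 * n⁺ * f)              ≡⟨ eq₃ n⁺ f ⟩
        n⁺ * (8 * f)                  ∎)
        where eq₁ : ∀ n⁺ N Δ → n⁺ * (N * Δ) ≡ N * (Δ * n⁺)
              eq₁ = solve-∀
              eq₂ : ∀ N x → N * (2 * x) ≡ 2 * (N * x)
              eq₂ = solve-∀
              eq₃ : ∀ n⁺ f → 2 * (4 * n⁺ * f) ≡ n⁺ * (8 * f)
              eq₃ = solve-∀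
      2n≤f : 2 * n⁺ ≤ f
      -- This gives δ ≥ 1, so that rounding in δ costs only a factor 2.
      2n≤f = ≮⇒≥ λ f<2n → <⇒≱ (^-monoˡ-< 5 f<2n) (begin
        (2 * n⁺) ^ 5                  ≡⟨ *-^ 2 n⁺ 5 ⟩
        32 * n⁺ ^ 5                   ≤⟨ *-mono-≤ {32} {c₅ s t} (32≤c₅ s′ t 2≤t) (≤-trans (≤-reflexive (sym (*-identityʳ (n⁺ ^ 5)))) (*-monoʳ-≤ (n⁺ ^ 5) (^-pos 2 1≤N))) ⟩
        c₅ s t * (n⁺ ^ 5 * N ^ 2)     ≤⟨ F₅ ⟩
        f ^ 5                        ∎)
      δ : ℕ
      -- Half the average degree into the level, so deleting the vertices of smaller degree loses at
      -- most f / 2 edges.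
      δ = f / (2 * n⁺)
      f≤4nδ : f ≤ 4 * (n⁺ * δ)
      f≤4nδ = ≤-trans (≤2[/] f (2 * n⁺) 2n≤f) (≤-reflexive (eq δ n⁺))
        where eq : ∀ δ n⁺ → 2 * (δ * (2 * n⁺)) ≡ 4 * (n⁺ * δ)
              eq = solve-∀
      E₁? : ∀ u b → Dec (E u b × (High i b × ¬ High (suc i) b))
      E₁? u b = E? u b ×-dec B? b
      -- Degrees are tested in `E₁?`, before deletion: a surviving u keeps all its edges, so the
      -- bound δ still holds.
      E₂? : ∀ u b → Dec (E u b × (High i b × ¬ High (suc i) b) × δ ≤ # (E₁? u))
      E₂? u b = E? u b ×-dec B? b ×-dec (δ ≤? # (E₁? u))
      δ≤degree : ∀ u → (∃ λ b → E u b × (High i b × ¬ High (suc i) b) × δ ≤ # (E₁? u)) → δ ≤ # (E₂? u)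
      δ≤degree u (_ , _ , _ , p) = ≤-trans p (sum-mono λ b → 𝟙-mono (E₁? u b) (E₂? u b) λ (q , o) → q , o , p)
      degree≤Δ : ∀ b → # (λ u → E₂? u b) ≤ Δ
      degree≤Δ b = case (B? b)
        where
        case : Dec (High i b × ¬ High (suc i) b) → # (λ u → E₂? u b) ≤ Δ
        case (yes p) = ≤-trans (sum-mono λ u → 𝟙-mono (E₂? u b) (E? u b) proj₁) (d≤Δ b p)
        case (no ¬p) = ≤-trans (≤-reflexive (sum-0 λ u → 𝟙-no (E₂? u b) λ (_ , p , _) → ¬p p)) z≤n
      f≡∑ : f ≡ sum λ u → # (E₁? u)
      f≡∑ = trans (sum-cong-≗ λ b → trans (*-distribˡ-sum (𝟙 (B? b)) λ u → 𝟙 (E? u b)) (sum-cong-≗ λ u → trans (*-comm (𝟙 (B? b)) _) (sym (𝟙-× (E? u b) (B? b)))))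
        (∑-comm λ b u → 𝟙 (E₁? u b))
      f≤2e₂ : f ≤ 2 * (sum λ b → # λ u → E₂? u b)
      f≤2e₂ = +-cancelʳ-≤ f _ _ (begin
        f + f                                          ≡⟨ cong (f +_) (+-identityʳ f) ⟨
        2 * f                                          ≡⟨ cong (2 *_) f≡∑ ⟩
        2 * (sum λ u → # (E₁? u))                      ≤⟨ *-monoʳ-≤ 2 (sum-mono λ u → case u (δ ≤? # (E₁? u))) ⟩
        2 * (sum λ u → # (E₂? u) + δ)                  ≡⟨ cong (2 *_) (trans (∑-distrib-+ (λ u → # (E₂? u)) _) (cong₂ _+_ (∑-comm λ u b → 𝟙 (E₂? u b)) (sum-const n⁺ δ))) ⟩
        2 * ((sum λ b → # λ u → E₂? u b) + n⁺ * δ)      ≡⟨ eq (sum λ b → # λ u → E₂? u b) n⁺ δ ⟩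
        2 * (sum λ b → # λ u → E₂? u b) + δ * (2 * n⁺)  ≤⟨ +-monoʳ-≤ _ (m/n*n≤m f (2 * n⁺)) ⟩
        2 * (sum λ b → # λ u → E₂? u b) + f            ∎)
        where
        eq : ∀ x n⁺ δ → 2 * (x + n⁺ * δ) ≡ 2 * x + δ * (2 * n⁺)
        eq = solve-∀
        case : ∀ u → Dec (δ ≤ # (E₁? u)) → # (E₁? u) ≤ # (E₂? u) + δ
        case u (yes p) = ≤-trans (sum-mono λ b → 𝟙-mono (E₁? u b) (E₂? u b) λ (q , o) → q , o , p) (m≤m+n _ _)
        case u (no ¬p) = ≤-trans (<⇒≤ (≰⇒> ¬p)) (m≤n+m _ _)

-- Bipartite subgraphs and the final count

opaque
  unfolding 𝟙 sum

  𝟙-T? : ∀ x → (if x then 1 else 0) ≡ 𝟙 (T? x)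
  𝟙-T? true = refl
  𝟙-T? false = refl

  list-sum-tabulate : (f : Fin n → ℕ) → ListAction.sum (tabulate f) ≡ sum f
  list-sum-tabulate {zero} f = refl
  list-sum-tabulate {suc n} f = cong (f zero +_) (list-sum-tabulate (f ∘ suc))

list-sum-allFin : (f : Fin n → ℕ) → ListAction.sum (map f (allFin n)) ≡ sum f
list-sum-allFin f = trans (cong ListAction.sum (map-tabulate id f)) (list-sum-tabulate f)

list-sum-concatMap : {A B : Set} (g : B → ℕ) (f : A → List B) (xs : List A) →
  ListAction.sum (map g (concatMap f xs)) ≡ ListAction.sum (map (λ x → ListAction.sum (map g (f x))) xs)
list-sum-concatMap g f [] = refl
list-sum-concatMap g f (x ∷ xs) = trans (cong ListAction.sum (map-++ g (f x) (concatMap f xs)))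
  (trans (sum-++ (map g (f x)) _) (cong (ListAction.sum (map g (f x)) +_) (list-sum-concatMap g f xs)))

sum-pairs : (g : Fin n × Fin n → ℕ) → ListAction.sum (map g (pairs n)) ≡ sum λ i → sum λ j → g (i , j)
sum-pairs {n} g = trans (list-sum-concatMap g (λ i → map (i ,_) (allFin n)) (allFin n))
  (trans (list-sum-allFin λ i → ListAction.sum (map g (map (i ,_) (allFin n))))
    (sum-cong-≗ λ i → trans (cong ListAction.sum (sym (map-∘ (allFin n)))) (list-sum-allFin λ j → g (i , j))))

-- Stated for a Boolean matrix, so that `maxCut` can delete vertex zero and recurse.
forward : (Fin n → Fin n → Bool) → ℕ
forward w = sum λ i → sum λ j → 𝟙 (T? ((toℕ i <ᵇ toℕ j) ∧ w i j))

edgeCount-≡ : (G : Graph n) → edgeCount G ≡ forward (adj G)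
edgeCount-≡ G = trans (sum-pairs _) (sum-cong-≗ λ i → sum-cong-≗ λ j → 𝟙-T? ((toℕ i <ᵇ toℕ j) ∧ adj G i j))

forward-suc : (w : Fin (suc n) → Fin (suc n) → Bool) →
  forward w ≡ (sum λ j → 𝟙 (T? (w zero (suc j)))) + forward (λ i j → w (suc i) (suc j))
forward-suc {n} w = trans (sum-suc _) (cong₂ _+_
  (trans (sum-suc _) (cong (_+ (sum λ j → 𝟙 (T? (w zero (suc j))))) (𝟙-no (T? false) λ ())))
  (sum-cong-≗ λ i → trans (sum-suc _) (cong (_+ (sum λ j → 𝟙 (T? ((toℕ i <ᵇ toℕ j) ∧ w (suc i) (suc j))))) (𝟙-no (T? false) λ ()))))

-- Oriented from the true to the false side, so no head of an edge is a tail, as `FFree⇒¬Config`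
-- asks.
Crossing : (Fin n → Bool) → (Fin n → Fin n → Bool) → Fin n → Fin n → Set
Crossing side w u v = side u ≡ true × side v ≡ false × T (w u v)

crossing? : (side : Fin n → Bool) (w : Fin n → Fin n → Bool) → ∀ u v → Dec (Crossing side w u v)
crossing? side w u v = (side u Bool.≟ true) ×-dec (side v Bool.≟ false) ×-dec T? (w u v)

cut : (Fin n → Bool) → (Fin n → Fin n → Bool) → ℕ
cut side w = sum λ u → sum λ v → 𝟙 (crossing? side w u v)

grid-row : (f : Fin (suc n) → Fin (suc n) → ℕ) →
  (sum λ v → f zero (suc v)) + (sum λ u → sum λ v → f (suc u) (suc v)) ≤ sum λ u → sum (f u)
grid-row f = ≤-trans (+-mono-≤ (m≤n+m _ (f zero zero)) (sum-mono λ u → m≤n+m _ (f (suc u) zero)))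
  (≤-reflexive (sym (trans (sum-suc _) (cong₂ _+_ (sum-suc _) (sum-cong-≗ λ u → sum-suc _)))))

grid-column : (f : Fin (suc n) → Fin (suc n) → ℕ) →
  (sum λ u → f (suc u) zero) + (sum λ u → sum λ v → f (suc u) (suc v)) ≤ sum λ u → sum (f u)
grid-column f = ≤-trans (≤-reflexive (cong ((sum λ u → f (suc u) zero) +_) (∑-comm λ u v → f (suc u) (suc v))))
  (≤-trans (grid-row λ u v → f v u) (≤-reflexive (sym (∑-comm f))))

-- Greedy: each vertex in turn joins the side that cuts at least half of its edges to the vertices already placed.
maxCut : ∀ {n} (w : Fin n → Fin n → Bool) → (∀ u v → w u v ≡ w v u) → ∃ λ side → forward w ≤ 2 * cut side w
maxCut {zero} w _ = (λ ()) , ≤-trans (≤-reflexive (sum-zero _)) z≤n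
maxCut {suc n} w w-sym with maxCut (λ i j → w (suc i) (suc j)) (λ i j → w-sym (suc i) (suc j))
... | side , h = choose (≤-total y x)
  where
  open ≤-Reasoning
  w′ : Fin n → Fin n → Bool
  w′ i j = w (suc i) (suc j)
  right? : ∀ v → Dec (side v ≡ false × T (w zero (suc v)))
  right? v = (side v Bool.≟ false) ×-dec T? (w zero (suc v))
  left? : ∀ v → Dec (side v ≡ true × T (w zero (suc v)))
  left? v = (side v Bool.≟ true) ×-dec T? (w zero (suc v))
  x y : ℕ
  x = # right?
  y = # left?
  extended : Bool → Fin (suc n) → Bool
  extended p zero = p
  extended p (suc v) = side v
  degree : (sum λ v → 𝟙 (T? (w zero (suc v)))) ≤ x + y
  degree = ≤-trans (sum-mono λ v → 𝟙-≤ (T? (w zero (suc v))) λ p → case v p (side v) refl) (≤-reflexive (∑-distrib-+ (λ v → 𝟙 (right? v)) _))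
    where
    case : ∀ v → T (w zero (suc v)) → ∀ p → side v ≡ p → 1 ≤ 𝟙 (right? v) + 𝟙 (left? v)
    case v p true eq = ≤-trans (≤-reflexive (sym (𝟙-yes (left? v) (eq , p)))) (m≤n+m _ _)
    case v p false eq = ≤-trans (≤-reflexive (sym (𝟙-yes (right? v) (eq , p)))) (m≤m+n _ _)
  bound : ∀ {z} c → x ≤ z → y ≤ z → z + cut side w′ ≤ c → forward w ≤ 2 * c
  bound {z} c x≤z y≤z h′ = begin
    forward w                                                     ≡⟨ forward-suc w ⟩
    (sum λ v → 𝟙 (T? (w zero (suc v)))) + forward w′              ≤⟨ +-mono-≤ (≤-trans degree (+-mono-≤ x≤z y≤z)) h ⟩
    (z + z) + 2 * cut side w′                                     ≡⟨ eq z (cut side w′) ⟩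
    2 * (z + cut side w′)                                         ≤⟨ *-monoʳ-≤ 2 h′ ⟩
    2 * c                                                         ∎
    where eq : ∀ z c → (z + z) + 2 * c ≡ 2 * (z + c)
          eq = solve-∀
  choose : y ≤ x ⊎ x ≤ y → ∃ λ side → forward w ≤ 2 * cut side w
  choose (inj₁ y≤x) = extended true , bound _ ≤-refl y≤x (≤-trans (+-monoˡ-≤ _ (sum-mono λ v →
    𝟙-mono (right? v) (crossing? (extended true) w zero (suc v)) (refl ,_))) (grid-row λ u v → 𝟙 (crossing? (extended true) w u v)))
  choose (inj₂ x≤y) = extended false , bound _ x≤y ≤-refl (≤-trans (+-monoˡ-≤ _ (sum-mono λ v →
    𝟙-mono (left? v) (crossing? (extended false) w (suc v) zero) λ (p , q) → p , refl , subst T (w-sym zero (suc v)) q))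
    (grid-column λ u v → 𝟙 (crossing? (extended false) w u v)))

-- Comparison of exponents

-- Compares n ^ (w / q) with n ^ (u / p) by raising everything to the power p q. The factor 2 ^ p
-- pays for passing to the cut, and one of the p copies of C ^ q already beats (2 ^ p c) ^ q.
growth : ∀ {e x n C} q w p u c → 1 ≤ q → 1 ≤ p → 1 ≤ n → 1 ≤ C → x ≤ 2 * e →
  C ^ q * n ^ w ≤ x ^ q → u * q ≤ p * w → 2 ^ p * c ≤ C → c * n ^ u ≤ e ^ p
growth {e} {x} {n} {C} q w p u c 1≤q 1≤p 1≤n 1≤C x≤2e large uq≤pw c≤C = ≮⇒≥ λ small → <-irrefl refl (begin-strict
  C ^ q * n ^ (p * w)             ≤⟨ *-monoˡ-≤ (n ^ (p * w)) (≤-trans (≤-reflexive (sym (^-identityʳ (C ^ q)))) (^-monoʳ-≤ (C ^ q) ⦃ >-nonZero (^-pos q 1≤C) ⦄ 1≤p)) ⟩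
  (C ^ q) ^ p * n ^ (p * w)       ≡⟨ cong ((C ^ q) ^ p *_) (trans (cong (n ^_) (*-comm p w)) (sym (^-*-assoc n w p))) ⟩
  (C ^ q) ^ p * (n ^ w) ^ p       ≡⟨ *-^ (C ^ q) (n ^ w) p ⟨
  (C ^ q * n ^ w) ^ p             ≤⟨ ^-monoˡ-≤ p (≤-trans large (^-monoˡ-≤ q x≤2e)) ⟩
  ((2 * e) ^ q) ^ p               ≡⟨ trans (^-*-assoc (2 * e) q p) (trans (cong ((2 * e) ^_) (*-comm q p)) (sym (^-*-assoc (2 * e) p q))) ⟩
  ((2 * e) ^ p) ^ q               ≡⟨ cong (_^ q) (*-^ 2 e p) ⟩
  (2 ^ p * e ^ p) ^ q             <⟨ ^-monoˡ-< q ⦃ >-nonZero 1≤q ⦄ (*-monoʳ-< (2 ^ p) ⦃ m^n≢0 2 p ⦄ small) ⟩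
  (2 ^ p * (c * n ^ u)) ^ q       ≡⟨ cong (_^ q) (*-assoc (2 ^ p) c (n ^ u)) ⟨
  (2 ^ p * c * n ^ u) ^ q         ≡⟨ *-^ (2 ^ p * c) (n ^ u) q ⟩
  (2 ^ p * c) ^ q * (n ^ u) ^ q   ≤⟨ *-mono-≤ (^-monoˡ-≤ q c≤C) (≤-trans (≤-reflexive (^-*-assoc n u q)) (^-monoʳ-≤ n ⦃ >-nonZero 1≤n ⦄ uq≤pw)) ⟩
  C ^ q * n ^ (p * w)             ∎)
  where open ≤-Reasoning

module Exponents (s : ℕ) where

  open ≤-Reasoning

  -- w / q is the exponent of the theorem.
  q w : ℕ
  q = 2 * s + 2 * (s * s)
  w = q + (s * s + 1)

  exponent₁ : 1 * q ≤ 1 * w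
  exponent₁ = *-monoʳ-≤ 1 (m≤m+n q _)

  -- Amounts to 2s ≤ s² + 3.
  exponent₃ : 4 * q ≤ 3 * w
  exponent₃ = begin
    4 * (2 * s + 2 * (s * s))                                        ≡⟨ eq₁ s ⟩
    2 * (s * 1) + (3 * (2 * s + 2 * (s * s)) + 2 * (s * s))          ≤⟨ +-monoˡ-≤ _ (2ab≤a²+b² s 1) ⟩
    s * s + 1 + (3 * (2 * s + 2 * (s * s)) + 2 * (s * s))            ≤⟨ m≤m+n _ 2 ⟩
    s * s + 1 + (3 * (2 * s + 2 * (s * s)) + 2 * (s * s)) + 2        ≡⟨ eq₂ s ⟩
    3 * (2 * s + 2 * (s * s) + (s * s + 1))                          ∎
    where
    eq₁ : ∀ s → 4 * (2 * s + 2 * (s * s)) ≡ 2 * (s * 1) + (3 * (2 * s + 2 * (s * s)) + 2 * (s * s))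
    eq₁ = solve-∀
    eq₂ : ∀ s → s * s + 1 + (3 * (2 * s + 2 * (s * s)) + 2 * (s * s)) + 2 ≡ 3 * (2 * s + 2 * (s * s) + (s * s + 1))
    eq₂ = solve-∀

  -- Amounts to 4s ≤ s² + 5, where 4s ≤ s² + 4 is a square being nonnegative.
  exponent₅ : 7 * q ≤ 5 * w
  exponent₅ = begin
    7 * (2 * s + 2 * (s * s))                                        ≡⟨ eq₁ s ⟩
    2 * (s * 2) + (5 * (2 * s + 2 * (s * s)) + 4 * (s * s))          ≤⟨ +-monoˡ-≤ _ (2ab≤a²+b² s 2) ⟩
    s * s + 4 + (5 * (2 * s + 2 * (s * s)) + 4 * (s * s))            ≤⟨ m≤m+n _ 1 ⟩
    s * s + 4 + (5 * (2 * s + 2 * (s * s)) + 4 * (s * s)) + 1        ≡⟨ eq₂ s ⟩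
    5 * (2 * s + 2 * (s * s) + (s * s + 1))                          ∎
    where
    eq₁ : ∀ s → 7 * (2 * s + 2 * (s * s)) ≡ 2 * (s * 2) + (5 * (2 * s + 2 * (s * s)) + 4 * (s * s))
    eq₁ = solve-∀
    eq₂ : ∀ s → s * s + 4 + (5 * (2 * s + 2 * (s * s)) + 4 * (s * s)) + 1 ≡ 5 * (2 * s + 2 * (s * s) + (s * s + 1))
    eq₂ = solve-∀

  -- The demand is 1 + s / (2(s + 1)) = 1 + s² / q; the exponent exceeds it by 1 / q, whence the
  -- surplus 2(s + 1).
  exponentₛ : (suc (2 * s) + suc s) * q ≤ (2 * suc s) * w
  exponentₛ = ≤-trans (m≤m+n _ (2 * suc s)) (≤-reflexive (eq s))
    where
    eq : ∀ s → (suc (2 * s) + suc s) * (2 * s + 2 * (s * s)) + 2 * suc s ≡ 2 * suc s * (2 * s + 2 * (s * s) + (s * s + 1))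
    eq = solve-∀

summand₁ : ∀ a b c d → a ≤ suc (a + (b + (c + d)))
summand₁ a b c d = m≤n⇒m≤1+n (m≤m+n a _)

summand₂ : ∀ a b c d → b ≤ suc (a + (b + (c + d)))
summand₂ a b c d = m≤n⇒m≤1+n (≤-trans (m≤m+n b _) (m≤n+m _ a))

summand₃ : ∀ a b c d → c ≤ suc (a + (b + (c + d)))
summand₃ a b c d = m≤n⇒m≤1+n (≤-trans (m≤m+n c d) (≤-trans (m≤n+m _ b) (m≤n+m _ a)))

summand₄ : ∀ a b c d → d ≤ suc (a + (b + (c + d)))
summand₄ a b c d = m≤n⇒m≤1+n (≤-trans (m≤n+m d c) (≤-trans (m≤n+m _ b) (m≤n+m _ a)))

module Constant (s t : ℕ) where

  -- A factor 2 ^ p is lost to the cut and 4 ^ (p + k) to the choice of a level.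
  b₁ b₃ b₅ bₛ : ℕ
  b₁ = 2 ^ 1 * (4 ^ 2 * c₁ s t)
  b₃ = 2 ^ 3 * (4 ^ 5 * c₃ s t)
  b₅ = 2 ^ 5 * (4 ^ 7 * c₅ s t)
  bₛ = 2 ^ (2 * suc s) * (4 ^ (2 * suc s + suc s) * cₛ s t)

  opaque
    C₀ : ℕ
    C₀ = suc (b₁ + (b₃ + (b₅ + bₛ)))

    1≤C₀ : 1 ≤ C₀
    1≤C₀ = s≤s z≤n

    b₁≤C₀ : b₁ ≤ C₀
    b₁≤C₀ = summand₁ b₁ b₃ b₅ bₛ

    b₃≤C₀ : b₃ ≤ C₀
    b₃≤C₀ = summand₂ b₁ b₃ b₅ bₛ

    b₅≤C₀ : b₅ ≤ C₀
    b₅≤C₀ = summand₃ b₁ b₃ b₅ bₛ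

    bₛ≤C₀ : bₛ ≤ C₀
    bₛ≤C₀ = summand₄ b₁ b₃ b₅ bₛ

-- Raising to the power q, the denominator of the exponent, keeps a rational exponent within ℕ.
theorem1p4 : ∀ (s t : ℕ) → 3 ≤ s → s ≤ t →
    ∃[ C ] ∀ (n : ℕ) (G : Graph n) → FFree s t G →
    edgeCount G ^ (2 * s + 2 * (s * s))
    ≤ C ^ (2 * s + 2 * (s * s)) * n ^ ((2 * s + 2 * (s * s)) + (s * s + 1))
theorem1p4 (suc s′) t 3≤s s≤t = Constant.C₀ (suc s′) t , edges≤
  where
  s : ℕ
  s = suc s′
  open Exponents s using (q; w; exponent₁; exponent₃; exponent₅; exponentₛ)
  2≤t : 2 ≤ t
  2≤t = ≤-trans (n≤1+n 2) (≤-trans 3≤s s≤t)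
  open Constant s t
  edges≤ : ∀ n (G : Graph n) → FFree s t G → edgeCount G ^ q ≤ C₀ ^ q * n ^ w
  -- Without vertices the left side is 0 ^ q with q ≥ 1.
  edges≤ zero G free = z≤n
  edges≤ (suc n′) G free = ≮⇒≥ contra
    where
    n⁺ : ℕ
    n⁺ = suc n′
    best : ∃ λ side → forward (adj G) ≤ 2 * cut side (adj G)
    best = maxCut (adj G) (Defs.sym G)
    side : Fin n⁺ → Bool
    side = proj₁ best
    E? : ∀ u v → Dec (Crossing side (adj G) u v)
    E? = crossing? side (adj G)
    e : ℕ
    e = sum λ b → # λ u → E? u b
    noConfig : ¬ Config s t (Crossing side (adj G))
    noConfig = FFree⇒¬Config G (proj₂ ∘ proj₂) (λ (_ , p , _) (q , _) → contradiction (trans (sym p) q) λ ()) free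
    count≤2e : edgeCount G ≤ 2 * e
    count≤2e = ≤-trans (≤-reflexive (edgeCount-≡ G)) (≤-trans (proj₂ best) (≤-reflexive (cong (2 *_) (∑-comm λ u v → 𝟙 (E? u v)))))
    contra : ¬ (C₀ ^ q * n⁺ ^ w < edgeCount G ^ q)
    contra large = Regularise.sparse s′ t 2≤t E? noConfig
      (grow 1 1 (4 ^ 2 * c₁ s t) (s≤s z≤n) exponent₁ b₁≤C₀)
      (grow 3 4 (4 ^ 5 * c₃ s t) (s≤s z≤n) exponent₃ b₃≤C₀)
      (grow 5 7 (4 ^ 7 * c₅ s t) (s≤s z≤n) exponent₅ b₅≤C₀)
      (grow (2 * suc s) (suc (2 * s) + suc s) (4 ^ (2 * suc s + suc s) * cₛ s t) (s≤s z≤n) exponentₛ bₛ≤C₀)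
      where
      grow : ∀ p u c → 1 ≤ p → u * q ≤ p * w → 2 ^ p * c ≤ C₀ → c * n⁺ ^ u ≤ e ^ p
      grow p u c 1≤p exponent c≤C₀ = growth {e} {edgeCount G} {n⁺} {C₀} q w p u c (s≤s z≤n) 1≤p (s≤s z≤n) 1≤C₀
        count≤2e (<⇒≤ large) exponent c≤C₀
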